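{- Let $k\ge1$, $n\ge2k+2$. The $(k+1)$-free subsets of $\binom{[n]}{2}$ are independent in the algebraic matroid of $\mathcal{P}f_k(n)$, and $k$-triangulations are bases of it.
   Context: Edges $\{i,j\},\{i',j'\}\in\binom{[n]}{2}$ with $i<j$, $i'<j'$ cross if $i<i'<j<j'$ or $i'<i<j'<j$. A $(k+1)$-crossing is a set of $k+1$ mutually crossing edges; a subset of $\binom{[n]}{2}$ is $(k+1)$-free if it contains no $(k+1)$-crossing; a $k$-triangulation is a maximal $(k+1)$-free subset. Let $\mathbb{K}$ be a field. For $U\subset[n]$ with $|U|=2k+2$, the Pfaffian of degree $k+1$ of $U$ is $\sum_E(-1)^{\mathrm{cr}(E)}\prod_{\{i,j\}\in E}x_{i,j}$ over perfect matchings $E$ of $U$, where $\mathrm{cr}(E)$ is the number of crossing pairs in $E$. $I_k(n)\subset\mathbb{K}[x_{i,j}:\{i,j\}\in\binom{[n]}{2}]$ is the (prime) ideal generated by all these Pfaffians, and $\mathcal{P}f_k(n)\subset\mathbb{K}^{\binom{[n]}{2}}$ is its variety: antisymmetric $n\times n$ matrices of rank at most $2k$. The algebraic matroid of $\mathcal{P}f_k(n)$ is the matroid of the prime ideal $I_k(n)$: its ground set is the set of variables $x_{i,j}$ (identified with $\binom{[n]}{2}$), and a subset $S$ is independent if $I_k(n)$ contains no nonzero polynomial involving only the variables in $S$. -}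

module Defs where

open import Algebra.Apartness.Bundles using (HeytingField; module HeytingCommutativeRing)
open import Algebra.Bundles using (CommutativeRing)
import Algebra.Properties.Semiring.Exp as Exp
open import Data.Bool.Base using (if_then_else_)
open import Data.Fin.Base using (Fin; _<_)
open import Data.Fin.Properties as Fin using (_<?_; <-irrelevant; all?)
open import Data.Fin.Subset as Subset using (Subset; ∣_∣)
import Data.Fin.Subset.Properties as Subset
open import Data.List.Base using (List; []; _∷_; _++_; map; mapMaybe; filter; foldr; length; allFin; cartesianProduct; cartesianProductWith)
open import Data.List.Relation.Unary.All as All using (All)
open import Data.List.Relation.Unary.AllPairs using (AllPairs)
open import Data.Maybe.Base as Maybe using (Maybe)
open import Data.Nat.Base as ℕ using (ℕ; suc)
import Data.Nat.Properties as ℕ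
open import Data.Product.Base using (_×_; _,_; ∃-syntax)
open import Data.Sum.Base using (_⊎_)
open import Level using (Level; 0ℓ; _⊔_) renaming (suc to lsuc)
open import Relation.Binary.Definitions using (DecidableEquality)
open import Relation.Binary.PropositionalEquality.Core using (_≡_; _≢_; refl)
open import Relation.Nullary using (¬_; Dec; yes; no; does)
open import Relation.Nullary.Decidable using (_×-dec_; _⊎-dec_; _→-dec_; ¬?; dec⇒maybe)
open import Relation.Unary using (Pred; _∈_; _⊆_)

Maximal : ∀ {a p} {A : Set a} → Pred (Pred A 0ℓ) p → Pred (Pred A 0ℓ) (a ⊔ p ⊔ lsuc 0ℓ)
Maximal P S = P S × (∀ T → P T → S ⊆ T → T ⊆ S)

------------------------------------------------------------------------
-- Edges and crossings

record Edge (n : ℕ) : Set where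
  constructor edge
  field
    lo hi : Fin n
    lo<hi : lo < hi

open Edge public

EdgeSet : ℕ → Set₁
EdgeSet n = Pred (Edge n) 0ℓ

module _ {n : ℕ} where

  infix 4 _≟ᵉ_

  _≟ᵉ_ : DecidableEquality (Edge n)
  edge i j p ≟ᵉ edge i′ j′ q with i Fin.≟ i′ | j Fin.≟ j′
  ... | no i≢i′  | _        = no λ { refl → i≢i′ refl }
  ... | yes _    | no j≢j′  = no λ { refl → j≢j′ refl }
  ... | yes refl | yes refl with refl ← <-irrelevant p q = yes refl

  Cross : Edge n → Edge n → Set
  Cross e f = (lo e < lo f × lo f < hi e × hi e < hi f)
            ⊎ (lo f < lo e × lo e < hi f × hi f < hi e)

  cross? : ∀ e f → Dec (Cross e f)
  cross? e f = (lo e <? lo f ×-dec lo f <? hi e ×-dec hi e <? hi f)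
         ⊎-dec (lo f <? lo e ×-dec lo e <? hi f ×-dec hi f <? hi e)

  -- Cross is irreflexive and symmetric, so such a list has no repetitions
  -- and lists a set of m mutually crossing edges.
  IsCrossing : ℕ → List (Edge n) → Set
  IsCrossing m E = length E ≡ m × AllPairs Cross E

  CrossingFree : ℕ → EdgeSet n → Set
  CrossingFree m S = ¬ (∃[ E ] IsCrossing m E × All (_∈ S) E)

  IsTriangulation : ℕ → EdgeSet n → Set₁
  IsTriangulation k = Maximal (CrossingFree (suc k))

  Incident : Fin n → Edge n → Set
  Incident v e = v ≡ lo e ⊎ v ≡ hi e

  incident? : ∀ v e → Dec (Incident v e)
  incident? v e = v Fin.≟ lo e ⊎-dec v Fin.≟ hi e

  degree : Fin n → List (Edge n) → ℕ
  degree v E = length (filter (incident? v) E)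

  PerfectMatching : Subset n → List (Edge n) → Set
  PerfectMatching U E = ∀ v → (v Subset.∈ U → degree v E ≡ 1)
                            × (¬ (v Subset.∈ U) → degree v E ≡ 0)

  perfectMatching? : ∀ U E → Dec (PerfectMatching U E)
  perfectMatching? U E = all? λ v →
          (v Subset.∈? U →-dec (degree v E ℕ.≟ 1))
    ×-dec (¬? (v Subset.∈? U) →-dec (degree v E ℕ.≟ 0))

  cr : List (Edge n) → ℕ
  cr []      = 0
  cr (e ∷ E) = length (filter (cross? e) E) ℕ.+ cr E

sublists : ∀ {a} {A : Set a} → List A → List (List A)
sublists []       = [] ∷ []
sublists (x ∷ xs) = map (x ∷_) (sublists xs) ++ sublists xs

allEdges : ∀ n → List (Edge n)
allEdges n = mapMaybe toEdge (cartesianProduct (allFin n) (allFin n))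
  where
  toEdge : Fin n × Fin n → Maybe (Edge n)
  toEdge (i , j) = Maybe.map (edge i j) (dec⇒maybe (i <? j))

-- allEdges n has no repetitions, so each set of edges is listed exactly once
-- among its sublists.
perfectMatchings : ∀ {n} → Subset n → List (List (Edge n))
perfectMatchings {n} U = filter (perfectMatching? U) (sublists (allEdges n))

------------------------------------------------------------------------
-- Monomials in the variables x_e, given by their exponents

Monomial : ℕ → Set
Monomial n = Edge n → ℕ

module _ {n : ℕ} where

  infixl 7 _·_
  infix  4 _≐_ _≐?_

  _≐_ : Monomial n → Monomial n → Set
  m ≐ m′ = All (λ e → m e ≡ m′ e) (allEdges n)

  _≐?_ : ∀ m m′ → Dec (m ≐ m′)
  m ≐? m′ = All.all? (λ e → m e ℕ.≟ m′ e) (allEdges n)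

  one : Monomial n
  one _ = 0

  _·_ : Monomial n → Monomial n → Monomial n
  (m · m′) e = m e ℕ.+ m′ e

  var : Edge n → Monomial n
  var e f = if does (e ≟ᵉ f) then 1 else 0

------------------------------------------------------------------------
-- The polynomial ring in the variables x_e over a field

-- A Heyting field has a tight apartness # for which x # y holds exactly when
-- x - y is invertible (so 0 and 1 are distinct); classically # is the negation
-- of ≈ and this is just a field.

module _ {c ℓ₁ ℓ₂ : Level} (K : HeytingField c ℓ₁ ℓ₂) (n : ℕ) where

  private
    module K = HeytingField K
    ring = HeytingCommutativeRing.commutativeRing K.heytingCommutativeRing

  open Exp (CommutativeRing.semiring ring) using (_^_)

  -- A polynomial is a formal sum of terms; the same monomial may occur in
  -- several terms, and terms may have coefficient zero.
  Poly : Set c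
  Poly = List (K.Carrier × Monomial n)

  coeff : Poly → Monomial n → K.Carrier
  coeff []            m = K.0#
  coeff ((a , m′) ∷ p) m = (if does (m′ ≐? m) then a else K.0#) K.+ coeff p m

  _≈ᵖ_ : Poly → Poly → Set ℓ₁
  p ≈ᵖ q = ∀ m → coeff p m K.≈ coeff q m

  0ᵖ : Poly
  0ᵖ = []

  _+ᵖ_ : Poly → Poly → Poly
  _+ᵖ_ = _++_

  _*ᵖ_ : Poly → Poly → Poly
  _*ᵖ_ = cartesianProductWith λ { (a , m) (b , m′) → a K.* b , m · m′ }

  data IdealGenerated {g : Level} (G : Pred Poly g) : Pred Poly (c ⊔ ℓ₁ ⊔ g) where
    generator : ∀ {p} → p ∈ G → p ∈ IdealGenerated G
    zero      : 0ᵖ ∈ IdealGenerated G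
    add       : ∀ {p q} → p ∈ IdealGenerated G → q ∈ IdealGenerated G → (p +ᵖ q) ∈ IdealGenerated G
    multiple  : ∀ r {p} → p ∈ IdealGenerated G → (r *ᵖ p) ∈ IdealGenerated G
    respects  : ∀ {p q} → p ≈ᵖ q → p ∈ IdealGenerated G → q ∈ IdealGenerated G

  pfaffian : Subset n → Poly
  pfaffian U = map (λ E → ((K.- K.1#) ^ cr E) , foldr _·_ one (map var E)) (perfectMatchings U)

  IsPfaffian : ℕ → Pred Poly c
  IsPfaffian d p = ∃[ U ] (∣ U ∣ ≡ 2 ℕ.* d × p ≡ pfaffian U)

  PfaffianIdeal : ℕ → Pred Poly (c ⊔ ℓ₁)
  PfaffianIdeal k = IdealGenerated (IsPfaffian (suc k))

  Involves : Poly → Edge n → Set ℓ₁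
  Involves p e = ∃[ m ] (¬ (coeff p m K.≈ K.0#) × m e ≢ 0)

  Independent : ℕ → EdgeSet n → Set (c ⊔ ℓ₁)
  Independent k S = ¬ (∃[ p ] p ∈ PfaffianIdeal k × ¬ (p ≈ᵖ 0ᵖ) × Involves p ⊆ S)

  IsBasis : ℕ → EdgeSet n → Set (lsuc 0ℓ ⊔ c ⊔ ℓ₁)
  IsBasis k = Maximal (Independent k)

{-# OPTIONS --safe #-}
-- Independence.  The Pfaffians of degree k + 1 vanish at every sum of k decomposable bivectors, being
-- coefficients of its exponential.  Let f in the ideal involve only edges of a crossing-free set S.  Taking
-- lowest-order coefficients in a power series parameter passes from f to a nonempty subset of its terms
-- which vanishes at the strictly upper triangular parts of matrices of rank k and is homogeneous in each
-- column.  The columns of such a matrix carry the letters of a word, and the pairs i < j are processed by a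
-- bubble sort that has no comparators at the pairs in S.  At (i , j) either two letters are exchanged, which
-- happens only off S, where the exponent of the variable is 0; or a shear by the parameter followed by
-- another passage to lowest order makes the exponent of the variable the same in all remaining terms.  The
-- network sorts the word exactly because S is crossing-free.  At the end a single term is left, and its
-- coefficient would have to vanish.
--
-- Bases.  Each exchange removes one ascent of the word, so the complement of a maximal crossing-free set
-- has as many elements as the initial word has ascents, and that of any crossing-free set at least as many.
-- A Pfaffian rewrites a (k + 1)-crossing into matchings of smaller weight; hence modulo the ideal the
-- monomials with crossing-free support span.  Up to a given degree they are outnumbered by the monomials in
-- any N + 1 variables, where N is the size of the k-triangulations, so N + 1 variables are dependent.

module Submission where

open import Defs
open import Algebra.Apartness.Bundles using (HeytingField; module HeytingCommutativeRing)
open import Algebra.Bundles using (CommutativeMonoid; CommutativeRing)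
import Algebra.Properties.CommutativeSemigroup as SemigroupProperties
import Algebra.Properties.Ring as RingProperties
import Algebra.Properties.CommutativeSemiring.Exp as CommutativeExp
import Algebra.Properties.Semiring.Exp as Exp
import Algebra.Solver.Ring.NaturalCoefficients.Default as SemiringSolver
open import Data.Bool.Base using (Bool; true; false; if_then_else_; _∨_; not)
import Data.Bool.Properties as Bool
open import Data.Empty using (⊥)
open import Data.Fin.Base as Fin using (Fin; toℕ; zero; suc)
import Data.Fin.Properties as Fin
open import Data.Fin.Subset as Subset using (Subset; ∣_∣)
import Data.Fin.Subset.Properties as Subset
open import Data.List.Base using (List; []; _∷_; _++_; map; mapMaybe; filter; foldr; length; allFin; cartesianProduct; cartesianProductWith; drop; upTo; concatMap; _ʳ++_)
open import Data.List.Membership.Propositional as List using () renaming (_∈_ to _∈ˡ_)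
import Data.List.Membership.Propositional.Properties as List
import Data.List.Properties as List
open import Data.List.Relation.Unary.All as All using (All; []; _∷_)
import Data.List.Relation.Unary.All.Properties as All
open import Data.List.Relation.Unary.AllPairs as AllPairs using (AllPairs; []; _∷_)
import Data.List.Relation.Unary.AllPairs.Properties as AllPairs
open import Data.List.Relation.Unary.Any as Any using (Any; here; there)
import Data.List.Relation.Unary.Any.Properties as Any
open import Data.List.Relation.Unary.Unique.Propositional using (Unique)
import Data.List.Relation.Unary.Unique.Propositional.Properties as Unique
open import Data.Maybe.Base as Maybe using (Maybe; just; nothing)
open import Data.Nat.Base as ℕ using (ℕ; zero; suc; z≤n; s≤s)
import Data.Nat.Properties as ℕ
open import Data.Nat.Solver using (module +-*-Solver)
open import Data.Product.Base using (Σ; _×_; _,_; proj₁; proj₂; ∃-syntax)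
open import Data.Sum.Base as Sum using (_⊎_; inj₁; inj₂)
open import Data.Unit.Base using (⊤)
open import Data.Unit.Polymorphic.Base as Poly using ()
open import Data.Vec.Functional as VecF using (insertAt)
open import Data.Vec.Functional.Properties using (insertAt-lookup; insertAt-punchIn)
open import Data.Vec.Properties using (lookup∘update; lookup∘update′; []=⇒lookup; lookup⇒[]=; lookup∘tabulate)
open import Data.Vec.Base as Vec using (Vec; []; _∷_)
open import Function.Base using (_∘_; id; case_of_)
open import Level using (0ℓ; _⊔_; Lift; lift) renaming (suc to lsuc)
open import Relation.Binary.Definitions using (Tri; tri<; tri≈; tri>)
open import Relation.Binary.PropositionalEquality.Core using (_≡_; _≢_; refl; sym; trans; cong; cong₂; subst; subst₂)
open import Relation.Nullary using (¬_; Dec; yes; no; does; contradiction)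
open import Relation.Nullary.Decidable using (dec-true; dec-false; ¬?; dec⇒maybe; _⊎-dec_; _×-dec_)
open import Relation.Unary using (Pred; _∈_)

module Big {a ℓ} (M : CommutativeMonoid a ℓ) where
  open CommutativeMonoid M renaming (refl to ≈-refl; sym to ≈-sym; trans to ≈-trans)
  open SemigroupProperties commutativeSemigroup using (interchange)

  fold : ∀ {b} {B : Set b} → (B → Carrier) → List B → Carrier
  fold f []       = ε
  fold f (x ∷ xs) = f x ∙ fold f xs

  module _ {b} {B : Set b} where

    fold-cong∈ : ∀ {f g : B → Carrier} xs → (∀ {x} → x ∈ˡ xs → f x ≈ g x) → fold f xs ≈ fold g xs
    fold-cong∈ []       eq = ≈-refl
    fold-cong∈ (x ∷ xs) eq = ∙-cong (eq (here refl)) (fold-cong∈ xs (eq ∘ there))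

    fold-cong : ∀ {f g : B → Carrier} xs → (∀ x → f x ≈ g x) → fold f xs ≈ fold g xs
    fold-cong xs eq = fold-cong∈ xs (λ {x} _ → eq x)

    fold-ε : ∀ {f : B → Carrier} xs → (∀ {x} → x ∈ˡ xs → f x ≈ ε) → fold f xs ≈ ε
    fold-ε []       eq = ≈-refl
    fold-ε (x ∷ xs) eq = ≈-trans (∙-cong (eq (here refl)) (fold-ε xs (eq ∘ there))) (identityˡ ε)

    fold-∙ : ∀ (f g : B → Carrier) xs → fold (λ x → f x ∙ g x) xs ≈ fold f xs ∙ fold g xs
    fold-∙ f g []       = ≈-sym (identityˡ ε)
    fold-∙ f g (x ∷ xs) = ≈-trans (∙-congˡ (fold-∙ f g xs)) (interchange _ _ _ _)

    fold-++ : ∀ (f : B → Carrier) xs ys → fold f (xs ++ ys) ≈ fold f xs ∙ fold f ys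
    fold-++ f []       ys = ≈-sym (identityˡ _)
    fold-++ f (x ∷ xs) ys = ≈-trans (∙-congˡ (fold-++ f xs ys)) (≈-sym (assoc _ _ _))

    fold-filter : ∀ {p} {P : Pred B p} (P? : ∀ x → Dec (P x)) (f : B → Carrier) xs →
      fold f (filter P? xs) ≈ fold (λ x → if does (P? x) then f x else ε) xs
    fold-filter P? f [] = ≈-refl
    fold-filter P? f (x ∷ xs) with does (P? x)
    ... | true  = ∙-congˡ (fold-filter P? f xs)
    ... | false = ≈-trans (fold-filter P? f xs) (≈-sym (identityˡ _))

    fold-single : ∀ {f : B → Carrier} {xs x} → Unique xs → x ∈ˡ xs → (∀ y → y ≢ x → f y ≈ ε) → fold f xs ≈ f x
    fold-single (x∉ ∷ _) (here refl) eq =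
      ≈-trans (∙-congˡ (fold-ε _ (λ y∈ → eq _ (All.lookup x∉ y∈ ∘ sym)))) (identityʳ _)
    fold-single (y∉ ∷ u) (there x∈)  eq =
      ≈-trans (∙-cong (eq _ (All.lookup y∉ x∈)) (fold-single u x∈ eq)) (identityˡ _)

  fold-map : ∀ {b d} {B : Set b} {D : Set d} (f : D → Carrier) (h : B → D) xs → fold f (map h xs) ≡ fold (f ∘ h) xs
  fold-map f h []       = refl
  fold-map f h (x ∷ xs) = cong (f (h x) ∙_) (fold-map f h xs)

  fold-swap : ∀ {b d} {B : Set b} {D : Set d} (f : B → D → Carrier) xs ys →
    fold (λ x → fold (f x) ys) xs ≈ fold (λ y → fold (λ x → f x y) xs) ys
  fold-swap f []       ys = ≈-sym (fold-ε ys (λ _ → ≈-refl))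
  fold-swap f (x ∷ xs) ys = ≈-trans (∙-congˡ (fold-swap f xs ys)) (≈-sym (fold-∙ (f x) _ ys))

-- Power series over a commutative ring

module PowerSeries {c ℓ} (F : CommutativeRing c ℓ) where
  open CommutativeRing F hiding (zero) renaming (refl to ≈-refl; sym to ≈-sym; trans to ≈-trans)
  open SemigroupProperties +-commutativeSemigroup using (interchange)
  private module * = SemigroupProperties *-commutativeSemigroup

  Series : Set c
  Series = ℕ → Carrier

  infix  4 _≋_
  infixl 7 _⊛_

  _≋_ : Series → Series → Set ℓ
  f ≋ g = ∀ n → f n ≈ g n

  const : Carrier → Series
  const a zero    = a
  const a (suc n) = 0#

  _⊛_ : Series → Series → Series
  (f ⊛ g) zero    = f 0 * g 0
  (f ⊛ g) (suc n) = f 0 * g (suc n) + (f ∘ suc ⊛ g) n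

  ⊛-cong : ∀ {f f′ g g′} → f ≋ f′ → g ≋ g′ → f ⊛ g ≋ f′ ⊛ g′
  ⊛-cong p q zero    = *-cong (p 0) (q 0)
  ⊛-cong p q (suc n) = +-cong (*-cong (p 0) (q (suc n))) (⊛-cong (p ∘ suc) q n)

  ⊛-distribʳ : ∀ h f g n → ((λ i → f i + g i) ⊛ h) n ≈ (f ⊛ h) n + (g ⊛ h) n
  ⊛-distribʳ h f g zero    = distribʳ _ _ _
  ⊛-distribʳ h f g (suc n) =
    ≈-trans (+-cong (distribʳ _ _ _) (⊛-distribʳ h (f ∘ suc) (g ∘ suc) n)) (interchange _ _ _ _)

  ⊛-sucʳ : ∀ f g n → (f ⊛ g) (suc n) ≈ (f ⊛ g ∘ suc) n + f (suc n) * g 0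
  ⊛-sucʳ f g zero    = ≈-refl
  ⊛-sucʳ f g (suc n) = ≈-trans (+-congˡ (⊛-sucʳ (f ∘ suc) g n)) (≈-sym (+-assoc _ _ _))

  ⊛-comm : ∀ f g n → (f ⊛ g) n ≈ (g ⊛ f) n
  ⊛-comm f g zero    = *-comm _ _
  ⊛-comm f g (suc n) = ≈-trans (+-cong (*-comm _ _) (⊛-comm (f ∘ suc) g n))
    (≈-trans (+-comm _ _) (≈-sym (⊛-sucʳ g f n)))

  ⊛-scale : ∀ a f g n → ((λ i → a * f i) ⊛ g) n ≈ a * (f ⊛ g) n
  ⊛-scale a f g zero    = *-assoc _ _ _
  ⊛-scale a f g (suc n) = ≈-trans (+-cong (*-assoc _ _ _) (⊛-scale a (f ∘ suc) g n)) (≈-sym (distribˡ _ _ _))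

  ⊛-assoc : ∀ f g h n → ((f ⊛ g) ⊛ h) n ≈ (f ⊛ (g ⊛ h)) n
  ⊛-assoc f g h zero    = *-assoc _ _ _
  ⊛-assoc f g h (suc n) =
    ≈-trans (+-congˡ (⊛-distribʳ h (λ i → f 0 * g (suc i)) (f ∘ suc ⊛ g) n))
   (≈-trans (+-cong (*-assoc _ _ _) (+-cong (⊛-scale (f 0) (g ∘ suc) h n) (⊛-assoc (f ∘ suc) g h n)))
   (≈-trans (≈-sym (+-assoc _ _ _)) (+-congʳ (≈-sym (distribˡ _ _ _)))))

  ⊛-zeroˡ : ∀ {f} → (∀ i → f i ≈ 0#) → ∀ g n → (f ⊛ g) n ≈ 0#
  ⊛-zeroˡ z g zero    = ≈-trans (*-congʳ (z 0)) (zeroˡ _)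
  ⊛-zeroˡ z g (suc n) = ≈-trans (+-cong (≈-trans (*-congʳ (z 0)) (zeroˡ _)) (⊛-zeroˡ (z ∘ suc) g n)) (+-identityˡ 0#)

  ⊛-constˡ : ∀ a g n → (const a ⊛ g) n ≈ a * g n
  ⊛-constˡ a g zero    = ≈-refl
  ⊛-constˡ a g (suc n) = ≈-trans (+-congˡ (⊛-zeroˡ (λ _ → ≈-refl) g n)) (+-identityʳ _)

  ⊛-identityˡ : ∀ f n → (const 1# ⊛ f) n ≈ f n
  ⊛-identityˡ f n = ≈-trans (⊛-constˡ 1# f n) (*-identityˡ _)

  series : CommutativeRing c ℓ
  series = record
    { Carrier = Series
    ; _≈_ = _≋_
    ; _+_ = λ f g i → f i + g i
    ; _*_ = _⊛_
    ; -_  = λ f i → - f i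
    ; 0#  = λ _ → 0#
    ; 1#  = const 1#
    ; isCommutativeRing = record
      { isRing = record
        { +-isAbelianGroup = record
          { isGroup = record
            { isMonoid = record
              { isSemigroup = record
                { isMagma = record
                  { isEquivalence = record
                    { refl  = λ _ → ≈-refl
                    ; sym   = λ p n → ≈-sym (p n)
                    ; trans = λ p q n → ≈-trans (p n) (q n)
                    }
                  ; ∙-cong = λ p q n → +-cong (p n) (q n)
                  }
                ; assoc = λ f g h n → +-assoc _ _ _
                }
              ; identity = (λ f n → +-identityˡ _) , (λ f n → +-identityʳ _)
              }
            ; inverse = (λ f n → -‿inverseˡ _) , (λ f n → -‿inverseʳ _)
            ; ⁻¹-cong = λ p n → -‿cong (p n)
            }
          ; comm = λ f g n → +-comm _ _
          }
        ; *-cong = ⊛-cong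
        ; *-assoc = ⊛-assoc
        ; *-identity = ⊛-identityˡ , λ f n → ≈-trans (⊛-comm f _ n) (⊛-identityˡ f n)
        ; distrib = (λ h f g n → ≈-trans (⊛-comm h _ n) (≈-trans (⊛-distribʳ h f g n) (+-cong (⊛-comm f h n) (⊛-comm g h n))))
                  , ⊛-distribʳ
        }
      ; *-comm = ⊛-comm
      }
    }

  X : Series
  X zero          = 0#
  X (suc zero)    = 1#
  X (suc (suc _)) = 0#

  X⊛-suc : ∀ f n → (X ⊛ f) (suc n) ≈ f n
  X⊛-suc f n = ≈-trans (+-cong (zeroˡ _) (≈-trans (⊛-cong {f = X ∘ suc} {f′ = const 1#} X∘suc (λ _ → ≈-refl) n) (⊛-identityˡ f n))) (+-identityˡ _)
    where
    X∘suc : X ∘ suc ≋ const 1#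
    X∘suc zero    = ≈-refl
    X∘suc (suc _) = ≈-refl

  const-* : ∀ a b → const (a * b) ≋ const a ⊛ const b
  const-* a b zero    = ≈-refl
  const-* a b (suc n) = ≈-sym (≈-trans (⊛-constˡ a (const b) (suc n)) (zeroʳ a))

record Hom {a b p q} (A : CommutativeRing a p) (B : CommutativeRing b q) : Set (a ⊔ b ⊔ p ⊔ q) where
  private
    module A = CommutativeRing A
    module B = CommutativeRing B
  field
    ⟦_⟧    : A.Carrier → B.Carrier
    ⟦⟧-cong : ∀ {x y} → x A.≈ y → ⟦ x ⟧ B.≈ ⟦ y ⟧
    ⟦⟧-+    : ∀ x y → ⟦ x A.+ y ⟧ B.≈ ⟦ x ⟧ B.+ ⟦ y ⟧
    ⟦⟧-*    : ∀ x y → ⟦ x A.* y ⟧ B.≈ ⟦ x ⟧ B.* ⟦ y ⟧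
    ⟦⟧-0    : ⟦ A.0# ⟧ B.≈ B.0#
    ⟦⟧-1    : ⟦ A.1# ⟧ B.≈ B.1#

  ⟦⟧-neg : ∀ x → ⟦ A.- x ⟧ B.≈ B.- ⟦ x ⟧
  ⟦⟧-neg x = RingProperties.+-cancelʳ B.ring ⟦ x ⟧ _ _
    (B.trans (B.sym (⟦⟧-+ _ _)) (B.trans (⟦⟧-cong (A.-‿inverseˡ x)) (B.trans ⟦⟧-0 (B.sym (B.-‿inverseˡ _)))))

id-hom : ∀ {a p} (A : CommutativeRing a p) → Hom A A
id-hom A = record { ⟦_⟧ = id ; ⟦⟧-cong = id ; ⟦⟧-+ = λ _ _ → A.refl ; ⟦⟧-* = λ _ _ → A.refl ; ⟦⟧-0 = A.refl ; ⟦⟧-1 = A.refl }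
  where module A = CommutativeRing A

_∘-hom_ : ∀ {a b d p q r} {A : CommutativeRing a p} {B : CommutativeRing b q} {D : CommutativeRing d r} → Hom B D → Hom A B → Hom A D
_∘-hom_ {D = D} g f = record
  { ⟦_⟧ = g.⟦_⟧ ∘ f.⟦_⟧
  ; ⟦⟧-cong = g.⟦⟧-cong ∘ f.⟦⟧-cong
  ; ⟦⟧-+ = λ x y → D.trans (g.⟦⟧-cong (f.⟦⟧-+ x y)) (g.⟦⟧-+ _ _)
  ; ⟦⟧-* = λ x y → D.trans (g.⟦⟧-cong (f.⟦⟧-* x y)) (g.⟦⟧-* _ _)
  ; ⟦⟧-0 = D.trans (g.⟦⟧-cong f.⟦⟧-0) g.⟦⟧-0
  ; ⟦⟧-1 = D.trans (g.⟦⟧-cong f.⟦⟧-1) g.⟦⟧-1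
  }
  where
  module D = CommutativeRing D
  module f = Hom f
  module g = Hom g

module _ {c ℓ} (F : CommutativeRing c ℓ) where
  open CommutativeRing F hiding (zero) renaming (refl to ≈-refl; sym to ≈-sym; trans to ≈-trans)
  open PowerSeries F

  const-hom : Hom F series
  const-hom = record
    { ⟦_⟧ = const
    ; ⟦⟧-cong = λ { p zero → p ; p (suc n) → ≈-refl }
    ; ⟦⟧-+ = λ { x y zero → ≈-refl ; x y (suc n) → ≈-sym (+-identityˡ 0#) }
    ; ⟦⟧-* = const-*
    ; ⟦⟧-0 = λ { zero → ≈-refl ; (suc n) → ≈-refl }
    ; ⟦⟧-1 = λ _ → ≈-refl
    }

  constantTerm : Hom series F
  constantTerm = record
    { ⟦_⟧ = λ f → f 0
    ; ⟦⟧-cong = λ p → p 0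
    ; ⟦⟧-+ = λ _ _ → ≈-refl
    ; ⟦⟧-* = λ _ _ → ≈-refl
    ; ⟦⟧-0 = ≈-refl
    ; ⟦⟧-1 = ≈-refl
    }

module ℕ-Sum = Big ℕ.+-0-commutativeMonoid

module _ {a b} {A : Set a} {B : Set b} (f : A → Maybe B) where

  ∈-mapMaybe⁺ : ∀ {x y xs} → x ∈ˡ xs → f x ≡ just y → y ∈ˡ mapMaybe f xs
  ∈-mapMaybe⁺ {xs = x ∷ xs} (here refl) eq with f x
  ... | just _ with refl ← eq = here refl
  ∈-mapMaybe⁺ {xs = x ∷ xs} (there x∈) eq with f x
  ... | just _  = there (∈-mapMaybe⁺ x∈ eq)
  ... | nothing = ∈-mapMaybe⁺ x∈ eq

  ∈-mapMaybe⁻ : ∀ {y} xs → y ∈ˡ mapMaybe f xs → ∃[ x ] x ∈ˡ xs × f x ≡ just y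
  ∈-mapMaybe⁻ (x ∷ xs) y∈ with f x in eq
  ∈-mapMaybe⁻ (x ∷ xs) (here refl) | just _ = x , here refl , eq
  ∈-mapMaybe⁻ (x ∷ xs) (there y∈)  | just _ with x′ , x′∈ , eq′ ← ∈-mapMaybe⁻ xs y∈ = x′ , there x′∈ , eq′
  ... | nothing with x′ , x′∈ , eq′ ← ∈-mapMaybe⁻ xs y∈ = x′ , there x′∈ , eq′

  mapMaybe-unique : (∀ {x x′ y} → f x ≡ just y → f x′ ≡ just y → x ≡ x′) → ∀ {xs} → Unique xs → Unique (mapMaybe f xs)
  mapMaybe-unique inj {[]}     []       = []
  mapMaybe-unique inj {x ∷ xs} (x∉ ∷ u) with f x in eq
  ... | nothing = mapMaybe-unique inj u
  ... | just y  = All.tabulate (λ z∈ → λ { refl → let x′ , x′∈ , eq′ = ∈-mapMaybe⁻ xs z∈ in All.lookup x∉ x′∈ (inj eq eq′) })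
                ∷ mapMaybe-unique inj u

edge-≡ : ∀ {n} {e f : Edge n} → lo e ≡ lo f → hi e ≡ hi f → e ≡ f
edge-≡ {e = edge i j p} {edge .i .j q} refl refl = cong (edge i j) (Fin.<-irrelevant p q)

module _ (n : ℕ) where

  private
    toEdge⁻ : ∀ {i j : Fin n} {e} (d : Dec (i Fin.< j)) → Maybe.map (edge i j) (dec⇒maybe d) ≡ just e → (i , j) ≡ (lo e , hi e)
    toEdge⁻ (yes p) refl = refl

    toEdge⁺ : ∀ {i j : Fin n} (p : i Fin.< j) (d : Dec (i Fin.< j)) → Maybe.map (edge i j) (dec⇒maybe d) ≡ just (edge i j p)
    toEdge⁺ p (yes q) = cong just (edge-≡ refl refl)
    toEdge⁺ p (no ¬p) = contradiction p ¬p

  allEdges-unique : Unique (allEdges n)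
  allEdges-unique = mapMaybe-unique _
    (λ { {i , j} {i′ , j′} p q → trans (toEdge⁻ (i Fin.<? j) p) (sym (toEdge⁻ (i′ Fin.<? j′) q)) })
    (Unique.cartesianProduct⁺ (Unique.allFin⁺ n) (Unique.allFin⁺ n))

  ∈-allEdges : ∀ e → e ∈ˡ allEdges n
  ∈-allEdges (edge i j p) = ∈-mapMaybe⁺ _ (List.∈-cartesianProduct⁺ (List.∈-allFin i) (List.∈-allFin j)) (toEdge⁺ p (i Fin.<? j))

module _ {n : ℕ} where

  ≐⇒≗ : ∀ {m m′ : Monomial n} → m ≐ m′ → ∀ e → m e ≡ m′ e
  ≐⇒≗ eq e = All.lookup eq (∈-allEdges n e)

  ≗⇒≐ : ∀ {m m′ : Monomial n} → (∀ e → m e ≡ m′ e) → m ≐ m′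
  ≗⇒≐ eq = All.tabulate (λ {e} _ → eq e)

  var-refl : ∀ (e : Edge n) → var e e ≡ 1
  var-refl e with e ≟ᵉ e
  ... | yes _  = refl
  ... | no e≢e = contradiction refl e≢e

  var-≢ : ∀ (e f : Edge n) → e ≢ f → var e f ≡ 0
  var-≢ e f e≢f with e ≟ᵉ f
  ... | yes e≡f = contradiction e≡f e≢f
  ... | no _    = refl

  wt : (Edge n → ℕ) → Monomial n → ℕ
  wt δ m = ℕ-Sum.fold (λ e → δ e ℕ.* m e) (allEdges n)

  wt-cong : ∀ (δ δ′ : Edge n → ℕ) (m m′ : Monomial n) → (∀ e → δ e ℕ.* m e ≡ δ′ e ℕ.* m′ e) → wt δ m ≡ wt δ′ m′
  wt-cong δ δ′ m m′ eq = ℕ-Sum.fold-cong (allEdges n) eq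

  wt-+ : ∀ δ δ′ m → wt (λ e → δ e ℕ.+ δ′ e) m ≡ wt δ m ℕ.+ wt δ′ m
  wt-+ δ δ′ m = trans (ℕ-Sum.fold-cong (allEdges n) (λ e → ℕ.*-distribʳ-+ (m e) (δ e) (δ′ e))) (ℕ-Sum.fold-∙ _ _ (allEdges n))

  wt-· : ∀ δ m m′ → wt δ (m · m′) ≡ wt δ m ℕ.+ wt δ m′
  wt-· δ m m′ = trans (ℕ-Sum.fold-cong (allEdges n) (λ e → ℕ.*-distribˡ-+ (δ e) (m e) (m′ e))) (ℕ-Sum.fold-∙ _ _ (allEdges n))

  wt-var : ∀ δ e → wt δ (var e) ≡ δ e
  wt-var δ e = trans (ℕ-Sum.fold-single (allEdges-unique n) (∈-allEdges n e) λ f f≢e → trans (cong (δ f ℕ.*_) (var-≢ e f (f≢e ∘ sym))) (ℕ.*-zeroʳ (δ f)))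
    (trans (cong (δ e ℕ.*_) (var-refl e)) (ℕ.*-identityʳ (δ e)))

  wt-var-coefficient : ∀ e m → wt (var e) m ≡ m e
  wt-var-coefficient e m = trans (ℕ-Sum.fold-single (allEdges-unique n) (∈-allEdges n e) λ f f≢e → cong (ℕ._* m f) (var-≢ e f (f≢e ∘ sym)))
    (trans (cong (ℕ._* m e) (var-refl e)) (ℕ.*-identityˡ (m e)))

  edgeProduct : List (Edge n) → Monomial n
  edgeProduct E = foldr _·_ one (map var E)

  wt-edgeProduct : ∀ δ E → wt δ (edgeProduct E) ≡ ℕ-Sum.fold δ E
  wt-edgeProduct δ []      = ℕ-Sum.fold-ε (allEdges n) (λ {e} _ → ℕ.*-zeroʳ (δ e))
  wt-edgeProduct δ (e ∷ E) = trans (wt-· δ (var e) (edgeProduct E)) (cong₂ ℕ._+_ (wt-var δ e) (wt-edgeProduct δ E))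

module MonomialValue {c ℓ} (F : CommutativeRing c ℓ) (n : ℕ) where
  open CommutativeRing F hiding (zero) renaming (refl to ≈-refl; sym to ≈-sym; trans to ≈-trans)
  open CommutativeExp commutativeSemiring using (_^_; ^-congˡ; ^-congʳ; ^-homo-*; ^-distrib-*; ^-assocʳ)
  private module ∏ = Big *-commutativeMonoid

  mon : (Edge n → Carrier) → Monomial n → Carrier
  mon u m = ∏.fold (λ e → u e ^ m e) (allEdges n)

  1^ : ∀ k → 1# ^ k ≈ 1#
  1^ zero    = ≈-refl
  1^ (suc k) = ≈-trans (*-identityˡ _) (1^ k)

  mon-cong : ∀ {u v : Edge n → Carrier} {m m′ : Monomial n} → (∀ e → m e ≡ m′ e) → (∀ e → m e ≡ 0 ⊎ u e ≈ v e) → mon u m ≈ mon v m′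
  mon-cong {u} {v} {m} {m′} eq p = ∏.fold-cong (allEdges n) λ e →
    ≈-trans (Sum.[ (λ z → ≈-trans (^-congʳ (u e) z) (≈-sym (^-congʳ (v e) z))) , ^-congˡ (m e) ]′ (p e)) (^-congʳ (v e) (eq e))

  mon-· : ∀ u m m′ → mon u (m · m′) ≈ mon u m * mon u m′
  mon-· u m m′ = ≈-trans (∏.fold-cong (allEdges n) (λ e → ^-homo-* (u e) (m e) (m′ e))) (∏.fold-∙ _ _ (allEdges n))

  mon-one : ∀ u → mon u one ≈ 1#
  mon-one u = ∏.fold-ε (allEdges n) (λ _ → ≈-refl)

  mon-var : ∀ u e → mon u (var e) ≈ u e
  mon-var u e = ≈-trans (∏.fold-single (allEdges-unique n) (∈-allEdges n e) (λ f f≢e → ^-congʳ (u f) (var-≢ e f (f≢e ∘ sym))))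
    (≈-trans (^-congʳ (u e) (var-refl e)) (*-identityʳ (u e)))

  mon-edgeProduct : ∀ u E → mon u (edgeProduct E) ≈ ∏.fold u E
  mon-edgeProduct u []      = mon-one u
  mon-edgeProduct u (e ∷ E) = ≈-trans (mon-· u (var e) (edgeProduct E)) (*-cong (mon-var u e) (mon-edgeProduct u E))

  mon-scale : ∀ t (δ : Edge n → ℕ) u m → mon (λ e → t ^ δ e * u e) m ≈ t ^ wt δ m * mon u m
  mon-scale t δ u m = ≈-trans
    (∏.fold-cong (allEdges n) (λ e → ≈-trans (^-distrib-* (t ^ δ e) (u e) (m e)) (*-congʳ (^-assocʳ t (δ e) (m e)))))
    (≈-trans (∏.fold-∙ _ _ (allEdges n)) (*-congʳ (powers (allEdges n))))
    where
    powers : ∀ es → ∏.fold (λ e → t ^ (δ e ℕ.* m e)) es ≈ t ^ ℕ-Sum.fold (λ e → δ e ℕ.* m e) es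
    powers []       = ≈-refl
    powers (e ∷ es) = ≈-trans (*-congˡ (powers es)) (≈-sym (^-homo-* t (δ e ℕ.* m e) _))

module _ {a b p q} {A : CommutativeRing a p} {B : CommutativeRing b q} (φ : Hom A B) where
  open Hom φ
  private
    module A = CommutativeRing A
    module B = CommutativeRing B
    module ∏A = Big A.*-commutativeMonoid
    module ∏B = Big B.*-commutativeMonoid
    open Exp A.semiring using () renaming (_^_ to _^A_)
    open Exp B.semiring using () renaming (_^_ to _^B_)

  ⟦⟧-^ : ∀ x k → ⟦ x ^A k ⟧ B.≈ ⟦ x ⟧ ^B k
  ⟦⟧-^ x zero    = ⟦⟧-1
  ⟦⟧-^ x (suc k) = B.trans (⟦⟧-* _ _) (B.*-congˡ (⟦⟧-^ x k))

  ⟦⟧-∏ : ∀ {d} {D : Set d} (f : D → A.Carrier) xs → ⟦ ∏A.fold f xs ⟧ B.≈ ∏B.fold (λ x → ⟦ f x ⟧) xs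
  ⟦⟧-∏ f []       = ⟦⟧-1
  ⟦⟧-∏ f (x ∷ xs) = B.trans (⟦⟧-* _ _) (B.*-congˡ (⟦⟧-∏ f xs))

  ⟦⟧-mon : ∀ {n} (u : Edge n → A.Carrier) (m : Monomial n) →
    ⟦ MonomialValue.mon A n u m ⟧ B.≈ MonomialValue.mon B n (⟦_⟧ ∘ u) m
  ⟦⟧-mon {n} u m = B.trans (⟦⟧-∏ _ (allEdges n)) (∏B.fold-cong (allEdges n) (λ e → ⟦⟧-^ (u e) (m e)))

module Evaluation {c ℓ₁ ℓ₂} (K : HeytingField c ℓ₁ ℓ₂) (n : ℕ) where

  module K = HeytingField K

  KR : CommutativeRing c ℓ₁
  KR = HeytingCommutativeRing.commutativeRing K.heytingCommutativeRing

  Terms : Set c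
  Terms = Poly K n

  private
    module ∑K = Big (CommutativeRing.+-commutativeMonoid KR)

  coeff-∑ : ∀ p m → coeff K n p m K.≈ ∑K.fold (λ { (a , m′) → if does (m′ ≐? m) then a else K.0# }) p
  coeff-∑ []            m = K.refl
  coeff-∑ ((a , m′) ∷ p) m = K.+-congˡ (coeff-∑ p m)

  coeff-++ : ∀ p q m → coeff K n (p ++ q) m K.≈ coeff K n p m K.+ coeff K n q m
  coeff-++ []      q m = K.sym (K.+-identityˡ _)
  coeff-++ (_ ∷ p) q m = K.trans (K.+-congˡ (coeff-++ p q m)) (K.sym (K.+-assoc _ _ _))

  scale : K.Carrier → Terms → Terms
  scale b = map λ { (a , m) → b K.* a , m }

  coeff-scale : ∀ b p m → coeff K n (scale b p) m K.≈ b K.* coeff K n p m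
  coeff-scale b []             m = K.sym (K.zeroʳ b)
  coeff-scale b ((a , m′) ∷ p) m = K.trans (K.+-cong head (coeff-scale b p m)) (K.sym (K.distribˡ _ _ _))
    where
    head : (if does (m′ ≐? m) then b K.* a else K.0#) K.≈ b K.* (if does (m′ ≐? m) then a else K.0#)
    head with does (m′ ≐? m)
    ... | true  = K.refl
    ... | false = K.sym (K.zeroʳ b)

  coeff-cong : ∀ p {m m′} → m ≐ m′ → coeff K n p m K.≈ coeff K n p m′
  coeff-cong []             eq = K.refl
  coeff-cong ((a , m₁) ∷ p) {m} {m′} eq = K.+-cong head (coeff-cong p eq)
    where
    head : (if does (m₁ ≐? m) then a else K.0#) K.≈ (if does (m₁ ≐? m′) then a else K.0#)
    head with m₁ ≐? m | m₁ ≐? m′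
    ... | yes _ | yes _ = K.refl
    ... | no _  | no _  = K.refl
    ... | yes p | no ¬q = contradiction (≗⇒≐ λ e → trans (≐⇒≗ p e) (≐⇒≗ eq e)) ¬q
    ... | no ¬p | yes q = contradiction (≗⇒≐ λ e → trans (≐⇒≗ q e) (sym (≐⇒≗ eq e))) ¬p

  coeff-others : ∀ m p m′ → coeff K n (filter (λ t → ¬? (proj₂ t ≐? m)) p) m′ K.≈ (if does (m ≐? m′) then K.0# else coeff K n p m′)
  coeff-others m [] m′ with does (m ≐? m′)
  ... | true  = K.refl
  ... | false = K.refl
  coeff-others m ((b , m₁) ∷ p) m′ with ih ← coeff-others m p m′ with m₁ ≐? m | m ≐? m′
  ... | yes p₁ | yes q = ih
  ... | yes p₁ | no ¬q = K.trans ih (K.sym (K.trans (K.+-congʳ zero′) (K.+-identityˡ _)))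
    where
    zero′ : (if does (m₁ ≐? m′) then b else K.0#) K.≈ K.0#
    zero′ with m₁ ≐? m′
    ... | no _  = K.refl
    ... | yes r = contradiction (≗⇒≐ λ e → trans (sym (≐⇒≗ p₁ e)) (≐⇒≗ r e)) ¬q
  ... | no ¬p | no _  = K.+-congˡ ih
  ... | no ¬p | yes q = K.trans (K.+-cong zero′ ih) (K.+-identityˡ _)
    where
    zero′ : (if does (m₁ ≐? m′) then b else K.0#) K.≈ K.0#
    zero′ with m₁ ≐? m′
    ... | no _  = K.refl
    ... | yes r = contradiction (≗⇒≐ λ e → trans (≐⇒≗ r e) (sym (≐⇒≗ q e))) ¬p

  module _ {a b} (F : CommutativeRing a b) (ι : Hom KR F) (u : Edge n → CommutativeRing.Carrier F) where
    open CommutativeRing F hiding (zero) renaming (refl to ≈-refl; sym to ≈-sym; trans to ≈-trans)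
    open MonomialValue F n
    open Hom ι
    private module ∑ = Big +-commutativeMonoid

    term : K.Carrier × Monomial n → Carrier
    term (a , m) = ⟦ a ⟧ * mon u m

    eval : Terms → Carrier
    eval = ∑.fold term

    eval-++ : ∀ p q → eval (p ++ q) ≈ eval p + eval q
    eval-++ = ∑.fold-++ term

    eval-scale : ∀ b p → eval (scale b p) ≈ ⟦ b ⟧ * eval p
    eval-scale b []            = ≈-sym (zeroʳ _)
    eval-scale b ((a , m) ∷ p) =
      ≈-trans (+-cong (≈-trans (*-congʳ (⟦⟧-* b a)) (*-assoc _ _ _)) (eval-scale b p)) (≈-sym (distribˡ _ _ _))

    eval-multiple : ∀ r p → eval p ≈ 0# → eval (_*ᵖ_ K n r p) ≈ 0#
    eval-multiple []            p z = ≈-refl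
    eval-multiple ((a , m) ∷ r) p z = ≈-trans (eval-++ (map _ p) _) (≈-trans (+-cong (head p) (eval-multiple r p z))
      (≈-trans (+-identityʳ _) (≈-trans (*-congˡ z) (zeroʳ _))))
      where
      head : ∀ p → eval (map (λ { (b , m′) → a K.* b , m · m′ }) p) ≈ (⟦ a ⟧ * mon u m) * eval p
      head []             = ≈-sym (zeroʳ _)
      head ((b , m′) ∷ p) = ≈-trans (+-cong
        (≈-trans (*-cong (⟦⟧-* a b) (mon-· u m m′)) (SemigroupProperties.interchange *-commutativeSemigroup _ _ _ _)) (head p))
        (≈-sym (distribˡ _ _ _))

    -- Terms with the same monomial are collected, so the list without them is shorter.
    eval-zero : ∀ k p → length p ℕ.≤ k → (∀ m → coeff K n p m K.≈ K.0#) → eval p ≈ 0#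
    eval-zero k       []            _         z = ≈-refl
    eval-zero (suc k) ((a , m) ∷ p) (s≤s len) z =
      ≈-trans (+-congˡ (≈-trans (split p) (+-congˡ (eval-zero k others (ℕ.≤-trans (List.length-filter ≉? p) len) others-zero))))
     (≈-trans (+-congˡ (+-identityʳ _)) (≈-trans (≈-sym (distribʳ _ _ _))
     (≈-trans (*-congʳ (≈-trans (≈-sym (⟦⟧-+ _ _)) (≈-trans (⟦⟧-cong head) ⟦⟧-0))) (zeroˡ _))))
      where
      ≉? : (t : K.Carrier × Monomial n) → Dec (¬ (proj₂ t ≐ m))
      ≉? t = ¬? (proj₂ t ≐? m)

      others : Terms
      others = filter ≉? p

      split : ∀ p → eval p ≈ ⟦ coeff K n p m ⟧ * mon u m + eval (filter ≉? p)
      split [] = ≈-sym (≈-trans (+-identityʳ _) (≈-trans (*-congʳ ⟦⟧-0) (zeroˡ _)))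
      split ((b , m′) ∷ p) with m′ ≐? m
      ... | yes eq = ≈-trans (+-cong (*-congˡ (mon-cong (≐⇒≗ eq) (λ _ → inj₂ ≈-refl))) (split p))
        (≈-trans (≈-sym (+-assoc _ _ _)) (+-congʳ (≈-trans (≈-sym (distribʳ _ _ _)) (*-congʳ (≈-sym (⟦⟧-+ _ _))))))
      ... | no _ = ≈-trans (+-congˡ (split p)) (≈-trans (SemigroupProperties.x∙yz≈y∙xz +-commutativeSemigroup _ _ _)
        (+-congʳ (*-congʳ (⟦⟧-cong (K.sym (K.+-identityˡ _))))))

      head : a K.+ coeff K n p m K.≈ K.0#
      head with q ← z m with m ≐? m
      ... | yes _ = q
      ... | no ¬p = contradiction (≗⇒≐ (λ _ → refl)) ¬p

      others-zero : ∀ m′ → coeff K n others m′ K.≈ K.0#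
      others-zero m′ with c ← coeff-others m p m′ with z′ ← z m′ with m ≐? m′
      ... | yes _ = c
      ... | no _  = K.trans c (K.trans (K.sym (K.+-identityˡ _)) z′)

    eval-cong : ∀ p q → _≈ᵖ_ K n p q → eval p ≈ eval q
    eval-cong p q eq = RingProperties.x∙y⁻¹≈ε⇒x≈y (CommutativeRing.ring F) _ _
      (≈-trans (+-congˡ (≈-sym negate)) (≈-trans (≈-sym (eval-++ p _)) (eval-zero _ (p ++ scale (K.- K.1#) q) ℕ.≤-refl
        λ m → K.trans (coeff-++ p _ m) (K.trans (K.+-cong (eq m) (K.trans (coeff-scale _ q m) (RingProperties.-1*x≈-x (CommutativeRing.ring KR) _))) (K.-‿inverseʳ _)))))
      where
      negate : eval (scale (K.- K.1#) q) ≈ - eval q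
      negate = ≈-trans (eval-scale _ q) (≈-trans (*-congʳ (≈-trans (⟦⟧-neg _) (-‿cong ⟦⟧-1))) (RingProperties.-1*x≈-x (CommutativeRing.ring F) _))

    eval-ideal : ∀ {g} {G : Pred Terms g} → (∀ {p} → p ∈ G → eval p ≈ 0#) → ∀ {p} → p ∈ IdealGenerated K n G → eval p ≈ 0#
    eval-ideal z (generator p∈)      = z p∈
    eval-ideal z IdealGenerated.zero = ≈-refl
    eval-ideal z (add {p} {q} i j)   = ≈-trans (eval-++ p q) (≈-trans (+-cong (eval-ideal z i) (eval-ideal z j)) (+-identityˡ 0#))
    eval-ideal z (multiple r {p} i)  = eval-multiple r p (eval-ideal z i)
    eval-ideal z (respects {p} {q} eq i) = ≈-trans (≈-sym (eval-cong p q eq)) (eval-ideal z i)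

-- Degrees and perfect matchings

[_] : ∀ {a} {A : Set a} → Dec A → ℕ
[ d ] = if does d then 1 else 0

[]-yes : ∀ {a} {A : Set a} {d : Dec A} → A → [ d ] ≡ 1
[]-yes {d = yes _} _ = refl
[]-yes {d = no ¬a} a = contradiction a ¬a

[]-no : ∀ {a} {A : Set a} {d : Dec A} → ¬ A → [ d ] ≡ 0
[]-no {d = yes a} ¬a = contradiction a ¬a
[]-no {d = no _}  _  = refl

[]≤1 : ∀ {a} {A : Set a} (d : Dec A) → [ d ] ℕ.≤ 1
[]≤1 (yes _) = ℕ.≤-refl
[]≤1 (no _)  = z≤n

∑ᶠ : ∀ {n} → (Fin n → ℕ) → ℕ
∑ᶠ {zero}  g = 0
∑ᶠ {suc n} g = g zero ℕ.+ ∑ᶠ (g ∘ suc)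

∑ᶠ-cong : ∀ {n} {f g : Fin n → ℕ} → (∀ v → f v ≡ g v) → ∑ᶠ f ≡ ∑ᶠ g
∑ᶠ-cong {zero}  eq = refl
∑ᶠ-cong {suc n} eq = cong₂ ℕ._+_ (eq zero) (∑ᶠ-cong (eq ∘ suc))

∑ᶠ-0 : ∀ {n} {f : Fin n → ℕ} → (∀ v → f v ≡ 0) → ∑ᶠ f ≡ 0
∑ᶠ-0 {zero}  eq = refl
∑ᶠ-0 {suc n} eq = cong₂ ℕ._+_ (eq zero) (∑ᶠ-0 (eq ∘ suc))

∑ᶠ-+ : ∀ {n} (f g : Fin n → ℕ) → ∑ᶠ (λ v → f v ℕ.+ g v) ≡ ∑ᶠ f ℕ.+ ∑ᶠ g
∑ᶠ-+ {zero}  f g = refl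
∑ᶠ-+ {suc n} f g = trans (cong (f zero ℕ.+ g zero ℕ.+_) (∑ᶠ-+ (f ∘ suc) (g ∘ suc)))
  (SemigroupProperties.interchange (CommutativeMonoid.commutativeSemigroup ℕ.+-0-commutativeMonoid) (f zero) (g zero) _ _)

∑ᶠ-single : ∀ {n} (g : Fin n → ℕ) x → ∑ᶠ (λ v → g v ℕ.* [ v Fin.≟ x ]) ≡ g x
∑ᶠ-single g zero    = trans (cong₂ ℕ._+_ (ℕ.*-identityʳ (g zero)) (∑ᶠ-0 (λ v → ℕ.*-zeroʳ (g (suc v))))) (ℕ.+-identityʳ (g zero))
∑ᶠ-single g (suc x) = cong₂ ℕ._+_ (ℕ.*-zeroʳ (g zero))
  (trans (∑ᶠ-cong (λ v → cong (g (suc v) ℕ.*_) (step v))) (∑ᶠ-single (g ∘ suc) x))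
  where
  step : ∀ v → [ suc v Fin.≟ suc x ] ≡ [ v Fin.≟ x ]
  step v with v Fin.≟ x
  ... | yes _ = refl
  ... | no _  = refl

bit : Bool → ℕ
bit b = if b then 1 else 0

module _ {n : ℕ} where

  lo≢hi : ∀ (e : Edge n) → lo e ≢ hi e
  lo≢hi e eq = Fin.<-irrefl eq (lo<hi e)

  degree-∷ : ∀ v (e : Edge n) E → degree v (e ∷ E) ≡ [ v Fin.≟ lo e ] ℕ.+ [ v Fin.≟ hi e ] ℕ.+ degree v E
  degree-∷ v e E with v Fin.≟ lo e | v Fin.≟ hi e
  ... | yes p | yes q = contradiction (trans (sym p) q) (lo≢hi e)
  ... | yes _ | no _  = refl
  ... | no _  | yes _ = refl
  ... | no _  | no _  = refl

  degree-sum : ∀ (g : Fin n → ℕ) E → ∑ᶠ (λ v → g v ℕ.* degree v E) ≡ ℕ-Sum.fold (λ e → g (lo e) ℕ.+ g (hi e)) E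
  degree-sum g []      = ∑ᶠ-0 (λ v → ℕ.*-zeroʳ (g v))
  degree-sum g (e ∷ E) = trans (∑ᶠ-cong distribute) (trans (∑ᶠ-+ _ (λ v → g v ℕ.* degree v E))
    (cong₂ ℕ._+_ (trans (∑ᶠ-+ _ (λ v → g v ℕ.* [ v Fin.≟ hi e ])) (cong₂ ℕ._+_ (∑ᶠ-single g (lo e)) (∑ᶠ-single g (hi e)))) (degree-sum g E)))
    where
    distribute : ∀ v → g v ℕ.* degree v (e ∷ E) ≡ g v ℕ.* [ v Fin.≟ lo e ] ℕ.+ g v ℕ.* [ v Fin.≟ hi e ] ℕ.+ g v ℕ.* degree v E
    distribute v = trans (cong (g v ℕ.*_) (degree-∷ v e E)) (trans (ℕ.*-distribˡ-+ (g v) _ (degree v E)) (cong (ℕ._+ g v ℕ.* degree v E) (ℕ.*-distribˡ-+ (g v) [ v Fin.≟ lo e ] _)))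

  degree-pos : ∀ {v} {e : Edge n} {E} → e ∈ˡ E → Incident v e → 1 ℕ.≤ degree v E
  degree-pos {v} {e} {E} e∈ inc with filter (incident? v) E | List.∈-filter⁺ (incident? v) e∈ inc
  ... | _ ∷ _ | _ = s≤s z≤n

  Covers : Subset n → List (Edge n) → Set
  Covers U E = ∀ v → degree v E ≡ bit (Vec.lookup U v)

  PM⇒Covers : ∀ {U E} → PerfectMatching U E → Covers U E
  PM⇒Covers {U} pm v with Vec.lookup U v in eq
  ... | true  = proj₁ (pm v) (lookup⇒[]= v U eq)
  ... | false = proj₂ (pm v) λ v∈ → contradiction (trans (sym eq) ([]=⇒lookup v∈)) λ ()

  Covers⇒PM : ∀ {U E} → Covers U E → PerfectMatching U E
  Covers⇒PM {U} {E} c v = (λ v∈ → trans (c v) (cong bit ([]=⇒lookup v∈))) , outside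
    where
    outside : ¬ (v Subset.∈ U) → degree v E ≡ 0
    outside v∉ with Vec.lookup U v in eq | c v
    ... | true  | _ = contradiction (lookup⇒[]= v U eq) v∉
    ... | false | d = d

  remove : Subset n → Fin n → Subset n
  remove U v = U Vec.[ v ]≔ false

  Covers-∷⁻ : ∀ {U e E} → Covers U (e ∷ E) →
    Vec.lookup U (lo e) ≡ true × Vec.lookup (remove U (lo e)) (hi e) ≡ true × Covers (remove (remove U (lo e)) (hi e)) E
  Covers-∷⁻ {U} {e} {E} c = lo∈ , trans (lookup∘update′ (lo≢hi e ∘ sym) U false) hi∈ , rest
    where
    inside : ∀ v → 1 ℕ.≤ [ v Fin.≟ lo e ] ℕ.+ [ v Fin.≟ hi e ] → Vec.lookup U v ≡ true
    inside v pos with Vec.lookup U v | trans (sym (degree-∷ v e E)) (c v)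
    ... | true  | _  = refl
    ... | false | eq = contradiction (ℕ.≤-trans pos (ℕ.≤-trans (ℕ.m≤m+n _ (degree v E)) (ℕ.≤-reflexive eq))) λ ()
    lo∈ = inside (lo e) (ℕ.≤-trans (ℕ.≤-reflexive (sym ([]-yes {d = lo e Fin.≟ lo e} refl))) (ℕ.m≤m+n _ _))
    hi∈ = inside (hi e) (ℕ.≤-trans (ℕ.≤-reflexive (sym ([]-yes {d = hi e Fin.≟ hi e} refl))) (ℕ.m≤n+m _ _))
    rest : Covers (remove (remove U (lo e)) (hi e)) E
    rest v with trans (sym (degree-∷ v e E)) (c v)
    ... | eq with v Fin.≟ hi e | v Fin.≟ lo e
    ... | yes refl | yes p    = contradiction (sym p) (lo≢hi e)
    ... | yes refl | no _     rewrite lookup∘update v (remove U (lo e)) false | hi∈ = ℕ.suc-injective eq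
    ... | no q     | yes refl rewrite lookup∘update′ q (remove U v) false | lookup∘update v U false | lo∈ = ℕ.suc-injective eq
    ... | no q     | no p     rewrite lookup∘update′ q (remove U (lo e)) false | lookup∘update′ p U false = eq

  Covers-∷⁺ : ∀ {U e E} → Vec.lookup U (lo e) ≡ true → Vec.lookup (remove U (lo e)) (hi e) ≡ true →
    Covers (remove (remove U (lo e)) (hi e)) E → Covers U (e ∷ E)
  Covers-∷⁺ {U} {e} {E} lo∈ hi∈ c v = trans (degree-∷ v e E) (helper (c v))
    where
    helper : degree v E ≡ bit (Vec.lookup (remove (remove U (lo e)) (hi e)) v) → [ v Fin.≟ lo e ] ℕ.+ [ v Fin.≟ hi e ] ℕ.+ degree v E ≡ bit (Vec.lookup U v)
    helper eq with v Fin.≟ lo e | v Fin.≟ hi e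
    ... | yes p    | yes q    = contradiction (trans (sym p) q) (lo≢hi e)
    ... | yes refl | no q     rewrite lo∈ | lookup∘update′ q (remove U v) false | lookup∘update v U false = cong suc eq
    ... | no p     | yes refl rewrite trans (sym (lookup∘update′ p U false)) hi∈ | lookup∘update v (remove U (lo e)) false = cong suc eq
    ... | no p     | no q     rewrite lookup∘update′ q (remove U (lo e)) false | lookup∘update′ p U false = eq

before : ∀ {n} → Fin n → Subset n → ℕ
before zero    _       = 0
before (suc i) (b ∷ U) = bit b ℕ.+ before i U

before-∑ : ∀ {n} (i : Fin n) U → before i U ≡ ∑ᶠ (λ v → [ v Fin.<? i ] ℕ.* bit (Vec.lookup U v))
before-∑ {suc n} zero (b ∷ U) = sym (∑ᶠ-0 {suc n} {λ v → [ v Fin.<? zero {n} ] ℕ.* bit (Vec.lookup (b ∷ U) v)} (λ v → refl))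
before-∑ (suc i) (b ∷ U) = cong₂ ℕ._+_ (sym (ℕ.+-identityʳ (bit b)))
  (before-∑ i U)

before-remove : ∀ {n} (i j : Fin n) U → ¬ (j Fin.< i) → before i (remove U j) ≡ before i U
before-remove zero    j       U       _ = refl
before-remove (suc i) zero    (b ∷ U) ≮ = contradiction (s≤s z≤n) ≮
before-remove (suc i) (suc j) (b ∷ U) ≮ = cong (bit b ℕ.+_) (before-remove i j U (≮ ∘ s≤s))

module _ {n : ℕ} where

  before-Covers : ∀ (i : Fin n) {U E} → Covers U E → before i U ≡ ℕ-Sum.fold (λ f → [ lo f Fin.<? i ] ℕ.+ [ hi f Fin.<? i ]) E
  before-Covers i {U} {E} c = trans (before-∑ i U)
    (trans (∑ᶠ-cong (λ v → cong ([ v Fin.<? i ] ℕ.*_) (sym (c v)))) (degree-sum (λ v → [ v Fin.<? i ]) E))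

  private
    data Value {a} {A : Set a} (d : Dec A) : ℕ → Set a where
      on  : A → Value d 1
      off : ¬ A → Value d 0

    value : ∀ {a} {A : Set a} {d : Dec A} {k} → Value d k → [ d ] ≡ k
    value {d = d} (on a)   = []-yes {d = d} a
    value {d = d} (off ¬a) = []-no {d = d} ¬a

    tally : ∀ (e f : Edge n) d {w x y z c} → Value (lo f Fin.<? lo e) w → Value (hi f Fin.<? lo e) x → Value (lo f Fin.<? hi e) y → Value (hi f Fin.<? hi e) z →
      Value (cross? e f) c → (w ℕ.+ x) ℕ.+ (y ℕ.+ z) ≡ c ℕ.+ 2 ℕ.* d →
      ∃[ d ] ([ lo f Fin.<? lo e ] ℕ.+ [ hi f Fin.<? lo e ]) ℕ.+ ([ lo f Fin.<? hi e ] ℕ.+ [ hi f Fin.<? hi e ]) ≡ [ cross? e f ] ℕ.+ 2 ℕ.* d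
    tally e f d p q r s t eq = d , trans (cong₂ ℕ._+_ (cong₂ ℕ._+_ (value p) (value q)) (cong₂ ℕ._+_ (value r) (value s))) (trans eq (cong (ℕ._+ 2 ℕ.* d) (sym (value t))))

  -- An edge with no endpoint in common with e has an odd number of its four
  -- endpoint comparisons with lo e and hi e true exactly when it crosses e.
  cross-parity : ∀ (e f : Edge n) → lo f ≢ lo e → lo f ≢ hi e → hi f ≢ lo e → hi f ≢ hi e →
    ∃[ d ] ([ lo f Fin.<? lo e ] ℕ.+ [ hi f Fin.<? lo e ]) ℕ.+ ([ lo f Fin.<? hi e ] ℕ.+ [ hi f Fin.<? hi e ]) ≡ [ cross? e f ] ℕ.+ 2 ℕ.* d
  cross-parity e f ll lh hl hh with Fin.<-cmp (lo f) (lo e) | Fin.<-cmp (lo f) (hi e) | Fin.<-cmp (hi f) (lo e) | Fin.<-cmp (hi f) (hi e)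
  ... | tri≈ _ p _ | _ | _ | _ = contradiction p ll
  ... | _ | tri≈ _ p _ | _ | _ = contradiction p lh
  ... | _ | _ | tri≈ _ p _ | _ = contradiction p hl
  ... | _ | _ | _ | tri≈ _ p _ = contradiction p hh
  ... | tri< a _ _ | tri> _ _ b | _ | _ = contradiction (Fin.<-trans (lo<hi e) b) (Fin.<-asym a)
  ... | _ | _ | tri< a _ _ | tri> _ _ b = contradiction (Fin.<-trans (lo<hi e) b) (Fin.<-asym a)
  ... | tri> _ _ a | _ | tri< b _ _ | _ = contradiction (Fin.<-trans (lo<hi f) b) (Fin.<-asym a)
  ... | _ | tri> _ _ a | _ | tri< b _ _ = contradiction (Fin.<-trans (lo<hi f) b) (Fin.<-asym a)
  ... | tri< a _ _ | tri< b _ _ | tri< c _ _ | tri< d _ _ = tally e f 2 (on a) (on c) (on b) (on d)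
    (off λ { (inj₁ (p , _)) → Fin.<-asym p a ; (inj₂ (_ , p , _)) → Fin.<-asym p c }) refl
  ... | tri< a _ _ | tri< b _ _ | tri> _ _ c | tri< d _ _ = tally e f 1 (on a) (off (Fin.<-asym c)) (on b) (on d)
    (on (inj₂ (a , c , d))) refl
  ... | tri< a _ _ | tri< b _ _ | tri> _ _ c | tri> _ _ d = tally e f 1 (on a) (off (Fin.<-asym c)) (on b) (off (Fin.<-asym d))
    (off λ { (inj₁ (p , _)) → Fin.<-asym p a ; (inj₂ (_ , _ , p)) → Fin.<-asym p d }) refl
  ... | tri> _ _ a | tri< b _ _ | tri> _ _ c | tri< d _ _ = tally e f 1 (off (Fin.<-asym a)) (off (Fin.<-asym c)) (on b) (on d)
    (off λ { (inj₁ (_ , _ , p)) → Fin.<-asym p d ; (inj₂ (p , _)) → Fin.<-asym p a }) refl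
  ... | tri> _ _ a | tri< b _ _ | tri> _ _ c | tri> _ _ d = tally e f 0 (off (Fin.<-asym a)) (off (Fin.<-asym c)) (on b) (off (Fin.<-asym d))
    (on (inj₁ (a , b , d))) refl
  ... | tri> _ _ a | tri> _ _ b | tri> _ _ c | tri> _ _ d = tally e f 0 (off (Fin.<-asym a)) (off (Fin.<-asym c)) (off (Fin.<-asym b)) (off (Fin.<-asym d))
    (off λ { (inj₁ (_ , p , _)) → Fin.<-asym p b ; (inj₂ (p , _)) → Fin.<-asym p a }) refl

  crossings-parity : ∀ {U E} (e : Edge n) → Covers U E → Vec.lookup U (lo e) ≡ false → Vec.lookup U (hi e) ≡ false →
    ∃[ d ] before (lo e) U ℕ.+ before (hi e) U ≡ length (filter (cross? e) E) ℕ.+ 2 ℕ.* d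
  crossings-parity {U} {E} e c lo∉ hi∉ = let d , eq = go E absent in
    d , trans (cong₂ ℕ._+_ (before-Covers (lo e) {U} {E} c) (before-Covers (hi e) {U} {E} c))
      (trans (sym (ℕ-Sum.fold-∙ (λ f → [ lo f Fin.<? lo e ] ℕ.+ [ hi f Fin.<? lo e ]) (λ f → [ lo f Fin.<? hi e ] ℕ.+ [ hi f Fin.<? hi e ]) E)) eq)
    where
    absent : ∀ {f} → f ∈ˡ E → lo f ≢ lo e × lo f ≢ hi e × hi f ≢ lo e × hi f ≢ hi e
    absent {f} f∈ = (λ p → no-edge lo∉ (inj₁ (sym p))) , (λ p → no-edge hi∉ (inj₁ (sym p))) , (λ p → no-edge lo∉ (inj₂ (sym p))) , (λ p → no-edge hi∉ (inj₂ (sym p)))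
      where
      no-edge : ∀ {v} → Vec.lookup U v ≡ false → Incident v f → ⊥
      no-edge {v} v∉ inc = contradiction (ℕ.≤-trans (degree-pos f∈ inc) (ℕ.≤-reflexive (trans (c v) (cong bit v∉)))) λ ()

    go : ∀ F → (∀ {f} → f ∈ˡ F → lo f ≢ lo e × lo f ≢ hi e × hi f ≢ lo e × hi f ≢ hi e) →
      ∃[ d ] ℕ-Sum.fold (λ f → ([ lo f Fin.<? lo e ] ℕ.+ [ hi f Fin.<? lo e ]) ℕ.+ ([ lo f Fin.<? hi e ] ℕ.+ [ hi f Fin.<? hi e ])) F
        ≡ length (filter (cross? e) F) ℕ.+ 2 ℕ.* d
    go []      _  = 0 , refl
    go (f ∷ F) ab =
      let d , eq = go F (ab ∘ there)
          ll , lh , hl , hh = ab (here refl)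
          d′ , eq′ = cross-parity e f ll lh hl hh
      in d′ ℕ.+ d , trans (cong₂ ℕ._+_ eq′ eq) (trans (rearrange [ cross? e f ] d′ (length (filter (cross? e) F)) d) (cong (λ z → z ℕ.+ 2 ℕ.* (d′ ℕ.+ d)) (sym count)))
      where
      rearrange : ∀ x d′ y d → (x ℕ.+ 2 ℕ.* d′) ℕ.+ (y ℕ.+ 2 ℕ.* d) ≡ (x ℕ.+ y) ℕ.+ 2 ℕ.* (d′ ℕ.+ d)
      rearrange = solve 4 (λ x d′ y d → (x :+ con 2 :* d′) :+ (y :+ con 2 :* d) := (x :+ y) :+ con 2 :* (d′ :+ d)) refl
        where open +-*-Solver
      count : length (filter (cross? e) (f ∷ F)) ≡ [ cross? e f ] ℕ.+ length (filter (cross? e) F)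
      count with does (cross? e f)
      ... | true  = refl
      ... | false = refl

-- Exterior multiplication and contraction

-- A form assigns a coefficient to each product of distinct generators, taken
-- in increasing order.
module Exterior {c ℓ} (F : CommutativeRing c ℓ) where
  open CommutativeRing F hiding (zero) renaming (refl to ≈-refl; sym to ≈-sym; trans to ≈-trans)
  open CommutativeExp commutativeSemiring using (_^_; ^-homo-*; ^-assocʳ; ^-congʳ)
  open SemiringSolver commutativeSemiring using (solve; _:=_; _:+_; _:*_; con)
  private module ∑ = Big +-commutativeMonoid
  private module ∏ = Big *-commutativeMonoid

  Form : ℕ → Set c
  Form n = Subset n → Carrier

  Vector : ℕ → Set c
  Vector n = Fin n → Carrier

  σ : Carrier
  σ = - 1#

  kill : ∀ {x y} z → x ≈ y + (1# + σ) * z → x ≈ y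
  kill z eq = ≈-trans eq (≈-trans (+-congˡ (≈-trans (*-congʳ (-‿inverseʳ 1#)) (zeroˡ z))) (+-identityʳ _))

  σσ : σ * σ ≈ 1#
  σσ = kill σ (≈-trans (≈-sym (+-identityˡ _)) (≈-trans (+-congʳ (≈-sym (-‿inverseʳ 1#))) (≈-trans (+-assoc _ _ _) (+-congˡ
    (solve 1 (λ s → s :+ s :* s := (con 1 :+ s) :* s) ≈-refl σ)))))

  -- Q a α is exterior multiplication by a plus contraction by α.
  Q : ∀ {n} → Vector n → Vector n → Form n → Form n
  Q a α φ []          = 0#
  Q a α φ (false ∷ U) = α zero * φ (true ∷ U) + Q (a ∘ suc) (α ∘ suc) (λ V → φ (false ∷ V)) U
  Q a α φ (true ∷ U)  = a zero * φ (false ∷ U) + σ * Q (a ∘ suc) (α ∘ suc) (λ V → φ (true ∷ V)) U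

  Q-cong : ∀ {n} {a b α β : Vector n} {φ ψ} → (∀ v → a v ≈ b v) → (∀ v → α v ≈ β v) → (∀ U → φ U ≈ ψ U) → ∀ U → Q a α φ U ≈ Q b β ψ U
  Q-cong p q r []          = ≈-refl
  Q-cong p q r (false ∷ U) = +-cong (*-cong (q zero) (r _)) (Q-cong (p ∘ suc) (q ∘ suc) (r ∘ (false ∷_)) U)
  Q-cong p q r (true ∷ U)  = +-cong (*-cong (p zero) (r _)) (*-congˡ (Q-cong (p ∘ suc) (q ∘ suc) (r ∘ (true ∷_)) U))

  Q-congᶠ : ∀ {n} {a α : Vector n} {φ ψ} → (∀ U → φ U ≈ ψ U) → ∀ U → Q a α φ U ≈ Q a α ψ U
  Q-congᶠ = Q-cong (λ _ → ≈-refl) (λ _ → ≈-refl)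

  Q-linear : ∀ {n} (a α : Vector n) x y φ ψ U → Q a α (λ V → x * φ V + y * ψ V) U ≈ x * Q a α φ U + y * Q a α ψ U
  Q-linear a α x y φ ψ [] = ≈-sym (≈-trans (+-cong (zeroʳ x) (zeroʳ y)) (+-identityˡ 0#))
  Q-linear a α x y φ ψ (false ∷ U) = ≈-trans (+-congˡ (Q-linear _ _ x y _ _ U))
    (solve 7 (λ k x y f g p q → k :* (x :* f :+ y :* g) :+ (x :* p :+ y :* q) := x :* (k :* f :+ p) :+ y :* (k :* g :+ q)) ≈-refl (α zero) x y _ _ _ _)
  Q-linear a α x y φ ψ (true ∷ U) = ≈-trans (+-congˡ (*-congˡ (Q-linear _ _ x y _ _ U)))
    (solve 8 (λ k s x y f g p q → k :* (x :* f :+ y :* g) :+ s :* (x :* p :+ y :* q) := x :* (k :* f :+ s :* p) :+ y :* (k :* g :+ s :* q)) ≈-refl (a zero) σ x y _ _ _ _)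

  Q-scaleᶠ : ∀ {n} (a α : Vector n) x φ U → Q a α (λ V → x * φ V) U ≈ x * Q a α φ U
  Q-scaleᶠ a α x φ U = ≈-trans (Q-congᶠ (λ V → ≈-sym (≈-trans (+-congˡ (zeroˡ (φ V))) (+-identityʳ _))) U)
    (≈-trans (Q-linear a α x 0# φ φ U) (≈-trans (+-congˡ (zeroˡ _)) (+-identityʳ _)))

  Q-+ᶠ : ∀ {n} (a α : Vector n) φ ψ U → Q a α (λ V → φ V + ψ V) U ≈ Q a α φ U + Q a α ψ U
  Q-+ᶠ a α φ ψ U = ≈-trans (Q-congᶠ (λ V → ≈-sym (+-cong (*-identityˡ _) (*-identityˡ _))) U)
    (≈-trans (Q-linear a α 1# 1# φ ψ U) (+-cong (*-identityˡ _) (*-identityˡ _)))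

  Q-0ᶠ : ∀ {n} (a α : Vector n) U → Q a α (λ _ → 0#) U ≈ 0#
  Q-0ᶠ a α U = ≈-trans (Q-congᶠ (λ _ → ≈-sym (zeroˡ 0#)) U) (≈-trans (Q-scaleᶠ a α 0# (λ _ → 0#) U) (zeroˡ _))

  Q-linearᵛ : ∀ {n} x y (a b α β : Vector n) φ U →
    Q (λ v → x * a v + y * b v) (λ v → x * α v + y * β v) φ U ≈ x * Q a α φ U + y * Q b β φ U
  Q-linearᵛ x y a b α β φ [] = ≈-sym (≈-trans (+-cong (zeroʳ x) (zeroʳ y)) (+-identityˡ 0#))
  Q-linearᵛ x y a b α β φ (false ∷ U) = ≈-trans (+-congˡ (Q-linearᵛ x y _ _ _ _ _ U))
    (solve 7 (λ x y k l f p q → (x :* k :+ y :* l) :* f :+ (x :* p :+ y :* q) := x :* (k :* f :+ p) :+ y :* (l :* f :+ q)) ≈-refl x y _ _ _ _ _)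
  Q-linearᵛ x y a b α β φ (true ∷ U) = ≈-trans (+-congˡ (*-congˡ (Q-linearᵛ x y _ _ _ _ _ U)))
    (solve 8 (λ s x y k l f p q → (x :* k :+ y :* l) :* f :+ s :* (x :* p :+ y :* q) := x :* (k :* f :+ s :* p) :+ y :* (l :* f :+ s :* q)) ≈-refl σ x y _ _ _ _ _)

  dot : ∀ {n} → Vector n → Vector n → Carrier
  dot {zero}  a β = 0#
  dot {suc n} a β = a zero * β zero + dot (a ∘ suc) (β ∘ suc)

  Q-anticomm : ∀ {n} (a α b β : Vector n) φ U → Q a α (Q b β φ) U + Q b β (Q a α φ) U ≈ (dot a β + dot b α) * φ U
  Q-anticomm a α b β φ [] = ≈-trans (+-identityˡ 0#) (≈-sym (≈-trans (*-congʳ (+-identityˡ 0#)) (zeroˡ _)))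
  Q-anticomm a α b β φ (false ∷ U) = kill (α zero * q + β zero * p)
    (≈-trans (+-cong (+-congˡ (expand _ _ (β zero) (b ∘ suc) (β ∘ suc))) (+-congˡ (expand _ _ (α zero) (a ∘ suc) (α ∘ suc))))
    (≈-trans (solve 10 (λ s a₀ α₀ b₀ β₀ f p q r r′ →
        (α₀ :* (b₀ :* f :+ s :* q) :+ (β₀ :* p :+ r)) :+ (β₀ :* (a₀ :* f :+ s :* p) :+ (α₀ :* q :+ r′))
        := ((a₀ :* β₀ :+ b₀ :* α₀) :* f :+ (r :+ r′)) :+ (con 1 :+ s) :* (α₀ :* q :+ β₀ :* p)) ≈-refl σ (a zero) (α zero) (b zero) (β zero) (φ (false ∷ U)) p q _ _)
    (+-congʳ (≈-trans (+-congˡ (Q-anticomm _ _ _ _ _ U))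
      (solve 5 (λ x y d d′ f → (x :+ y) :* f :+ (d :+ d′) :* f := ((x :+ d) :+ (y :+ d′)) :* f) ≈-refl _ _ _ _ (φ (false ∷ U)))))))
    where
    p = Q (a ∘ suc) (α ∘ suc) (λ V → φ (true ∷ V)) U
    q = Q (b ∘ suc) (β ∘ suc) (λ V → φ (true ∷ V)) U
    expand : ∀ a α x b β → Q a α (λ V → x * φ (true ∷ V) + Q b β (λ V → φ (false ∷ V)) V) U
                         ≈ x * Q a α (λ V → φ (true ∷ V)) U + Q a α (Q b β (λ V → φ (false ∷ V))) U
    expand a α x b β = ≈-trans (Q-+ᶠ a α _ _ U) (+-congʳ (Q-scaleᶠ a α x _ U))
  Q-anticomm a α b β φ (true ∷ U) = kill (a zero * q + b zero * p)
    (≈-trans (+-cong (+-congˡ (expand _ _ (b zero) (b ∘ suc) (β ∘ suc))) (+-congˡ (expand _ _ (a zero) (a ∘ suc) (α ∘ suc))))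
    (≈-trans (solve 10 (λ s a₀ α₀ b₀ β₀ f p q r r′ →
        (a₀ :* (β₀ :* f :+ q) :+ (s :* (b₀ :* p) :+ r)) :+ (b₀ :* (α₀ :* f :+ p) :+ (s :* (a₀ :* q) :+ r′))
        := ((a₀ :* β₀ :+ b₀ :* α₀) :* f :+ (r :+ r′)) :+ (con 1 :+ s) :* (a₀ :* q :+ b₀ :* p)) ≈-refl σ (a zero) (α zero) (b zero) (β zero) (φ (true ∷ U)) p q _ _)
    (+-congʳ (≈-trans (+-congˡ (Q-anticomm _ _ _ _ _ U))
      (solve 5 (λ x y d d′ f → (x :+ y) :* f :+ (d :+ d′) :* f := ((x :+ d) :+ (y :+ d′)) :* f) ≈-refl _ _ _ _ (φ (true ∷ U)))))))
    where
    p = Q (a ∘ suc) (α ∘ suc) (λ V → φ (false ∷ V)) U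
    q = Q (b ∘ suc) (β ∘ suc) (λ V → φ (false ∷ V)) U
    expand : ∀ a α x b β → σ * Q a α (λ V → x * φ (false ∷ V) + σ * Q b β (λ V → φ (true ∷ V)) V) U
                         ≈ σ * (x * Q a α (λ V → φ (false ∷ V)) U) + Q a α (Q b β (λ V → φ (true ∷ V))) U
    expand a α x b β = ≈-trans (*-congˡ (Q-linear a α x σ _ _ U)) (≈-trans (distribˡ _ _ _)
      (+-congˡ (≈-trans (≈-sym (*-assoc _ _ _)) (≈-trans (*-congʳ σσ) (*-identityˡ _)))))

  𝟘 : ∀ {n} → Vector n
  𝟘 _ = 0#

  Q-𝟘 : ∀ {n} (φ : Form n) U → Q 𝟘 𝟘 φ U ≈ 0#
  Q-𝟘 φ []          = ≈-refl
  Q-𝟘 φ (false ∷ U) = ≈-trans (+-cong (zeroˡ _) (Q-𝟘 _ U)) (+-identityˡ 0#)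
  Q-𝟘 φ (true ∷ U)  = ≈-trans (+-cong (zeroˡ _) (≈-trans (*-congˡ (Q-𝟘 _ U)) (zeroʳ σ))) (+-identityˡ 0#)

  W : ∀ {n} → Vector n → Form n → Form n
  W a = Q a 𝟘

  dot-𝟘 : ∀ {n} (a : Vector n) → dot a 𝟘 ≈ 0#
  dot-𝟘 {zero}  a = ≈-refl
  dot-𝟘 {suc n} a = ≈-trans (+-cong (zeroʳ _) (dot-𝟘 (a ∘ suc))) (+-identityˡ 0#)

  W-anticomm : ∀ {n} (a b : Vector n) φ U → W a (W b φ) U + W b (W a φ) U ≈ 0#
  W-anticomm a b φ U = ≈-trans (Q-anticomm a 𝟘 b 𝟘 φ U) (≈-trans (*-congʳ (≈-trans (+-cong (dot-𝟘 a) (dot-𝟘 b)) (+-identityˡ 0#))) (zeroˡ _))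

  W-antisym : ∀ {n} (a b : Vector n) φ U → W a (W b φ) U ≈ σ * W b (W a φ) U
  W-antisym a b φ U = kill (W b (W a φ) U) (≈-trans (≈-sym (+-identityʳ _)) (≈-trans (+-congˡ (≈-sym (zeroˡ (W b (W a φ) U))))
    (≈-trans (+-congˡ (*-congʳ (≈-sym (-‿inverseʳ 1#)))) (≈-trans (solve 3 (λ s x y → x :+ (con 1 :+ s) :* y := (x :+ y) :+ s :* y) ≈-refl σ _ _)
    (≈-trans (+-congʳ (W-anticomm a b φ U)) (≈-trans (+-identityˡ _) (≈-trans (≈-sym (+-identityʳ _)) (+-congˡ (≈-sym (≈-trans (*-congʳ (-‿inverseʳ 1#)) (zeroˡ _)))))))))))

  -- The diagonal case does not follow from anticommutation in characteristic 2.
  W-square : ∀ {n} (a : Vector n) φ U → W a (W a φ) U ≈ 0#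
  W-square a φ [] = ≈-refl
  W-square a φ (false ∷ U) = ≈-trans (+-cong (zeroˡ _) (Q-congᶠ (λ V → ≈-trans (+-congʳ (zeroˡ _)) (+-identityˡ _)) U))
    (≈-trans (+-identityˡ _) (W-square (a ∘ suc) _ U))
  W-square a φ (true ∷ U) = kill (a zero * p)
    (≈-trans (+-cong (*-congˡ (≈-trans (+-congʳ (zeroˡ _)) (+-identityˡ _)))
      (≈-trans (*-congˡ (Q-linear _ _ (a zero) σ (λ V → φ (false ∷ V)) (W (a ∘ suc) (λ V → φ (true ∷ V))) U)) (*-congˡ (+-congˡ (≈-trans (*-congˡ (W-square (a ∘ suc) _ U)) (zeroʳ σ))))))
    (solve 3 (λ a₀ s p → a₀ :* p :+ s :* (a₀ :* p :+ con 0) := con 0 :+ (con 1 :+ s) :* (a₀ :* p)) ≈-refl (a zero) σ p))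
    where
    p = W (a ∘ suc) (λ V → φ (false ∷ V)) U

  unit : ∀ {n} → Fin n → Vector n
  unit zero    zero    = 1#
  unit zero    (suc j) = 0#
  unit (suc i) zero    = 0#
  unit (suc i) (suc j) = unit i j

  ∂ : ∀ {n} → Fin n → Form n → Form n
  ∂ v = Q 𝟘 (unit v)

  dot-unit : ∀ {n} (a : Vector n) v → dot a (unit v) ≈ a v
  dot-unit a zero    = ≈-trans (+-cong (*-identityʳ _) (dot-𝟘 (a ∘ suc))) (+-identityʳ _)
  dot-unit a (suc v) = ≈-trans (+-cong (zeroʳ _) (dot-unit (a ∘ suc) v)) (+-identityˡ _)

  ∂-W : ∀ {n} v (a : Vector n) φ U → ∂ v (W a φ) U ≈ a v * φ U + σ * W a (∂ v φ) U
  ∂-W {n} v a φ U = kill (W a (∂ v φ) U) (≈-trans (≈-trans (≈-sym (+-identityʳ _)) (+-congˡ (≈-sym (≈-trans (*-congʳ (-‿inverseʳ 1#)) (zeroˡ (W a (∂ v φ) U))))))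
    (≈-trans (solve 3 (λ s x y → x :+ (con 1 :+ s) :* y := (x :+ y) :+ s :* y) ≈-refl σ _ _)
    (≈-trans (+-congʳ (≈-trans (Q-anticomm 𝟘 (unit v) a 𝟘 φ U) (*-congʳ (≈-trans (+-cong (dot-𝟘 {n} 𝟘) (dot-unit a v)) (+-identityˡ _)))))
    (≈-trans (≈-sym (+-identityʳ _)) (+-congˡ (≈-sym (≈-trans (*-congʳ (-‿inverseʳ 1#)) (zeroˡ _))))))))

  W-local : ∀ {n} (a : Vector n) {φ ψ} U → (∀ V → suc ∣ V ∣ ≡ ∣ U ∣ → φ V ≈ ψ V) → W a φ U ≈ W a ψ U
  W-local a []          eq = ≈-refl
  W-local a (false ∷ U) eq = +-cong (≈-trans (zeroˡ _) (≈-sym (zeroˡ _))) (W-local (a ∘ suc) U (λ V p → eq (false ∷ V) p))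
  W-local a (true ∷ U)  eq = +-cong (*-congˡ (eq (false ∷ U) refl)) (*-congˡ (W-local (a ∘ suc) U (λ V p → eq (true ∷ V) (cong suc p))))

  W-support : ∀ {n} (a : Vector n) {φ k} → (∀ V → k ℕ.< ∣ V ∣ → φ V ≈ 0#) → ∀ U → suc k ℕ.< ∣ U ∣ → W a φ U ≈ 0#
  W-support a z U k< = ≈-trans (W-local a U (λ V eq → z V (ℕ.s≤s⁻¹ (subst (_ ℕ.<_) (sym eq) k<)))) (Q-0ᶠ a 𝟘 U)

  Bivector : ℕ → Set c
  Bivector n = List (Carrier × Vector n × Vector n)

  entry : ∀ {n} → Bivector n → Fin n → Fin n → Carrier
  entry P v j = ∑.fold (λ { (x , a , b) → x * (a v * b j + σ * (b v * a j)) }) P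

  δ∅ : ∀ {n} → Form n
  δ∅ []          = 1#
  δ∅ (true ∷ U)  = 0#
  δ∅ (false ∷ U) = δ∅ U

  exp : ∀ {n} → Bivector n → Form n
  exp []                U = δ∅ U
  exp ((x , a , b) ∷ P) U = exp P U + x * W a (W b (exp P)) U

  δ∅-∂ : ∀ {n} v (U : Subset n) → ∂ v δ∅ U ≈ 0#
  δ∅-∂ zero    (false ∷ U) = ≈-trans (+-cong (zeroʳ _) (Q-𝟘 _ U)) (+-identityˡ 0#)
  δ∅-∂ zero    (true ∷ U)  = ≈-trans (+-cong (zeroˡ _) (≈-trans (*-congˡ (Q-0ᶠ _ _ U)) (zeroʳ σ))) (+-identityˡ 0#)
  δ∅-∂ (suc v) (false ∷ U) = ≈-trans (+-cong (zeroˡ _) (δ∅-∂ v U)) (+-identityˡ 0#)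
  δ∅-∂ (suc v) (true ∷ U)  = ≈-trans (+-cong (zeroˡ _) (≈-trans (*-congˡ (Q-0ᶠ _ _ U)) (zeroʳ σ))) (+-identityˡ 0#)

  W-linearᵛ : ∀ {n} x y (a b : Vector n) φ U → W (λ v → x * a v + y * b v) φ U ≈ x * W a φ U + y * W b φ U
  W-linearᵛ x y a b φ U = ≈-trans (Q-cong (λ _ → ≈-refl) (λ _ → ≈-sym (≈-trans (+-cong (zeroʳ x) (zeroʳ y)) (+-identityˡ 0#))) (λ _ → ≈-refl) U)
    (Q-linearᵛ x y a b 𝟘 𝟘 φ U)

  ∂-exp : ∀ {n} (P : Bivector n) v U → ∂ v (exp P) U ≈ W (entry P v) (exp P) U
  ∂-exp []                v U = ≈-trans (δ∅-∂ v U) (≈-sym (Q-𝟘 δ∅ U))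
  ∂-exp ((x , a , b) ∷ P) v U = ≈-trans
    (≈-trans (Q-+ᶠ _ _ ψ _ U) (+-cong (∂-exp P v U) (≈-trans (Q-scaleᶠ _ _ x _ U) (*-congˡ contracted))))
    (≈-sym (≈-trans (≈-trans (Q-cong (λ j → +-cong (*-congˡ (+-congˡ (≈-sym (*-assoc _ _ _)))) (≈-sym (*-identityˡ _))) (λ _ → ≈-refl) (λ _ → ≈-refl) U)
        (≈-trans (W-linearᵛ x 1# _ z ψ′ U) (+-congʳ (*-congˡ (W-linearᵛ (a v) (σ * b v) b a ψ′ U)))))
      (≈-trans (+-cong (*-congˡ (+-cong (*-congˡ b-part) (*-congˡ a-part))) (≈-trans (*-identityˡ _) z-part))
        (solve 8 (λ x p q s f g h k → x :* (p :* f :+ (s :* q) :* g) :+ (h :+ x :* k) := h :+ x :* (p :* f :+ (s :* (q :* g) :+ k))) ≈-refl x (a v) (b v) σ _ _ _ _))))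
    where
    ψ = exp P
    ψ′ = exp ((x , a , b) ∷ P)
    z = entry P v

    contracted : ∂ v (W a (W b ψ)) U ≈ a v * W b ψ U + (σ * (b v * W a ψ U) + W a (W b (W z ψ)) U)
    contracted = ≈-trans (∂-W v a (W b ψ) U) (+-congˡ (≈-trans
      (*-congˡ (≈-trans (Q-congᶠ (∂-W v b ψ) U) (Q-linear a 𝟘 (b v) σ ψ (W b (∂ v ψ)) U)))
      (≈-trans (distribˡ _ _ _) (+-congˡ (≈-trans (≈-sym (*-assoc _ _ _)) (≈-trans (*-congʳ σσ) (≈-trans (*-identityˡ _)
        (Q-congᶠ (Q-congᶠ (∂-exp P v)) U))))))))

    absorb : ∀ w → W w (W a (W b ψ)) U ≈ 0# → W w ψ′ U ≈ W w ψ U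
    absorb w eq = ≈-trans (Q-+ᶠ w 𝟘 ψ _ U) (≈-trans (+-congˡ (≈-trans (Q-scaleᶠ w 𝟘 x _ U) (≈-trans (*-congˡ eq) (zeroʳ x)))) (+-identityʳ _))

    a-part : W a ψ′ U ≈ W a ψ U
    a-part = absorb a (W-square a (W b ψ) U)

    b-part : W b ψ′ U ≈ W b ψ U
    b-part = absorb b (≈-trans (W-antisym b a (W b ψ) U) (≈-trans (*-congˡ (≈-trans (Q-congᶠ (W-square b ψ) U) (Q-0ᶠ a 𝟘 U))) (zeroʳ σ)))

    z-part : W z ψ′ U ≈ W z ψ U + x * W a (W b (W z ψ)) U
    z-part = ≈-trans (Q-+ᶠ z 𝟘 ψ _ U) (+-congˡ (≈-trans (Q-scaleᶠ z 𝟘 x _ U) (*-congˡ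
      (≈-trans (W-antisym z a (W b ψ) U) (≈-trans (*-congˡ (≈-trans (Q-congᶠ (W-antisym z b ψ) U) (Q-scaleᶠ a 𝟘 σ _ U)))
      (≈-trans (≈-sym (*-assoc _ _ _)) (≈-trans (*-congʳ σσ) (*-identityˡ _))))))))

  W-empty : ∀ {n} (a : Vector n) φ U → ∣ U ∣ ≡ 0 → W a φ U ≈ 0#
  W-empty a φ U eq = ≈-trans (W-local a U (λ V p → contradiction (trans p eq) λ ())) (Q-0ᶠ a 𝟘 U)

  exp-empty : ∀ {n} (P : Bivector n) U → ∣ U ∣ ≡ 0 → exp P U ≈ 1#
  exp-empty ((x , a , b) ∷ P) U eq = ≈-trans (+-cong (exp-empty P U eq) (≈-trans (*-congˡ (W-empty a _ U eq)) (zeroʳ x))) (+-identityʳ 1#)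
  exp-empty [] []          eq = ≈-refl
  exp-empty [] (false ∷ U) eq = exp-empty [] U eq

  first-contraction : ∀ {n} (U : Subset n) {k} → ∣ U ∣ ≡ suc k → ∃[ v ] ∃[ V ] ∣ V ∣ ≡ k × (∀ φ → φ U ≈ ∂ v φ V)
  first-contraction (true ∷ U)  eq = zero , false ∷ U , ℕ.suc-injective eq ,
    λ φ → ≈-sym (≈-trans (+-cong (*-identityˡ _) (Q-𝟘 _ U)) (+-identityʳ _))
  first-contraction (false ∷ U) eq with v , V , p , q ← first-contraction U eq =
    suc v , false ∷ V , p , λ φ → ≈-trans (q (λ V → φ (false ∷ V))) (≈-sym (≈-trans (+-congʳ (zeroˡ _)) (+-identityˡ _)))

  exp-unique : ∀ {n} (P R : Bivector n) → (∀ v j → entry P v j ≈ entry R v j) → ∀ k U → ∣ U ∣ ℕ.≤ k → exp P U ≈ exp R U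
  exp-unique P R eq zero    U le = ≈-trans (exp-empty P U (ℕ.n≤0⇒n≡0 le)) (≈-sym (exp-empty R U (ℕ.n≤0⇒n≡0 le)))
  exp-unique P R eq (suc k) U le with ∣ U ∣ in size
  ... | zero  = exp-unique P R eq k U (ℕ.≤-trans (ℕ.≤-reflexive size) z≤n)
  ... | suc j with v , V , p , q ← first-contraction U size =
    ≈-trans (q (exp P)) (≈-trans (∂-exp P v V) (≈-trans (Q-cong (eq v) (λ _ → ≈-refl) (λ _ → ≈-refl) V)
      (≈-trans (W-local (entry R v) V (λ V′ r → exp-unique P R eq k V′ (ℕ.≤-trans (ℕ.n≤1+n _) (ℕ.≤-trans (ℕ.≤-reflexive (trans r p)) (ℕ.s≤s⁻¹ le)))))
      (≈-sym (≈-trans (q (exp R)) (∂-exp R v V))))))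

  exp-support : ∀ {n} (P : Bivector n) U → 2 ℕ.* length P ℕ.< ∣ U ∣ → exp P U ≈ 0#
  exp-support [] (true ∷ U)  lt = ≈-refl
  exp-support [] (false ∷ U) lt = exp-support [] U lt
  exp-support ((x , a , b) ∷ P) U lt = ≈-trans (+-cong (exp-support P U (ℕ.<-trans (ℕ.<-trans (ℕ.n<1+n _) (ℕ.n<1+n _)) lt′))
    (≈-trans (*-congˡ (W-support a (W-support b (exp-support P)) U lt′)) (zeroʳ x))) (+-identityˡ 0#)
    where
    lt′ : suc (suc (2 ℕ.* length P)) ℕ.< ∣ U ∣
    lt′ = subst (ℕ._< ∣ U ∣) (ℕ.*-suc 2 (length P)) lt

  -- Pfaffians as coefficients of exponentials

  W-unit : ∀ {n} (i : Fin n) φ U → W (unit i) φ U ≈ (if Vec.lookup U i then σ ^ before i U * φ (remove U i) else 0#)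
  W-unit zero φ (true ∷ U)  = ≈-trans (+-congˡ (≈-trans (*-congˡ (Q-𝟘 _ U)) (zeroʳ σ))) (+-identityʳ _)
  W-unit zero φ (false ∷ U) = ≈-trans (+-cong (zeroˡ _) (Q-𝟘 _ U)) (+-identityˡ 0#)
  W-unit (suc i) φ (false ∷ U) = ≈-trans (+-cong (zeroˡ _) (W-unit i _ U)) (+-identityˡ _)
  W-unit (suc i) φ (true ∷ U) with ih ← W-unit i (λ V → φ (true ∷ V)) U with Vec.lookup U i
  ... | true  = ≈-trans (+-cong (zeroˡ _) (*-congˡ ih)) (≈-trans (+-identityˡ _) (≈-sym (*-assoc _ _ _)))
  ... | false = ≈-trans (+-cong (zeroˡ _) (≈-trans (*-congˡ ih) (zeroʳ σ))) (+-identityˡ 0#)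

  module _ {n : ℕ} where

    θ : List (Edge n) → Form n
    θ []      = δ∅
    θ (e ∷ E) = W (unit (lo e)) (W (unit (hi e)) (θ E))

    σ-even : ∀ d → σ ^ (2 ℕ.* d) ≈ 1#
    σ-even d = ≈-trans (≈-sym (^-assocʳ σ 2 d)) (≈-trans (CommutativeExp.^-congˡ commutativeSemiring d (≈-trans (*-congˡ (*-identityʳ σ)) σσ)) (MonomialValue.1^ F n d))

    δ∅-Covers : ∀ (U : Subset n) → Covers U [] → δ∅ U ≈ 1#
    δ∅-Covers = go
      where
      go : ∀ {m} (U : Subset m) → (∀ v → 0 ≡ bit (Vec.lookup U v)) → δ∅ U ≈ 1#
      go []          c = ≈-refl
      go (false ∷ U) c = go U (c ∘ suc)
      go (true ∷ U)  c = contradiction (c zero) λ ()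

    δ∅-¬Covers : ∀ (U : Subset n) → ¬ Covers U [] → δ∅ U ≈ 0#
    δ∅-¬Covers = go
      where
      go : ∀ {m} (U : Subset m) → ¬ (∀ v → 0 ≡ bit (Vec.lookup U v)) → δ∅ U ≈ 0#
      go []          c = contradiction (λ ()) c
      go (false ∷ U) c = go U λ d → c λ { zero → refl ; (suc v) → d v }
      go (true ∷ U)  c = ≈-refl

    θ-Covers : ∀ E U → Covers U E → θ E U ≈ σ ^ cr E
    θ-Covers []      U c = δ∅-Covers U c
    θ-Covers (e ∷ E) U c with i∈ , j∈ , c′ ← Covers-∷⁻ {U = U} {e} {E} c =
      ≈-trans (W-unit (lo e) _ U) (≈-trans (select i∈) (≈-trans (*-congˡ (≈-trans (W-unit (hi e) _ _) (≈-trans (select j∈) (*-congˡ (θ-Covers E V c′)))))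
      (≈-trans (≈-sym (*-assoc _ _ _)) (≈-trans (*-congʳ (≈-trans (≈-sym (^-homo-* σ (before (lo e) U) _)) sign)) (≈-sym (^-homo-* σ (length (filter (cross? e) E)) (cr E)))))))
      where
      V = remove (remove U (lo e)) (hi e)

      select : ∀ {b} {x : Carrier} → b ≡ true → (if b then x else 0#) ≈ x
      select refl = ≈-refl

      before-lo : before (lo e) V ≡ before (lo e) U
      before-lo = trans (before-remove (lo e) (hi e) _ (Fin.<-asym (lo<hi e))) (before-remove (lo e) (lo e) U (Fin.<-irrefl refl))

      before-hi : before (hi e) V ≡ before (hi e) (remove U (lo e))
      before-hi = before-remove (hi e) (hi e) _ (Fin.<-irrefl refl)

      sign : σ ^ (before (lo e) U ℕ.+ before (hi e) (remove U (lo e))) ≈ σ ^ length (filter (cross? e) E)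
      sign with d , eq ← crossings-parity {U = V} {E} e c′ (trans (lookup∘update′ (lo≢hi e) (remove U (lo e)) false) (lookup∘update (lo e) U false)) (lookup∘update (hi e) (remove U (lo e)) false) =
        ≈-trans (^-congʳ σ (trans (sym (cong₂ ℕ._+_ before-lo before-hi)) eq))
          (≈-trans (^-homo-* σ (length (filter (cross? e) E)) _) (≈-trans (*-congˡ (σ-even d)) (*-identityʳ _)))

    θ-¬Covers : ∀ E U → ¬ Covers U E → θ E U ≈ 0#
    θ-¬Covers []      U ¬c = δ∅-¬Covers U ¬c
    θ-¬Covers (e ∷ E) U ¬c with Vec.lookup U (lo e) in i∈ | W-unit (lo e) (W (unit (hi e)) (θ E)) U
    ... | false | eq = eq
    ... | true  | eq with Vec.lookup (remove U (lo e)) (hi e) in j∈ | W-unit (hi e) (θ E) (remove U (lo e))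
    ... | false | eq′ = ≈-trans eq (≈-trans (*-congˡ eq′) (zeroʳ _))
    ... | true  | eq′ = ≈-trans eq (≈-trans (*-congˡ (≈-trans eq′ (≈-trans (*-congˡ (θ-¬Covers E _ λ c → ¬c (Covers-∷⁺ {U = U} {e} {E} i∈ j∈ c))) (zeroʳ _)))) (zeroʳ _))

    module _ (x : Edge n → Carrier) where

      edgeBivector : List (Edge n) → Bivector n
      edgeBivector = map λ e → x e , unit (lo e) , unit (hi e)

      W-∑ : ∀ {b} {B : Set b} (a : Vector n) (φ : B → Form n) xs U → W a (λ V → ∑.fold (λ y → φ y V) xs) U ≈ ∑.fold (λ y → W a (φ y) U) xs
      W-∑ a φ []       U = Q-0ᶠ a 𝟘 U
      W-∑ a φ (y ∷ ys) U = ≈-trans (Q-+ᶠ a 𝟘 _ _ U) (+-congˡ (W-∑ a φ ys U))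

      exp-expand : ∀ L U → exp (edgeBivector L) U ≈ ∑.fold (λ E → ∏.fold x E * θ E U) (sublists L)
      exp-expand []      U = ≈-sym (≈-trans (+-identityʳ _) (*-identityˡ _))
      exp-expand (e ∷ L) U = ≈-trans (+-comm _ _) (≈-trans (+-cong (≈-trans (*-congˡ inner) with-e) (exp-expand L U))
        (≈-sym (∑.fold-++ _ (map (e ∷_) (sublists L)) (sublists L))))
        where
        i = unit (lo e)
        j = unit (hi e)
        pull : ∀ a (φ : List (Edge n) → Form n) U → W a (λ V → ∑.fold (λ E → ∏.fold x E * φ E V) (sublists L)) U ≈ ∑.fold (λ E → ∏.fold x E * W a (φ E) U) (sublists L)
        pull a φ U = ≈-trans (W-∑ a (λ E V → ∏.fold x E * φ E V) (sublists L) U) (∑.fold-cong (sublists L) (λ E → Q-scaleᶠ a 𝟘 _ (φ E) U))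
        inner : W i (W j (exp (edgeBivector L))) U ≈ ∑.fold (λ E → ∏.fold x E * θ (e ∷ E) U) (sublists L)
        inner = ≈-trans (Q-congᶠ (λ V → ≈-trans (Q-congᶠ (exp-expand L) V) (pull j θ V)) U) (pull i (λ E → W j (θ E)) U)
        with-e : x e * ∑.fold (λ E → ∏.fold x E * θ (e ∷ E) U) (sublists L) ≈ ∑.fold (λ E → ∏.fold x E * θ E U) (map (e ∷_) (sublists L))
        with-e = go (sublists L)
          where
          go : ∀ Es → x e * ∑.fold (λ E → ∏.fold x E * θ (e ∷ E) U) Es ≈ ∑.fold (λ E → ∏.fold x E * θ E U) (map (e ∷_) Es)
          go []       = zeroʳ _
          go (E ∷ Es) = ≈-trans (distribˡ _ _ _) (+-cong (≈-sym (*-assoc _ _ _)) (go Es))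

      exp-matchings : ∀ U → exp (edgeBivector (allEdges n)) U ≈ ∑.fold (λ E → σ ^ cr E * ∏.fold x E) (perfectMatchings U)
      exp-matchings U = ≈-trans (exp-expand (allEdges n) U)
        (≈-trans (∑.fold-cong (sublists (allEdges n)) step) (≈-sym (∑.fold-filter (perfectMatching? U) _ (sublists (allEdges n)))))
        where
        step : ∀ E → ∏.fold x E * θ E U ≈ (if does (perfectMatching? U E) then σ ^ cr E * ∏.fold x E else 0#)
        step E = go (perfectMatching? U E)
          where
          go : (d : Dec (PerfectMatching U E)) → ∏.fold x E * θ E U ≈ (if does d then σ ^ cr E * ∏.fold x E else 0#)
          go (yes pm) = ≈-trans (*-comm _ _) (*-congʳ (θ-Covers E U (PM⇒Covers {U = U} {E} pm)))
          go (no ¬pm) = ≈-trans (*-congˡ (θ-¬Covers E U (λ c → ¬pm (Covers⇒PM {U = U} {E} c)))) (zeroʳ _)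

  module _ {n : ℕ} where

    skew : List (Vector n × Vector n) → Edge n → Carrier
    skew L e = ∑.fold (λ { (a , b) → a (lo e) * b (hi e) + σ * (b (lo e) * a (hi e)) }) L

    skewBivector : List (Vector n × Vector n) → Bivector n
    skewBivector = map λ { (a , b) → 1# , a , b }

    unit-≡ : ∀ (i : Fin n) → unit i i ≈ 1#
    unit-≡ = go
      where
      go : ∀ {m} (i : Fin m) → unit i i ≈ 1#
      go zero    = ≈-refl
      go (suc i) = go i

    unit-≢ : ∀ {i j : Fin n} → i ≢ j → unit i j ≈ 0#
    unit-≢ = go
      where
      go : ∀ {m} {i j : Fin m} → i ≢ j → unit i j ≈ 0#
      go {i = zero}  {zero}  i≢j = contradiction refl i≢j
      go {i = zero}  {suc j} i≢j = ≈-refl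
      go {i = suc i} {zero}  i≢j = ≈-refl
      go {i = suc i} {suc j} i≢j = go (i≢j ∘ cong suc)

    entry-skew : ∀ L v j → entry (skewBivector L) v j ≈ ∑.fold (λ { (a , b) → a v * b j + σ * (b v * a j) }) L
    entry-skew []            v j = ≈-refl
    entry-skew ((a , b) ∷ L) v j = +-cong (*-identityˡ _) (entry-skew L v j)

    entry-edges : ∀ L v j → entry (edgeBivector (skew L) (allEdges n)) v j ≈ entry (skewBivector L) v j
    entry-edges L v j = ≈-trans (reflexive (∑.fold-map _ _ (allEdges n))) (≈-trans cases (≈-sym (entry-skew L v j)))
      where
      summand : Edge n → Carrier
      summand e = skew L e * (unit (lo e) v * unit (hi e) j + σ * (unit (hi e) v * unit (lo e) j))

      vanish : ∀ {e} → ¬ (lo e ≡ v × hi e ≡ j) → ¬ (hi e ≡ v × lo e ≡ j) → summand e ≈ 0#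
      vanish {e} ¬p ¬q = ≈-trans (*-congˡ (≈-trans (+-cong (off ¬p) (≈-trans (*-congˡ (off ¬q)) (zeroʳ σ))) (+-identityˡ 0#))) (zeroʳ _)
        where
        off : ∀ {x y : Fin n} → ¬ (x ≡ v × y ≡ j) → unit x v * unit y j ≈ 0#
        off {x} {y} ¬r with x Fin.≟ v | y Fin.≟ j
        ... | yes p | yes q = contradiction (p , q) ¬r
        ... | no p  | _     = ≈-trans (*-congʳ (unit-≢ p)) (zeroˡ _)
        ... | yes _ | no q  = ≈-trans (*-congˡ (unit-≢ q)) (zeroʳ _)

      diagonal : ∀ L → 0# ≈ ∑.fold (λ { (a , b) → a v * b v + σ * (b v * a v) }) L
      diagonal []            = ≈-refl
      diagonal ((a , b) ∷ L) = ≈-sym (≈-trans (+-cong (kill (a v * b v) (solve 3 (λ s x y → x :* y :+ s :* (y :* x) := con 0 :+ (con 1 :+ s) :* (x :* y)) ≈-refl σ (a v) (b v))) (≈-sym (diagonal L))) (+-identityˡ 0#))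

      flip : ∀ L v j → σ * ∑.fold (λ { (a , b) → a v * b j + σ * (b v * a j) }) L ≈ ∑.fold (λ { (a , b) → a j * b v + σ * (b j * a v) }) L
      flip []            v j = zeroʳ σ
      flip ((a , b) ∷ L) v j = ≈-trans (distribˡ _ _ _) (+-cong
        (≈-trans (distribˡ _ _ _) (≈-trans (+-congˡ (≈-trans (≈-sym (*-assoc _ _ _)) (≈-trans (*-congʳ σσ) (*-identityˡ _))))
          (solve 5 (λ s p q r t → s :* (p :* q) :+ r :* t := t :* r :+ s :* (q :* p)) ≈-refl σ (a v) (b j) (b v) (a j)))) (flip L v j))

      cases : ∑.fold summand (allEdges n) ≈ ∑.fold (λ { (a , b) → a v * b j + σ * (b v * a j) }) L
      cases with Fin.<-cmp v j
      ... | tri≈ _ refl _ = ≈-trans (∑.fold-ε (allEdges n) λ {e} _ →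
        vanish {e} (λ { (p , q) → lo≢hi e (trans p (sym q)) }) (λ { (p , q) → lo≢hi e (trans q (sym p)) })) (diagonal L)
      ... | tri< v<j _ _ = ≈-trans (∑.fold-single (allEdges-unique n) (∈-allEdges n (edge v j v<j)) λ e e≢ →
          vanish {e} (λ { (p , q) → e≢ (edge-≡ p q) }) (λ { (refl , refl) → Fin.<-asym v<j (lo<hi e) }))
        (≈-trans (*-congˡ (≈-trans (+-cong (≈-trans (*-cong (unit-≡ v) (unit-≡ j)) (*-identityˡ 1#))
          (≈-trans (*-congˡ (≈-trans (*-congʳ (unit-≢ (Fin.<⇒≢ v<j ∘ sym))) (zeroˡ _))) (zeroʳ σ))) (+-identityʳ 1#))) (*-identityʳ _))
      ... | tri> _ _ j<v = ≈-trans (∑.fold-single (allEdges-unique n) (∈-allEdges n (edge j v j<v)) λ e e≢ →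
          vanish {e} (λ { (refl , refl) → Fin.<-asym j<v (lo<hi e) }) (λ { (p , q) → e≢ (edge-≡ q p) }))
        (≈-trans (*-congˡ (≈-trans (+-cong (≈-trans (*-congʳ (unit-≢ (Fin.<⇒≢ j<v))) (zeroˡ _))
          (≈-trans (*-congˡ (≈-trans (*-cong (unit-≡ v) (unit-≡ j)) (*-identityˡ 1#))) (*-identityʳ σ))) (+-identityˡ σ))) (≈-trans (*-comm _ _) (flip L j v)))

    matchings-vanish : ∀ L U → 2 ℕ.* length L ℕ.< ∣ U ∣ → ∑.fold (λ E → σ ^ cr E * ∏.fold (skew L) E) (perfectMatchings U) ≈ 0#
    matchings-vanish L U lt = ≈-trans (≈-sym (exp-matchings (skew L) U)) (≈-trans (exp-unique (edgeBivector (skew L) (allEdges n)) (skewBivector L) (entry-edges L) _ U ℕ.≤-refl)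
      (exp-support (skewBivector L) U (subst (λ k → 2 ℕ.* k ℕ.< ∣ U ∣) (sym (List.length-map _ L)) lt)))

module PfaffianValue {c ℓ₁ ℓ₂} (K : HeytingField c ℓ₁ ℓ₂) (n : ℕ) {a b} (F : CommutativeRing a b) (ι : Hom (Evaluation.KR K n) F) where
  open CommutativeRing F hiding (zero) renaming (refl to ≈-refl; sym to ≈-sym; trans to ≈-trans)
  open Evaluation K n
  open Exterior F
  open Hom ι
  private
    module ∑ = Big +-commutativeMonoid

  eval-pfaffian : ∀ L U → 2 ℕ.* length L ℕ.< ∣ U ∣ → eval F ι (skew L) (pfaffian K n U) ≈ 0#
  eval-pfaffian L U lt = ≈-trans (reflexive (∑.fold-map _ _ (perfectMatchings U)))
    (≈-trans (∑.fold-cong (perfectMatchings U) (λ E → *-cong (≈-trans (⟦⟧-^ ι _ (cr E)) (CommutativeExp.^-congˡ commutativeSemiring (cr E) (≈-trans (⟦⟧-neg _) (-‿cong ⟦⟧-1))))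
      (MonomialValue.mon-edgeProduct F n (skew L) E))) (matchings-vanish L U lt))

  eval-pfaffianIdeal : ∀ L {p} → p ∈ PfaffianIdeal K n (length L) → eval F ι (skew L) p ≈ 0#
  eval-pfaffianIdeal L = eval-ideal F ι (skew L) λ { (U , size , refl) → eval-pfaffian L U
    (ℕ.≤-trans (ℕ.+-monoˡ-≤ (2 ℕ.* length L) (s≤s (z≤n {1}))) (ℕ.≤-reflexive (trans (sym (ℕ.*-suc 2 (length L))) (sym size)))) }

-- Bubble sort with comparators switched off on a set of pairs

cnt : ℕ → List ℕ → ℕ
cnt a []       = 0
cnt a (x ∷ xs) = [ x ℕ.<? a ] ℕ.+ cnt a xs

private module + = SemigroupProperties (CommutativeMonoid.commutativeSemigroup ℕ.+-0-commutativeMonoid)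

above : ℕ → List ℕ → ℕ
above y []       = 0
above y (x ∷ xs) = [ y ℕ.<? x ] ℕ.+ above y xs

ascents : List ℕ → ℕ
ascents []       = 0
ascents (x ∷ xs) = above x xs ℕ.+ ascents xs

ascents-snoc : ∀ xs z → ascents (xs ++ z ∷ []) ≡ ascents xs ℕ.+ cnt z xs
ascents-snoc []       z = refl
ascents-snoc (x ∷ xs) z = trans (cong₂ ℕ._+_ (above-snoc xs) (ascents-snoc xs z)) (+.interchange (above x xs) [ x ℕ.<? z ] (ascents xs) (cnt z xs))
  where
  above-snoc : ∀ xs → above x (xs ++ z ∷ []) ≡ above x xs ℕ.+ [ x ℕ.<? z ]
  above-snoc []       = ℕ.+-identityʳ _
  above-snoc (y ∷ ys) = trans (cong ([ x ℕ.<? y ] ℕ.+_) (above-snoc ys)) (sym (ℕ.+-assoc [ x ℕ.<? y ] (above x ys) _))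

-- Row i of the network: the carry κ meets columns j, j + 1, … in turn and, except at a pair
-- of s, leaves the larger of the two entries behind; t counts the exchanges.
module Network (s : ℕ → ℕ → Bool) where

  data Sweep (i : ℕ) : ℕ → ℕ → List ℕ → List ℕ → ℕ → ℕ → Set where
    done : ∀ {j κ} → Sweep i j κ [] [] κ 0
    stay : ∀ {j κ x xs out κ′ t} → s i j ≡ true ⊎ x ℕ.≤ κ → Sweep i (suc j) x xs out κ′ t → Sweep i j κ (x ∷ xs) (κ ∷ out) κ′ t
    swap : ∀ {j κ x xs out κ′ t} → s i j ≡ false → κ ℕ.< x → Sweep i (suc j) κ xs out κ′ t → Sweep i j κ (x ∷ xs) (x ∷ out) κ′ (suc t)

  data Runs : ℕ → List ℕ → ℕ → Set where
    end : ∀ {i} → Runs i [] 0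
    row : ∀ {i κ xs out t t′} → Sweep i (suc i) κ xs out i t → cnt i out ≡ 0 → Runs (suc i) out t′ → Runs i (κ ∷ xs) (t ℕ.+ t′)

  sweep : ∀ i j κ xs → ∃[ out ] ∃[ κ′ ] ∃[ t ] Sweep i j κ xs out κ′ t
  sweep i j κ []       = _ , _ , _ , done
  sweep i j κ (x ∷ xs) with s i j in eq | κ ℕ.<? x
  ... | true  | _       = let _ , _ , _ , w = sweep i (suc j) x xs in _ , _ , _ , stay (inj₁ eq) w
  ... | false | no κ≮x  = let _ , _ , _ , w = sweep i (suc j) x xs in _ , _ , _ , stay (inj₂ (ℕ.≮⇒≥ κ≮x)) w
  ... | false | yes κ<x = let _ , _ , _ , w = sweep i (suc j) κ xs in _ , _ , _ , swap eq κ<x w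

  sweep-length : ∀ {i j κ xs out κ′ t} → Sweep i j κ xs out κ′ t → length out ≡ length xs
  sweep-length done         = refl
  sweep-length (stay _ w)   = cong suc (sweep-length w)
  sweep-length (swap _ _ w) = cong suc (sweep-length w)

  conserve : ∀ a {i j κ xs out κ′ t} → Sweep i j κ xs out κ′ t → [ κ ℕ.<? a ] ℕ.+ cnt a xs ≡ [ κ′ ℕ.<? a ] ℕ.+ cnt a out
  conserve a done = refl
  conserve a {κ = κ} {x ∷ xs} {κ ∷ out} {κ′} (stay _ w) =
    trans (cong ([ κ ℕ.<? a ] ℕ.+_) (conserve a w)) (+.x∙yz≈y∙xz [ κ ℕ.<? a ] [ κ′ ℕ.<? a ] (cnt a out))
  conserve a {κ = κ} {x ∷ xs} {x ∷ out} {κ′} (swap _ _ w) =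
    trans (+.x∙yz≈y∙xz [ κ ℕ.<? a ] [ x ℕ.<? a ] (cnt a xs))
    (trans (cong ([ x ℕ.<? a ] ℕ.+_) (conserve a w)) (+.x∙yz≈y∙xz [ x ℕ.<? a ] [ κ′ ℕ.<? a ] (cnt a out)))

  above-sweep : ∀ y {i j κ xs out κ′ t} → Sweep i j κ xs out κ′ t → above y (κ ∷ xs) ≡ above y (out ++ κ′ ∷ [])
  above-sweep y done                         = refl
  above-sweep y {κ = κ} (stay _ w)           = cong ([ y ℕ.<? κ ] ℕ.+_) (above-sweep y w)
  above-sweep y {κ = κ} {x ∷ xs} (swap _ _ w) = trans (+.x∙yz≈y∙xz [ y ℕ.<? κ ] [ y ℕ.<? x ] (above y xs)) (cong ([ y ℕ.<? x ] ℕ.+_) (above-sweep y w))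

  ascents-sweep : ∀ {i j κ xs out κ′ t} → Sweep i j κ xs out κ′ t → ascents (κ ∷ xs) ≡ ascents (out ++ κ′ ∷ []) ℕ.+ t
  ascents-sweep done = refl
  ascents-sweep {κ = κ} {x ∷ xs} {_ ∷ out} {κ′} {t} (stay _ w) =
    trans (cong₂ ℕ._+_ (above-sweep κ w) (ascents-sweep w)) (sym (ℕ.+-assoc (above κ (out ++ κ′ ∷ [])) _ t))
  ascents-sweep {κ = κ} {x ∷ xs} {_ ∷ out} {κ′} {suc t} (swap _ κ<x w) =
    trans (cong (λ z → (z ℕ.+ above κ xs) ℕ.+ (above x xs ℕ.+ ascents xs)) ([]-yes {d = κ ℕ.<? x} κ<x))
    (trans (cong suc (trans (+.x∙yz≈y∙xz (above κ xs) (above x xs) (ascents xs))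
       (trans (cong₂ ℕ._+_ (sym (cong (ℕ._+ above x xs) ([]-no {d = x ℕ.<? κ} (ℕ.<-asym κ<x)))) (ascents-sweep w))
       (trans (cong (ℕ._+ (ascents (out ++ κ′ ∷ []) ℕ.+ t)) (above-sweep x w)) (sym (ℕ.+-assoc (above x (out ++ κ′ ∷ [])) _ t))))))
    (sym (ℕ.+-suc _ t)))

  ascents-runs : ∀ {i xs t} → Runs i xs t → ascents xs ≡ t
  ascents-runs end = refl
  ascents-runs {i} (row {out = out} {t} {t′} w low r) = trans (ascents-sweep w) (trans (cong (ℕ._+ t) (trans (ascents-snoc out i)
    (trans (cong (ascents out ℕ.+_) low) (trans (ℕ.+-identityʳ _) (ascents-runs r))))) (ℕ.+-comm t′ t))

  -- Crossings through the cut between a - 1 and a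

  module Cut (n a : ℕ) where

    data Chain : ℕ → ℕ → ℕ → Set where
      []  : ∀ {i b} → Chain i b 0
      add : ∀ {i b i′ j r} → i ℕ.≤ i′ → i′ ℕ.< a → b ℕ.≤ j → j ℕ.< n → s i′ j ≡ true → Chain (suc i′) (suc j) r → Chain i b (suc r)

    weaken : ∀ {i i′ b b′ r} → i ℕ.≤ i′ → b ℕ.≤ b′ → Chain i′ b′ r → Chain i b r
    weaken p q []                  = []
    weaken p q (add h u v w x c) = add (ℕ.≤-trans p h) u (ℕ.≤-trans q v) w x c

    chain-rows : ∀ {i b r} → i ℕ.≤ a → Chain i b r → r ℕ.+ i ℕ.≤ a
    chain-rows le []                        = le
    chain-rows {i} le (add {i′ = i′} {r = r} p q _ _ _ c) = ℕ.≤-trans (ℕ.≤-reflexive (sym (ℕ.+-suc r i)))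
      (ℕ.≤-trans (ℕ.+-monoʳ-≤ r (s≤s p)) (chain-rows q c))

    chain-columns : ∀ {i b r} → b ℕ.≤ n → Chain i b r → r ℕ.+ b ℕ.≤ n
    chain-columns le []                     = le
    chain-columns {b = b} le (add {r = r} _ _ p q _ c) = ℕ.≤-trans (ℕ.≤-reflexive (sym (ℕ.+-suc r b)))
      (ℕ.≤-trans (ℕ.+-monoʳ-≤ r (s≤s p)) (chain-columns q c))

    Bounded : ℕ → ℕ → List ℕ → Set
    Bounded i j []       = ⊤
    Bounded i j (x ∷ xs) = (∀ {r} → Chain i j r → r ℕ.≤ cnt a (x ∷ xs)) × Bounded i (suc j) xs

    bound : ∀ {i j} xs → j ℕ.+ length xs ≡ n → Bounded i j xs → ∀ {r} → Chain i j r → r ℕ.≤ cnt a xs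
    bound {j = j} []       eq _       []                = z≤n
    bound {j = j} []       eq _       (add _ _ p q _ _) = contradiction (ℕ.≤-<-trans (ℕ.≤-trans (ℕ.≤-reflexive (trans (sym eq) (ℕ.+-identityʳ j))) p) q) (ℕ.<-irrefl refl)
    bound         (x ∷ xs) eq (h , _)                   = h

    forward : ∀ {i j κ xs out κ′ t} → Sweep i j κ xs out κ′ t → i ℕ.< a → j ℕ.+ length xs ≡ n → Bounded i j xs →
      (¬ (κ ℕ.< a) → ∀ {r} → Chain (suc i) j r → suc r ℕ.≤ cnt a xs) → κ′ ℕ.< a × Bounded (suc i) j out
    forward {κ = κ} done i<a eq bd carry with κ ℕ.<? a
    ... | yes κ<a = κ<a , _
    ... | no κ≮a  = contradiction (carry κ≮a []) λ ()
    forward {i} {j} {κ} {x ∷ xs} {o ∷ out} {κ′} w i<a eq (h , bd) carry = κ′<a , head , rest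
      where
      eq′ : suc j ℕ.+ length xs ≡ n
      eq′ = trans (sym (ℕ.+-suc j (length xs))) eq

      tail : ∀ {t} → Sweep i j κ (x ∷ xs) (o ∷ out) κ′ t → κ′ ℕ.< a × Bounded (suc i) (suc j) out
      tail (stay (inj₁ sij) w′) = forward w′ i<a eq′ bd λ x≮a c →
        ℕ.≤-trans (h (add ℕ.≤-refl i<a ℕ.≤-refl (ℕ.≤-trans (ℕ.m≤m+n (suc j) (length xs)) (ℕ.≤-reflexive eq′)) sij c)) (ℕ.≤-reflexive (cong (ℕ._+ cnt a xs) ([]-no {d = x ℕ.<? a} x≮a)))
      tail (stay (inj₂ x≤κ) w′) = forward w′ i<a eq′ bd λ x≮a c →
        ℕ.≤-trans (carry (λ κ<a → x≮a (ℕ.≤-<-trans x≤κ κ<a)) (weaken ℕ.≤-refl (ℕ.n≤1+n j) c)) (ℕ.≤-reflexive (cong (ℕ._+ cnt a xs) ([]-no {d = x ℕ.<? a} x≮a)))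
      tail (swap _ κ<x w′) = forward w′ i<a eq′ bd λ κ≮a c →
        ℕ.≤-trans (carry κ≮a (weaken ℕ.≤-refl (ℕ.n≤1+n j) c)) (ℕ.≤-reflexive (cong (ℕ._+ cnt a xs) ([]-no {d = x ℕ.<? a} (λ x<a → κ≮a (ℕ.<-trans κ<x x<a)))))

      κ′<a = proj₁ (tail w)
      rest = proj₂ (tail w)

      balance : [ κ ℕ.<? a ] ℕ.+ cnt a (x ∷ xs) ≡ suc (cnt a (o ∷ out))
      balance = trans (conserve a w) (cong (ℕ._+ cnt a (o ∷ out)) ([]-yes {d = κ′ ℕ.<? a} κ′<a))

      head : ∀ {r} → Chain (suc i) j r → r ℕ.≤ cnt a (o ∷ out)
      head c with κ ℕ.<? a
      ... | yes κ<a = ℕ.≤-trans (h (weaken (ℕ.n≤1+n i) ℕ.≤-refl c))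
        (ℕ.≤-reflexive (ℕ.suc-injective (trans (cong (ℕ._+ cnt a (x ∷ xs)) (sym ([]-yes {d = κ ℕ.<? a} κ<a))) balance)))
      ... | no κ≮a = ℕ.s≤s⁻¹ (ℕ.≤-trans (carry κ≮a c)
        (ℕ.≤-reflexive (trans (cong (ℕ._+ cnt a (x ∷ xs)) (sym ([]-no {d = κ ℕ.<? a} κ≮a))) balance)))

    backward : ∀ {i j κ xs out κ′ t} → Sweep i j κ xs out κ′ t → κ′ ℕ.< a → j ℕ.+ length xs ≡ n → Bounded (suc i) j out → Bounded i j xs
    backward done κ′<a eq bd = _
    backward {i} {j} {κ} {x ∷ xs} {o ∷ out} {κ′} w κ′<a eq (h , bd) = head w , tail w
      where
      eq′ : suc j ℕ.+ length xs ≡ n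
      eq′ = trans (sym (ℕ.+-suc j (length xs))) eq

      tail : ∀ {t} → Sweep i j κ (x ∷ xs) (o ∷ out) κ′ t → Bounded i (suc j) xs
      tail (stay _ w′)   = backward w′ κ′<a eq′ bd
      tail (swap _ _ w′) = backward w′ κ′<a eq′ bd

      balance : ∀ {j κ xs out t} → Sweep i j κ xs out κ′ t → suc (cnt a out) ≡ [ κ ℕ.<? a ] ℕ.+ cnt a xs
      balance w = trans (cong (ℕ._+ _) (sym ([]-yes {d = κ′ ℕ.<? a} κ′<a))) (sym (conserve a w))

      head : ∀ {r t} → Sweep i j κ (x ∷ xs) (o ∷ out) κ′ t → Chain i j r → r ℕ.≤ cnt a (x ∷ xs)
      head w [] = z≤n
      head w c@(add {i′ = i′} {j = j′} p q u v sij c′) with ℕ.m≤n⇒m<n∨m≡n p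
      ... | inj₁ i<i′ = ℕ.≤-trans (h (add i<i′ q u v sij c′))
        (ℕ.s≤s⁻¹ (ℕ.≤-trans (ℕ.≤-reflexive (balance w)) (ℕ.+-monoˡ-≤ (cnt a (x ∷ xs)) ([]≤1 (κ ℕ.<? a)))))
      ... | inj₂ refl with ℕ.m≤n⇒m<n∨m≡n u
      ... | inj₁ j<j′ = ℕ.≤-trans (bound xs eq′ (tail w) (add p q j<j′ v sij c′)) (ℕ.m≤n+m _ [ x ℕ.<? a ])
      ... | inj₂ refl with w
      ... | stay _ w′     = ℕ.≤-trans (s≤s (bound out (trans (cong (suc j ℕ.+_) (sweep-length w′)) eq′) bd c′)) (ℕ.≤-reflexive (balance w′))
      ... | swap ¬sij _ _ = contradiction (trans (sym sij) ¬sij) λ ()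

    -- The entries in columns j to a - 1 are below a from column h on.
    data Split (i h : ℕ) : ℕ → List ℕ → Set where
      base : ∀ {xs} → Bounded i a xs → Split i h a xs
      step : ∀ {j x xs} → j ℕ.< a → (x ℕ.< a → h ℕ.≤ j) → (h ℕ.≤ j → x ℕ.< a) → Split i h (suc j) xs → Split i h j (x ∷ xs)

    forward-split : ∀ {i j h κ xs out κ′ t} → Sweep i j κ xs out κ′ t → i ℕ.< a → j ℕ.+ length xs ≡ n →
      (∀ {j} → i ℕ.< j → j ℕ.≤ h → j ℕ.< n → s i j ≡ true) → i ℕ.< j →
      Split i h j xs → (κ ℕ.< a → h ℕ.< j) → (h ℕ.< j → κ ℕ.< a) → (a ℕ.≤ h → cnt a xs ℕ.+ i ≡ a) →
      κ′ ℕ.< a × Split (suc i) (suc h) j out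
    forward-split {i} {h = h} {κ} {xs} w i<a eq short i<j (base bd) f g total =
      let κ′<a , bd′ = forward w i<a eq bd carry in κ′<a , base bd′
      where
      carry : ¬ (κ ℕ.< a) → ∀ {r} → Chain (suc i) a r → suc r ℕ.≤ cnt a xs
      carry κ≮a {r} c = ℕ.+-cancelʳ-≤ i (suc r) (cnt a xs) (ℕ.≤-trans (ℕ.≤-reflexive (sym (ℕ.+-suc r i)))
        (ℕ.≤-trans (chain-rows i<a c) (ℕ.≤-reflexive (sym (total (ℕ.≮⇒≥ (κ≮a ∘ g)))))))
    forward-split {i} {j} {h} {κ} {x ∷ xs} w i<a eq short i<j (step j<a p q sp) f g total with w
    ... | stay _ w′ = let κ′<a , sp′ = forward-split w′ i<a eq′ short (ℕ.<-trans i<j (ℕ.n<1+n j)) sp (s≤s ∘ p) (q ∘ ℕ.s≤s⁻¹) total′ in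
      κ′<a , step j<a f g sp′
      where
      eq′ = trans (sym (ℕ.+-suc j (length xs))) eq
      total′ : a ℕ.≤ h → cnt a xs ℕ.+ i ≡ a
      total′ a≤h = trans (cong (λ z → (z ℕ.+ cnt a xs) ℕ.+ i) (sym ([]-no {d = x ℕ.<? a} (λ x<a → contradiction (ℕ.≤-<-trans (ℕ.≤-trans a≤h (p x<a)) j<a) (ℕ.<-irrefl refl))))) (total a≤h)
    ... | swap ¬sij κ<x w′ = let κ′<a , sp′ = forward-split w′ i<a eq′ short (ℕ.<-trans i<j (ℕ.n<1+n j)) sp (λ _ → ℕ.<-trans h<j (ℕ.n<1+n j)) (λ _ → g h<j) total′ in
      κ′<a , step j<a (λ _ → h<j) (λ _ → q (ℕ.<⇒≤ h<j)) sp′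
      where
      eq′ = trans (sym (ℕ.+-suc j (length xs))) eq
      j<n : j ℕ.< n
      j<n = ℕ.≤-trans (ℕ.m≤m+n (suc j) (length xs)) (ℕ.≤-reflexive eq′)
      h<j : h ℕ.< j
      h<j = ℕ.≰⇒> λ j≤h → contradiction (trans (sym (short i<j j≤h j<n)) ¬sij) λ ()
      total′ : a ℕ.≤ h → cnt a xs ℕ.+ i ≡ a
      total′ a≤h = contradiction (ℕ.<-trans (ℕ.≤-<-trans a≤h h<j) j<a) (ℕ.<-irrefl refl)

    data From (i : ℕ) : ℕ → List ℕ → Set where
      base : ∀ {xs} → Bounded i a xs → From i a xs
      step : ∀ {j x xs} → From i (suc j) xs → From i j (x ∷ xs)

    From-≤ : ∀ {i j xs} → From i j xs → j ℕ.≤ a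
    From-≤ (base _) = ℕ.≤-refl
    From-≤ (step f) = ℕ.≤-trans (ℕ.n≤1+n _) (From-≤ f)

    backward-from : ∀ {i j κ xs out κ′ t} → Sweep i j κ xs out κ′ t → κ′ ℕ.< a → j ℕ.+ length xs ≡ n → From (suc i) j out → From i j xs
    backward-from w κ′<a eq (base bd) = base (backward w κ′<a eq bd)
    backward-from {j = j} {xs = x ∷ xs} w κ′<a eq (step f) with w
    ... | stay _ w′   = step (backward-from w′ κ′<a (trans (sym (ℕ.+-suc j (length xs))) eq) f)
    ... | swap _ _ w′ = step (backward-from w′ κ′<a (trans (sym (ℕ.+-suc j (length xs))) eq) f)

    Bounded-last : ∀ j xs → Bounded a j xs
    Bounded-last j []       = _
    Bounded-last j (x ∷ xs) = (λ { [] → z≤n ; (add p q _ _ _ _) → contradiction (ℕ.≤-<-trans p q) (ℕ.<-irrefl refl) }) , Bounded-last (suc j) xs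

    runs-bounded : ∀ {i xs t} → Runs i xs t → i ℕ.≤ a → a ℕ.≤ n → i ℕ.+ length xs ≡ n → From i i xs
    runs-bounded {i} r i≤a a≤n eq with ℕ.m≤n⇒m<n∨m≡n i≤a
    ... | inj₂ refl = base (Bounded-last i _)
    runs-bounded {i} end i≤a a≤n eq | inj₁ i<a =
      contradiction (ℕ.<-≤-trans i<a (ℕ.≤-trans a≤n (ℕ.≤-reflexive (trans (sym eq) (ℕ.+-identityʳ i))))) (ℕ.<-irrefl refl)
    runs-bounded {i} (row {xs = xs} w low r) i≤a a≤n eq | inj₁ i<a = step (backward-from w i<a eq′
      (runs-bounded r i<a a≤n (trans (cong (suc i ℕ.+_) (sweep-length w)) eq′)))
      where eq′ = trans (sym (ℕ.+-suc i (length xs))) eq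

  open Cut

  record Sortable (n i : ℕ) (q : ℕ → ℕ) (xs : List ℕ) : Set where
    field
      size   : i ℕ.+ length xs ≡ n
      counts : ∀ {a} → i ℕ.≤ a → a ℕ.≤ n → cnt a xs ℕ.+ i ≡ a
      splits : ∀ {a} → i ℕ.< a → a ℕ.< n → Split n a i (q a ℕ.+ i) i xs

  sortable⇒runs : ∀ {n k} (q : ℕ → ℕ) → (∀ {a} → 0 ℕ.< a → a ℕ.< n → 0 ℕ.< q a) → (∀ a → q a ℕ.≤ k) →
    (∀ {i j} → i ℕ.< j → j ℕ.≤ k ℕ.+ i → j ℕ.< n → s i j ≡ true) → ∀ m {i} xs → length xs ≡ m → Sortable n i q xs → ∃[ t ] Runs i xs t
  sortable⇒runs q q>0 q≤k short m []       len S = 0 , end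
  sortable⇒runs {n} {k} q q>0 q≤k short (suc m) {i} (κ ∷ xs) len S with out , κ′ , t , w ← sweep i (suc i) κ xs =
    let t′ , r = sortable⇒runs q q>0 q≤k short m out (trans (sweep-length w) (ℕ.suc-injective len)) S′ in
    t ℕ.+ t′ , row (subst (λ z → Sweep i (suc i) κ xs out z t) κ′≡i w) low r
    where
    open Sortable S

    size′ : suc i ℕ.+ length xs ≡ n
    size′ = trans (sym (ℕ.+-suc i (length xs))) size

    i<n : i ℕ.< n
    i<n = ℕ.≤-trans (ℕ.m≤m+n (suc i) (length xs)) (ℕ.≤-reflexive size′)

    none : [ κ′ ℕ.<? i ] ℕ.+ cnt i out ≡ 0
    none = trans (sym (conserve i w)) (ℕ.+-cancelʳ-≡ i (cnt i (κ ∷ xs)) 0 (counts ℕ.≤-refl (ℕ.<⇒≤ i<n)))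

    low : cnt i out ≡ 0
    low = ℕ.m+n≡0⇒n≡0 [ κ′ ℕ.<? i ] none

    splits′ : ∀ {a} → i ℕ.< a → a ℕ.< n → κ′ ℕ.< a × Split n a (suc i) (suc (q a ℕ.+ i)) (suc i) out
    splits′ {a} i<a a<n with splits i<a a<n
    ... | base _ = contradiction i<a (ℕ.<-irrefl refl)
    ... | step _ p p′ sp = forward-split n a w i<a size′
      (λ {j} i<j j≤ → short i<j (ℕ.≤-trans j≤ (ℕ.+-monoˡ-≤ i (q≤k a)))) (ℕ.n<1+n i) sp
      (λ κ<a → s≤s (p κ<a)) (λ h<j → p′ (ℕ.s≤s⁻¹ h<j))
      (λ a≤h → trans (cong (λ z → (z ℕ.+ cnt a xs) ℕ.+ i) (sym ([]-no {d = κ ℕ.<? a} κ≮a))) (counts (ℕ.<⇒≤ i<a) (ℕ.<⇒≤ a<n)))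
      where
      κ≮a : ¬ (κ ℕ.< a)
      κ≮a κ<a = ℕ.<⇒≱ (ℕ.+-monoˡ-< i (q>0 (ℕ.≤-<-trans z≤n i<a) a<n)) (p κ<a)

    κ′≤i : κ′ ℕ.< suc i
    κ′≤i with ℕ.m≤n⇒m<n∨m≡n i<n
    ... | inj₁ 1+i<n = proj₁ (splits′ (ℕ.n<1+n i) 1+i<n)
    ... | inj₂ refl  = last xs w (ℕ.+-cancelˡ-≡ (suc i) (length xs) 0 (trans size′ (sym (ℕ.+-identityʳ (suc i))))) (counts (ℕ.n≤1+n i) ℕ.≤-refl)
      where
      last : ∀ xs {out t} → Sweep i (suc i) κ xs out κ′ t → length xs ≡ 0 → cnt (suc i) (κ ∷ xs) ℕ.+ i ≡ suc i → κ′ ℕ.< suc i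
      last [] done _ c with κ ℕ.<? suc i
      ... | yes p = p
      ... | no ¬p = contradiction (trans (sym c) (cong (λ z → (z ℕ.+ 0) ℕ.+ i) ([]-no {d = κ ℕ.<? suc i} ¬p))) ℕ.1+n≢n

    κ′≡i : κ′ ≡ i
    κ′≡i = ℕ.≤-antisym (ℕ.s≤s⁻¹ κ′≤i) (ℕ.≮⇒≥ λ κ′<i →
      contradiction (trans (cong (ℕ._+ cnt i out) (sym ([]-yes {d = κ′ ℕ.<? i} κ′<i))) none) λ ())

    S′ : Sortable n (suc i) q out
    S′ = record
      { size   = trans (cong (suc i ℕ.+_) (sweep-length w)) size′
      ; counts = λ {a} i<a a≤n → trans (ℕ.+-suc _ i) (trans (cong (ℕ._+ i) (trans (cong (ℕ._+ cnt a out) (sym ([]-yes {d = κ′ ℕ.<? a} (subst (ℕ._< a) (sym κ′≡i) i<a))))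
                   (sym (conserve a w)))) (counts (ℕ.<⇒≤ i<a) a≤n))
      ; splits = λ {a} i<a a<n → subst (λ h → Split n a (suc i) h (suc i) out) (sym (ℕ.+-suc (q a) i)) (proj₂ (splits′ (ℕ.<-trans (ℕ.n<1+n i) i<a) a<n))
      }

-- The initial word of the network

letter : ℕ → ℕ → ℕ → ℕ
letter n k c = if does ((c ℕ.<? k) ⊎-dec (n ℕ.∸ k ℕ.≤? c)) then n ℕ.∸ suc c else c

word : ℕ → ℕ → ℕ → ℕ → List ℕ
word n k c zero    = []
word n k c (suc m) = letter n k c ∷ word n k (suc c) m

letter-cases : ∀ n k c → (c ℕ.< k × letter n k c ≡ n ℕ.∸ suc c) ⊎ (n ℕ.∸ k ℕ.≤ c × letter n k c ≡ n ℕ.∸ suc c) ⊎ (k ℕ.≤ c × c ℕ.< n ℕ.∸ k × letter n k c ≡ c)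
letter-cases n k c = go (c ℕ.<? k) (n ℕ.∸ k ℕ.≤? c)
  where
  go : (d : Dec (c ℕ.< k)) (d′ : Dec (n ℕ.∸ k ℕ.≤ c)) → let l = if does (d ⊎-dec d′) then n ℕ.∸ suc c else c in
    (c ℕ.< k × l ≡ n ℕ.∸ suc c) ⊎ (n ℕ.∸ k ℕ.≤ c × l ≡ n ℕ.∸ suc c) ⊎ (k ℕ.≤ c × c ℕ.< n ℕ.∸ k × l ≡ c)
  go (yes p) _       = inj₁ (p , refl)
  go (no ¬p) (yes q) = inj₂ (inj₁ (q , refl))
  go (no ¬p) (no ¬q) = inj₂ (inj₂ (ℕ.≮⇒≥ ¬p , ℕ.≰⇒> ¬q , refl))

word-length : ∀ n k c m → length (word n k c m) ≡ m
word-length n k c zero    = refl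
word-length n k c (suc m) = cong suc (word-length n k (suc c) m)

module Word (n k : ℕ) (0<k : 0 ℕ.< k) (2k≤n : k ℕ.+ k ℕ.≤ n) where

  quota : ℕ → ℕ
  quota a = (k ℕ.⊓ a) ℕ.⊓ (n ℕ.∸ a)

  k≤n∸k : k ℕ.≤ n ℕ.∸ k
  k≤n∸k = ℕ.m+n≤o⇒m≤o∸n k 2k≤n

  k≤n : k ℕ.≤ n
  k≤n = ℕ.≤-trans (ℕ.m≤m+n k k) 2k≤n

  late : ∀ {a c m} → c ℕ.+ suc m ≡ n → a ℕ.≤ c → letter n k c ℕ.< a → suc m ℕ.≤ k ℕ.⊓ a
  late {a} {c} {m} eq a≤c lt with letter-cases n k c
  ... | inj₁ (c<k , l) = ℕ.⊓-glb (ℕ.≤-trans m<a (ℕ.≤-trans a≤c (ℕ.<⇒≤ c<k))) m<a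
    where
    m<a : m ℕ.< a
    m<a = subst (ℕ._< a) (trans l (trans (cong (ℕ._∸ suc c) (trans (sym eq) (ℕ.+-suc c m))) (ℕ.m+n∸m≡n (suc c) m))) lt
  ... | inj₂ (inj₁ (n∸k≤c , l)) = ℕ.⊓-glb (ℕ.+-cancelˡ-≤ c (suc m) k (ℕ.≤-trans (ℕ.≤-reflexive eq) (ℕ.≤-trans (ℕ.m≤n+m∸n n k) (ℕ.≤-trans (ℕ.≤-reflexive (ℕ.+-comm k _)) (ℕ.+-monoˡ-≤ k n∸k≤c)))))
    (subst (ℕ._< a) (trans l (trans (cong (ℕ._∸ suc c) (trans (sym eq) (ℕ.+-suc c m))) (ℕ.m+n∸m≡n (suc c) m))) lt)
  ... | inj₂ (inj₂ (_ , _ , l)) = contradiction (ℕ.<-≤-trans (subst (ℕ._< a) l lt) a≤c) (ℕ.<-irrefl refl)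

  late⁻ : ∀ {a c m} → c ℕ.+ suc m ≡ n → suc m ℕ.≤ k ℕ.⊓ a → letter n k c ℕ.< a
  late⁻ {a} {c} {m} eq le with letter-cases n k c
  ... | inj₁ (_ , l)        = subst (ℕ._< a) (sym (trans l (trans (cong (ℕ._∸ suc c) (trans (sym eq) (ℕ.+-suc c m))) (ℕ.m+n∸m≡n (suc c) m)))) (ℕ.≤-trans le (ℕ.m⊓n≤n k a))
  ... | inj₂ (inj₁ (_ , l)) = subst (ℕ._< a) (sym (trans l (trans (cong (ℕ._∸ suc c) (trans (sym eq) (ℕ.+-suc c m))) (ℕ.m+n∸m≡n (suc c) m)))) (ℕ.≤-trans le (ℕ.m⊓n≤n k a))
  ... | inj₂ (inj₂ (_ , c<n∸k , _)) = contradiction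
    (ℕ.≤-trans (ℕ.+-monoʳ-< c (ℕ.≤-trans le (ℕ.m⊓n≤m k a))) (ℕ.≤-trans (ℕ.+-monoˡ-≤ k (ℕ.<⇒≤ c<n∸k)) (ℕ.≤-reflexive (ℕ.m∸n+n≡m k≤n))))
    (λ lt → ℕ.<-irrefl refl (ℕ.<-≤-trans (ℕ.+-monoˡ-< k c<n∸k) (ℕ.≤-trans (ℕ.≤-reflexive (trans (ℕ.m∸n+n≡m k≤n) (sym eq))) (ℕ.+-monoʳ-≤ c (ℕ.≤-trans le (ℕ.m⊓n≤m k a))))))

  cnt-word : ∀ a m {c} → c ℕ.+ m ≡ n → a ℕ.≤ c → cnt a (word n k c m) ≡ (k ℕ.⊓ a) ℕ.⊓ m
  cnt-word a zero    eq a≤c = sym (ℕ.⊓-zeroʳ (k ℕ.⊓ a))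
  cnt-word a (suc m) {c} eq a≤c with suc m ℕ.≤? k ℕ.⊓ a
  ... | yes le = trans (cong₂ ℕ._+_ ([]-yes {d = letter n k c ℕ.<? a} (late⁻ eq le)) (cnt-word a m (trans (sym (ℕ.+-suc c m)) eq) (ℕ.m≤n⇒m≤1+n a≤c)))
    (trans (cong suc (ℕ.m≥n⇒m⊓n≡n (ℕ.<⇒≤ le))) (sym (ℕ.m≥n⇒m⊓n≡n le)))
  ... | no ¬le = trans (cong₂ ℕ._+_ ([]-no {d = letter n k c ℕ.<? a} (¬le ∘ late eq a≤c)) (cnt-word a m (trans (sym (ℕ.+-suc c m)) eq) (ℕ.m≤n⇒m≤1+n a≤c)))
    (trans (ℕ.m≤n⇒m⊓n≡m (ℕ.s≤s⁻¹ (ℕ.≰⇒> ¬le))) (sym (ℕ.m≤n⇒m⊓n≡m (ℕ.≤-trans (ℕ.n≤1+n _) (ℕ.≰⇒> ¬le)))))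

  quota≤k : ∀ a → quota a ℕ.≤ k
  quota≤k a = ℕ.≤-trans (ℕ.m⊓n≤m (k ℕ.⊓ a) _) (ℕ.m⊓n≤m k a)

  early : ∀ {a c} → c ℕ.< a → a ℕ.≤ n → letter n k c ℕ.< a → quota a ℕ.≤ c
  early {a} {c} c<a a≤n lt with letter-cases n k c
  ... | inj₁ (c<k , l) = ℕ.≤-trans (ℕ.m⊓n≤n (k ℕ.⊓ a) _) (ℕ.m≤n+o⇒m∸n≤o n a (ℕ.≤-trans (ℕ.m≤n+m∸n n (suc c))
    (ℕ.≤-trans (ℕ.≤-reflexive (sym (ℕ.+-suc c _))) (ℕ.≤-trans (ℕ.+-monoʳ-≤ c (subst (ℕ._< a) l lt)) (ℕ.≤-reflexive (ℕ.+-comm c a))))))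
  ... | inj₂ (inj₁ (n∸k≤c , _)) = ℕ.≤-trans (quota≤k a) (ℕ.≤-trans k≤n∸k n∸k≤c)
  ... | inj₂ (inj₂ (k≤c , _))   = ℕ.≤-trans (quota≤k a) k≤c

  early⁻ : ∀ {a c} → c ℕ.< a → a ℕ.≤ n → quota a ℕ.≤ c → letter n k c ℕ.< a
  early⁻ {a} {c} c<a a≤n le with letter-cases n k c
  ... | inj₂ (inj₂ (_ , _ , l)) = subst (ℕ._< a) (sym l) c<a
  ... | inj₂ (inj₁ (n∸k≤c , l)) = subst (ℕ._< a) (sym l) (ℕ.≤-<-trans (ℕ.m≤n+o⇒m∸n≤o n (suc c)
    (ℕ.≤-trans (ℕ.m≤n+m∸n n k) (ℕ.≤-trans (ℕ.+-monoʳ-≤ k n∸k≤c) (ℕ.≤-trans (ℕ.≤-reflexive (ℕ.+-comm k c)) (ℕ.n≤1+n _)))))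
    (ℕ.≤-<-trans (ℕ.≤-trans k≤n∸k n∸k≤c) c<a))
  ... | inj₁ (c<k , l) = subst (ℕ._< a) (sym l) (ℕ.≤-trans (ℕ.≤-reflexive (sym (ℕ.+-∸-assoc 1 c<n)))
    (ℕ.m≤n+o⇒m∸n≤o n c (ℕ.≤-trans (ℕ.m≤n+m∸n n a) (ℕ.≤-trans (ℕ.+-monoʳ-≤ a n∸a≤c) (ℕ.≤-reflexive (ℕ.+-comm a c))))))
    where
    c<n = ℕ.<-≤-trans c<a a≤n
    n∸a≤c : n ℕ.∸ a ℕ.≤ c
    n∸a≤c with n ℕ.∸ a ℕ.≤? c
    ... | yes p = p
    ... | no ¬p = contradiction le (ℕ.<⇒≱ (ℕ.⊓-glb (ℕ.⊓-glb c<k c<a) (ℕ.≰⇒> ¬p)))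

  cnt-total : ∀ {a} → a ℕ.≤ n → ∀ d {c m} → d ℕ.+ c ≡ a → c ℕ.+ m ≡ n → cnt a (word n k c m) ℕ.+ (c ℕ.⊔ quota a) ≡ a ℕ.+ quota a
  cnt-total {a} a≤n zero {m = m} refl eq =
    trans (cong₂ ℕ._+_ (trans (cnt-word a m eq ℕ.≤-refl) (cong ((k ℕ.⊓ a) ℕ.⊓_) (trans (sym (ℕ.m+n∸m≡n a m)) (cong (ℕ._∸ a) eq))))
      (ℕ.m≥n⇒m⊔n≡m (ℕ.≤-trans (ℕ.m⊓n≤m (k ℕ.⊓ a) _) (ℕ.m⊓n≤n k a)))) (ℕ.+-comm (quota a) a)
  cnt-total {a} a≤n (suc d) {c} {zero}  eq₁ eq₂ = contradiction (ℕ.≤-trans (s≤s (ℕ.m≤n+m c d)) (ℕ.≤-trans (ℕ.≤-reflexive eq₁) (ℕ.≤-trans a≤n (ℕ.≤-reflexive (trans (sym eq₂) (ℕ.+-identityʳ c)))))) (ℕ.<-irrefl refl)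
  cnt-total {a} a≤n (suc d) {c} {suc m} eq₁ eq₂ with quota a ℕ.≤? c
  ... | yes le = trans (cong₂ (λ x y → (x ℕ.+ cnt a (word n k (suc c) m)) ℕ.+ y) ([]-yes {d = letter n k c ℕ.<? a} (early⁻ c<a a≤n le)) (ℕ.m≥n⇒m⊔n≡m le))
    (trans (sym (ℕ.+-suc (cnt a (word n k (suc c) m)) c)) (trans (cong (cnt a (word n k (suc c) m) ℕ.+_) (sym (ℕ.m≥n⇒m⊔n≡m (ℕ.m≤n⇒m≤1+n le))))
      (cnt-total a≤n d (trans (ℕ.+-suc d c) eq₁) (trans (sym (ℕ.+-suc c m)) eq₂))))
    where c<a = ℕ.≤-trans (s≤s (ℕ.m≤n+m c d)) (ℕ.≤-reflexive eq₁)
  ... | no ¬le = trans (cong₂ (λ x y → (x ℕ.+ cnt a (word n k (suc c) m)) ℕ.+ y) ([]-no {d = letter n k c ℕ.<? a} (¬le ∘ early c<a a≤n)) (ℕ.m≤n⇒m⊔n≡n (ℕ.<⇒≤ (ℕ.≰⇒> ¬le))))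
    (trans (cong (cnt a (word n k (suc c) m) ℕ.+_) (sym (ℕ.m≤n⇒m⊔n≡n (ℕ.≰⇒> ¬le))))
      (cnt-total a≤n d (trans (ℕ.+-suc d c) eq₁) (trans (sym (ℕ.+-suc c m)) eq₂)))
    where c<a = ℕ.≤-trans (s≤s (ℕ.m≤n+m c d)) (ℕ.≤-reflexive eq₁)

  module _ (s : ℕ → ℕ → Bool) where
    open Network s
    open Cut n

    free⇒runs : (∀ {a r} → Chain a 0 a r → r ℕ.≤ k) → (∀ {i j} → i ℕ.< j → j ℕ.≤ k ℕ.+ i → j ℕ.< n → s i j ≡ true) → ∃[ t ] Runs 0 (word n k 0 n) t
    free⇒runs free short = sortable⇒runs quota
      (λ 0<a a<n → ℕ.⊓-glb (ℕ.⊓-glb 0<k 0<a) (ℕ.m<n⇒0<n∸m a<n)) quota≤k short n (word n k 0 n) (word-length n k 0 n)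
      record
        { size   = word-length n k 0 n
        ; counts = λ {a} _ a≤n → trans (ℕ.+-identityʳ _) (ℕ.+-cancelʳ-≡ (quota a) _ a (cnt-total a≤n a (ℕ.+-identityʳ a) refl))
        ; splits = λ {a} 0<a a<n → subst (λ h → Split a 0 h 0 (word n k 0 n)) (sym (ℕ.+-identityʳ (quota a))) (splits (ℕ.<⇒≤ a<n) a (ℕ.+-identityʳ a) refl)
        }
      where
      bounded : ∀ a m {c} → c ℕ.+ m ≡ n → a ℕ.≤ c → Bounded a 0 c (word n k c m)
      bounded a zero    eq a≤c = _
      bounded a (suc m) {c} eq a≤c =
        (λ {r} ch → ℕ.≤-trans (ℕ.⊓-glb (ℕ.⊓-glb (free {a} (weaken a z≤n a≤c ch)) (ℕ.≤-trans (ℕ.m≤m+n r 0) (chain-rows a z≤n ch)))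
            (ℕ.+-cancelʳ-≤ c r (suc m) (ℕ.≤-trans (chain-columns a (ℕ.≤-trans (ℕ.m≤m+n c _) (ℕ.≤-reflexive eq)) ch) (ℕ.≤-reflexive (trans (sym eq) (ℕ.+-comm c _))))))
          (ℕ.≤-reflexive (sym (cnt-word a (suc m) eq a≤c)))) ,
        bounded a m (trans (sym (ℕ.+-suc c m)) eq) (ℕ.m≤n⇒m≤1+n a≤c)

      splits : ∀ {a} → a ℕ.≤ n → ∀ d {c m} → d ℕ.+ c ≡ a → c ℕ.+ m ≡ n → Split a 0 (quota a) c (word n k c m)
      splits {a} a≤n zero {m = m} refl eq = base (bounded a m eq ℕ.≤-refl)
      splits {a} a≤n (suc d) {c} {zero}  eq₁ eq₂ = contradiction (ℕ.≤-trans (s≤s (ℕ.m≤n+m c d)) (ℕ.≤-trans (ℕ.≤-reflexive eq₁) (ℕ.≤-trans a≤n (ℕ.≤-reflexive (trans (sym eq₂) (ℕ.+-identityʳ c)))))) (ℕ.<-irrefl refl)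
      splits {a} a≤n (suc d) {c} {suc m} eq₁ eq₂ = step c<a (early c<a a≤n) (early⁻ c<a a≤n) (splits a≤n d (trans (ℕ.+-suc d c) eq₁) (trans (sym (ℕ.+-suc c m)) eq₂))
        where c<a = ℕ.≤-trans (s≤s (ℕ.m≤n+m c d)) (ℕ.≤-reflexive eq₁)

    runs⇒free : ∀ {t} → Runs 0 (word n k 0 n) t → ∀ {a} → a ℕ.≤ n → ∀ {r} → Chain a 0 a r → r ℕ.≤ k
    runs⇒free runs {a} a≤n c = go a (ℕ.+-identityʳ a) refl (runs-bounded a runs z≤n a≤n (word-length n k 0 n)) refl c
      where
      go : ∀ d {c m xs} → d ℕ.+ c ≡ a → c ℕ.+ m ≡ n → From a 0 c xs → xs ≡ word n k c m → ∀ {r} → Chain a 0 a r → r ℕ.≤ k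
      go d {m = m} eq₁ eq₂ (base bd) refl c = ℕ.≤-trans (bound a _ (trans (cong (a ℕ.+_) (word-length n k a m)) eq₂) bd c)
        (ℕ.≤-trans (ℕ.≤-reflexive (cnt-word a m eq₂ ℕ.≤-refl)) (ℕ.≤-trans (ℕ.m⊓n≤m (k ℕ.⊓ a) m) (ℕ.m⊓n≤m k a)))
      go zero    {m = suc m} refl eq₂ (step f) refl c = contradiction (From-≤ a f) (ℕ.<-irrefl refl)
      go (suc d) {c₀} {suc m} eq₁ eq₂ (step f) refl c = go d (trans (ℕ.+-suc d c₀) eq₁) (trans (sym (ℕ.+-suc c₀ m)) eq₂) f refl c

outside : (ℕ → ℕ → Bool) → ℕ → ℕ → ℕ
outside s i j = if s i j then 0 else 1

sumFrom : ℕ → ℕ → (ℕ → ℕ) → ℕ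
sumFrom j zero    f = 0
sumFrom j (suc m) f = f j ℕ.+ sumFrom (suc j) m f

triangle : ℕ → ℕ → (ℕ → ℕ → ℕ) → ℕ
triangle i zero    h = 0
triangle i (suc m) h = sumFrom (suc i) m (h i) ℕ.+ triangle (suc i) m h

record Extends (s s′ : ℕ → ℕ → Bool) (i₀ j₀ : ℕ) : Set where
  field
    old : ∀ {i j} → s i j ≡ true → s′ i j ≡ true
    new : ∀ {i j} → s′ i j ≡ true → s i j ≡ true ⊎ (i ≡ i₀ × j ≡ j₀)

  still : ∀ {i j} → s i j ≡ false → ¬ (i ≡ i₀ × j ≡ j₀) → s′ i j ≡ false
  still {i} {j} out ≢ with s′ i j in eq
  ... | false = refl
  ... | true with new eq
  ...   | inj₁ p = contradiction (trans (sym p) out) λ ()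
  ...   | inj₂ p = contradiction p ≢

module _ {s : ℕ → ℕ → Bool} where
  open Network

  sweep-lift : ∀ {s′ i₀ j₀ i j κ xs out κ′ t} → Extends s s′ i₀ j₀ → i ≢ i₀ ⊎ j₀ ℕ.< j → Sweep s i j κ xs out κ′ t → Sweep s′ i j κ xs out κ′ t
  sweep-lift e p done = done
  sweep-lift e p (stay q w)   = stay (Sum.map₁ (Extends.old e) q) (sweep-lift e (Sum.map₂ (λ lt → ℕ.<-trans lt (ℕ.n<1+n _)) p) w)
  sweep-lift e p (swap q r w) = swap (Extends.still e q λ { (i≡ , j≡) → Sum.[ (λ i≢ → i≢ i≡) , (λ lt → ℕ.<-irrefl (sym j≡) lt) ]′ p }) r
    (sweep-lift e (Sum.map₂ (λ lt → ℕ.<-trans lt (ℕ.n<1+n _)) p) w)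

  runs-lift : ∀ {s′ i₀ j₀ i xs t} → Extends s s′ i₀ j₀ → i₀ ℕ.< i → Runs s i xs t → Runs s′ i xs t
  runs-lift e lt end = end
  runs-lift e lt (row w low r) = row (sweep-lift e (inj₁ (λ i≡ → ℕ.<-irrefl (sym i≡) lt)) w) low (runs-lift e (ℕ.<-trans lt (ℕ.n<1+n _)) r)

  sweep-exchanges : ∀ {i j κ xs out κ′ t} → Sweep s i j κ xs out κ′ t → t ℕ.≤ sumFrom j (length xs) (outside s i)
  sweep-exchanges done = z≤n
  sweep-exchanges (stay _ w) = ℕ.≤-trans (sweep-exchanges w) (ℕ.m≤n+m _ _)
  sweep-exchanges {i} {j} {xs = _ ∷ xs} {t = suc t} (swap q _ w) =
    subst (λ b → suc t ℕ.≤ (if b then 0 else 1) ℕ.+ sumFrom (suc j) (length xs) (outside s i)) (sym q) (s≤s (sweep-exchanges w))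

  runs-exchanges : ∀ {i xs t} → Runs s i xs t → t ℕ.≤ triangle i (length xs) (outside s)
  runs-exchanges end = z≤n
  runs-exchanges {i} (row {out = out} w _ r) = ℕ.+-mono-≤ (sweep-exchanges w)
    (subst (λ m → _ ℕ.≤ triangle (suc i) m (outside s)) (sweep-length s w) (runs-exchanges r))

  sweep-tight : ∀ {i j κ xs out κ′ t} → Sweep s i j κ xs out κ′ t → t ≡ sumFrom j (length xs) (outside s i)
    ⊎ ∃[ j₀ ] j ℕ.≤ j₀ × j₀ ℕ.< j ℕ.+ length xs × s i j₀ ≡ false × (∀ {s′} → Extends s s′ i j₀ → Sweep s′ i j κ xs out κ′ t)
  sweep-tight done = inj₁ refl
  sweep-tight {i} {j} {xs = _ ∷ xs} (stay q w) with s i j in sij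
  ... | false = inj₂ (j , ℕ.≤-refl , ℕ.m<m+n j (s≤s z≤n) , sij ,
    λ e → stay (Sum.[ (λ ()) , inj₂ ]′ q) (sweep-lift e (inj₂ (ℕ.n<1+n j)) w))
  ... | true with sweep-tight w
  ...   | inj₁ eq = inj₁ eq
  ...   | inj₂ (j₀ , p , p′ , o , l) = inj₂ (j₀ , ℕ.≤-trans (ℕ.n≤1+n j) p , ℕ.≤-trans p′ (ℕ.≤-reflexive (sym (ℕ.+-suc j _))) , o ,
    λ e → stay (inj₁ (Extends.old e sij)) (l e))
  sweep-tight {i} {j} {xs = _ ∷ xs} (swap q κ<x w) with sweep-tight w
  ... | inj₁ eq = inj₁ (trans (cong suc eq) (cong (λ b → (if b then 0 else 1) ℕ.+ sumFrom (suc j) (length xs) (outside s i)) (sym q)))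
  ... | inj₂ (j₀ , p , p′ , o , l) = inj₂ (j₀ , ℕ.≤-trans (ℕ.n≤1+n j) p , ℕ.≤-trans p′ (ℕ.≤-reflexive (sym (ℕ.+-suc j _))) , o ,
    λ e → swap (Extends.still e q λ { (_ , refl) → ℕ.<-irrefl refl p }) κ<x (l e))

  runs-tight : ∀ {i xs t} → Runs s i xs t → t ≡ triangle i (length xs) (outside s)
    ⊎ ∃[ i₀ ] ∃[ j₀ ] i ℕ.≤ i₀ × i₀ ℕ.< j₀ × j₀ ℕ.< i ℕ.+ length xs × s i₀ j₀ ≡ false × (∀ {s′} → Extends s s′ i₀ j₀ → Runs s′ i xs t)
  runs-tight end = inj₁ refl
  runs-tight {i} (row {κ = κ} {xs} {out} w low r) with sweep-tight w
  ... | inj₂ (j₀ , p , p′ , o , l) = inj₂ (i , j₀ , ℕ.≤-refl , p , ℕ.≤-trans p′ (ℕ.≤-reflexive (sym (ℕ.+-suc i _))) , o ,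
    λ e → row (l e) low (runs-lift e (ℕ.n<1+n i) r))
  ... | inj₁ eq with runs-tight r
  ...   | inj₁ eq′ = inj₁ (cong₂ ℕ._+_ eq (trans eq′ (cong (λ m → triangle (suc i) m (outside s)) (sweep-length s w))))
  ...   | inj₂ (i₀ , j₀ , p , p′ , q , o , l) = inj₂ (i₀ , j₀ , ℕ.≤-trans (ℕ.n≤1+n i) p , p′ ,
    ℕ.≤-trans q (ℕ.≤-reflexive (trans (cong (suc i ℕ.+_) (sweep-length s w)) (sym (ℕ.+-suc i _)))) , o ,
    λ e → row (sweep-lift e (inj₁ (λ i≡ → ℕ.<-irrefl i≡ p)) w) low (l e))

module _ {a b} {A : Set a} {B : Set b} where

  fold-mapMaybe : ∀ (f : A → Maybe B) (g : B → ℕ) xs → ℕ-Sum.fold g (mapMaybe f xs) ≡ ℕ-Sum.fold (Maybe.maybe g 0 ∘ f) xs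
  fold-mapMaybe f g [] = refl
  fold-mapMaybe f g (x ∷ xs) with f x
  ... | just y  = cong (g y ℕ.+_) (fold-mapMaybe f g xs)
  ... | nothing = fold-mapMaybe f g xs

  fold-cartesianProduct : ∀ (g : A × B → ℕ) xs ys → ℕ-Sum.fold g (cartesianProduct xs ys) ≡ ℕ-Sum.fold (λ x → ℕ-Sum.fold (λ y → g (x , y)) ys) xs
  fold-cartesianProduct g []       ys = refl
  fold-cartesianProduct g (x ∷ xs) ys = trans (ℕ-Sum.fold-++ g (map (x ,_) ys) (cartesianProduct xs ys))
    (cong₂ ℕ._+_ (ℕ-Sum.fold-map g (x ,_) ys) (fold-cartesianProduct g xs ys))

fold-tabulate : ∀ {a n} {A : Set a} (f : Fin n → A) (g : A → ℕ) → ℕ-Sum.fold g (Data.List.Base.tabulate f) ≡ ∑ᶠ (g ∘ f)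
fold-tabulate {n = zero}  f g = refl
fold-tabulate {n = suc n} f g = cong (g (f zero) ℕ.+_) (fold-tabulate (f ∘ suc) g)

∑ᶠ-sumFrom : ∀ m j f → ∑ᶠ {m} (λ v → f (j ℕ.+ toℕ v)) ≡ sumFrom j m f
∑ᶠ-sumFrom zero    j f = refl
∑ᶠ-sumFrom (suc m) j f = cong₂ ℕ._+_ (cong f (ℕ.+-identityʳ j))
  (trans (∑ᶠ-cong {m} (λ v → cong f (ℕ.+-suc j (toℕ v)))) (∑ᶠ-sumFrom m (suc j) f))

fold-allFin : ∀ n (f : ℕ → ℕ) → ℕ-Sum.fold (λ v → f (toℕ v)) (allFin n) ≡ sumFrom 0 n f
fold-allFin n f = trans (fold-tabulate {n = n} id (λ v → f (toℕ v))) (∑ᶠ-sumFrom n 0 f)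

sumFrom-0 : ∀ m j f → (∀ d → d ℕ.< j ℕ.+ m → f d ≡ 0) → sumFrom j m f ≡ 0
sumFrom-0 zero    j f z = refl
sumFrom-0 (suc m) j f z = cong₂ ℕ._+_ (z j (ℕ.m<m+n j (s≤s z≤n))) (sumFrom-0 m (suc j) f (λ d lt → z d (ℕ.≤-trans lt (ℕ.≤-reflexive (sym (ℕ.+-suc j m))))))

sumFrom-cong : ∀ m j {f g} → (∀ d → j ℕ.≤ d → f d ≡ g d) → sumFrom j m f ≡ sumFrom j m g
sumFrom-cong zero    j eq = refl
sumFrom-cong (suc m) j eq = cong₂ ℕ._+_ (eq j ℕ.≤-refl) (sumFrom-cong m (suc j) (λ d le → eq d (ℕ.≤-trans (ℕ.n≤1+n j) le)))

sumFrom-+ : ∀ m m′ j f → sumFrom j (m ℕ.+ m′) f ≡ sumFrom j m f ℕ.+ sumFrom (j ℕ.+ m) m′ f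
sumFrom-+ zero    m′ j f = cong (λ z → sumFrom z m′ f) (sym (ℕ.+-identityʳ j))
sumFrom-+ (suc m) m′ j f = trans (cong (f j ℕ.+_) (trans (sumFrom-+ m m′ (suc j) f) (cong (λ z → sumFrom (suc j) m f ℕ.+ sumFrom z m′ f) (sym (ℕ.+-suc j m)))))
  (sym (ℕ.+-assoc (f j) _ _))

triangle-sum : ∀ n (h : ℕ → ℕ → ℕ) m i → i ℕ.+ m ≡ n → sumFrom i m (λ i → sumFrom 0 n (λ j → if does (i ℕ.<? j) then h i j else 0)) ≡ triangle i m h
triangle-sum n h zero    i eq = refl
triangle-sum n h (suc m) i eq = cong₂ ℕ._+_
  (trans (cong (λ z → sumFrom 0 z f) (sym eq′)) (trans (sumFrom-+ (suc i) m 0 f) (cong₂ ℕ._+_ (sumFrom-0 (suc i) 0 f off) (sumFrom-cong m (suc i) on))))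
  (triangle-sum n h m (suc i) eq′)
  where
  eq′ = trans (sym (ℕ.+-suc i m)) eq
  f : ℕ → ℕ
  f j = if does (i ℕ.<? j) then h i j else 0
  off : ∀ d → d ℕ.< suc i → f d ≡ 0
  off d lt = cong (λ b → if b then h i d else 0) (dec-false (i ℕ.<? d) (ℕ.≤⇒≯ (ℕ.s≤s⁻¹ lt)))
  on : ∀ d → suc i ℕ.≤ d → f d ≡ h i d
  on d le = cong (λ b → if b then h i d else 0) (dec-true (i ℕ.<? d) le)

-- Sets of edges as sets of pairs of numbers

module _ {n : ℕ} where

  mkEdge : ∀ {i j} → i ℕ.< j → j ℕ.< n → Edge n
  mkEdge i<j j<n = edge (Fin.fromℕ< (ℕ.<-trans i<j j<n)) (Fin.fromℕ< j<n)
    (ℕ.≤-trans (ℕ.≤-reflexive (cong suc (Fin.toℕ-fromℕ< _))) (ℕ.≤-trans i<j (ℕ.≤-reflexive (sym (Fin.toℕ-fromℕ< j<n)))))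

  pair : (Edge n → Bool) → ℕ → ℕ → Bool
  pair σ i j with i ℕ.<? j | j ℕ.<? n
  ... | yes i<j | yes j<n = σ (mkEdge i<j j<n)
  ... | yes _   | no _    = false
  ... | no _    | _       = false

  pair-edge : ∀ σ e → pair σ (toℕ (lo e)) (toℕ (hi e)) ≡ σ e
  pair-edge σ e with toℕ (lo e) ℕ.<? toℕ (hi e) | toℕ (hi e) ℕ.<? n
  ... | yes p | yes q = cong σ (edge-≡ (Fin.fromℕ<-toℕ (lo e) _) (Fin.fromℕ<-toℕ (hi e) _))
  ... | yes _ | no ¬q = contradiction (Fin.toℕ<n (hi e)) ¬q
  ... | no ¬p | _     = contradiction (lo<hi e) ¬p

  pair-true : ∀ σ {i j} → pair σ i j ≡ true → ∃[ e ] toℕ (lo e) ≡ i × toℕ (hi e) ≡ j × σ e ≡ true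
  pair-true σ {i} {j} eq with i ℕ.<? j | j ℕ.<? n
  ... | yes p | yes q = mkEdge p q , Fin.toℕ-fromℕ< _ , Fin.toℕ-fromℕ< q , eq
  pair-true σ () | yes _ | no _
  pair-true σ () | no _  | _

  pair-mkEdge : ∀ σ {i j} (p : i ℕ.< j) (q : j ℕ.< n) → pair σ i j ≡ σ (mkEdge p q)
  pair-mkEdge σ p q = trans (cong₂ (pair σ) (sym (Fin.toℕ-fromℕ< (ℕ.<-trans p q))) (sym (Fin.toℕ-fromℕ< q))) (pair-edge σ (mkEdge p q))

  pair-mono : ∀ {σ τ : Edge n → Bool} → (∀ e → σ e ≡ true → τ e ≡ true) → ∀ {i j} → pair σ i j ≡ true → pair τ i j ≡ true
  pair-mono {σ} {τ} imp {i} {j} eq with e , refl , refl , p ← pair-true σ {i} {j} eq = trans (pair-edge τ e) (imp e p)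

  missing : (Edge n → Bool) → ℕ
  missing σ = ℕ-Sum.fold (λ e → if σ e then 0 else 1) (allEdges n)

  missing-triangle : ∀ σ → missing σ ≡ triangle 0 n (outside (pair σ))
  missing-triangle σ = trans (fold-mapMaybe _ _ (cartesianProduct (allFin n) (allFin n)))
    (trans (fold-cartesianProduct _ (allFin n) (allFin n)) (trans (ℕ-Sum.fold-cong (allFin n) line)
    (trans (fold-allFin n (λ i → sumFrom 0 n (h i))) (triangle-sum n (outside (pair σ)) n 0 refl))))
    where
    h : ℕ → ℕ → ℕ
    h i j = if does (i ℕ.<? j) then outside (pair σ) i j else 0
    cell′ : ∀ (i j : Fin n) (d : Dec (i Fin.< j)) → Maybe.maybe (λ e → if σ e then 0 else 1) 0 (Maybe.map (edge i j) (dec⇒maybe d))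
      ≡ (if does d then outside (pair σ) (toℕ i) (toℕ j) else 0)
    cell′ i j (yes p) = cong (λ b → if b then 0 else 1) (sym (pair-edge σ (edge i j p)))
    cell′ i j (no _)  = refl
    line : ∀ (i : Fin n) → _ ≡ sumFrom 0 n (h (toℕ i))
    line i = trans (ℕ-Sum.fold-cong (allFin n) (λ j → cell′ i j (i Fin.<? j))) (fold-allFin n (h (toℕ i)))

  _≺_ : Edge n → Edge n → Set
  e ≺ f = lo e Fin.< lo f × lo f Fin.< hi e × hi e Fin.< hi f

  insert : ∀ (P : Pred (Edge n) 0ℓ) e E → All (Cross e) E → AllPairs _≺_ E → P e → All P E →
    ∃[ E′ ] length E′ ≡ suc (length E) × AllPairs _≺_ E′ × All P E′
  insert P e []      []         []         Pe []         = e ∷ [] , refl , [] ∷ [] , Pe ∷ []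
  insert P e (f ∷ E) (inj₁ e≺f ∷ cs) (f≺ ∷ s) Pe (Pf ∷ PE) = e ∷ f ∷ E , refl , (e≺f ∷ All.zipWith (λ {g} → later {g}) (cs , f≺)) ∷ f≺ ∷ s , Pe ∷ Pf ∷ PE
    where
    later : ∀ {g} → Cross e g × f ≺ g → e ≺ g
    later (inj₁ e≺g , _)                 = e≺g
    later (inj₂ (g<e , _) , (f<g , _)) = contradiction (Fin.<-trans g<e (proj₁ e≺f)) (Fin.<-asym f<g)
  insert P e (f ∷ E) (inj₂ f≺e ∷ cs) (f≺ ∷ s) Pe (Pf ∷ PE)
    with E′ , len , s′ , PE′ ← insert (λ g → P g × f ≺ g) e E cs s (Pe , f≺e) (All.zip (PE , f≺)) =
    f ∷ E′ , cong suc len , All.map proj₂ PE′ ∷ s′ , Pf ∷ All.map proj₁ PE′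

  sortCrossing : ∀ (P : Pred (Edge n) 0ℓ) E → AllPairs Cross E → All P E → ∃[ E′ ] length E′ ≡ length E × AllPairs _≺_ E′ × All P E′
  sortCrossing P []      []       []        = [] , refl , [] , []
  sortCrossing P (e ∷ E) (c ∷ cs) (Pe ∷ PE) with E′ , len , s , PE′ ← sortCrossing (λ f → P f × Cross e f) E cs (All.zip (PE , c))
    with E″ , len′ , s′ , PE″ ← insert P e E′ (All.map proj₂ PE′) s Pe (All.map proj₁ PE′) = E″ , trans len′ (cong suc len) , s′ , PE″

  module _ (σ : Edge n → Bool) where
    open Network (pair σ)

    Selected : Edge n → Set
    Selected e = σ e ≡ true

    sorted⇒chain : ∀ a {i b} E → AllPairs _≺_ E → All Selected E → All (λ e → toℕ (lo e) ℕ.< a × i ℕ.≤ toℕ (lo e) × b ℕ.≤ toℕ (hi e)) E → Cut.Chain n a i b (length E)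
    sorted⇒chain a []      _        _        _                  = Cut.[]
    sorted⇒chain a (e ∷ E) (s ∷ ss) (p ∷ ps) ((q , r , t) ∷ qs) = Cut.add r q t (Fin.toℕ<n (hi e)) (trans (pair-edge σ e) p)
      (sorted⇒chain a E ss ps (All.zipWith (λ { ((e<f , _ , e<f′) , (q , _ , _)) → q , e<f , e<f′ }) (s , qs)))

    crossing⇒chain : ∀ E {m} → IsCrossing (suc m) E → All Selected E → ∃[ a ] Cut.Chain n a 0 a (suc m)
    crossing⇒chain E (len , cs) ps with sortCrossing Selected E cs ps
    ... | []     , len′ , _        , _   = contradiction (trans len′ len) λ ()
    ... | e ∷ E′ , len′ , (s ∷ ss) , ps′ = toℕ (hi e) , subst (Cut.Chain n _ 0 _) (trans len′ len)
      (sorted⇒chain (toℕ (hi e)) (e ∷ E′) (s ∷ ss) ps′ ((lo<hi e , z≤n , ℕ.≤-refl) ∷ All.map (λ { (_ , p , q) → p , z≤n , ℕ.<⇒≤ q }) s))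

    chain⇒crossing : ∀ {a i b r} → a ℕ.≤ b → Cut.Chain n a i b r →
      ∃[ E ] IsCrossing r E × All Selected E × All (λ e → i ℕ.≤ toℕ (lo e) × toℕ (lo e) ℕ.< a × b ℕ.≤ toℕ (hi e)) E
    chain⇒crossing a≤b Cut.[] = [] , (refl , []) , [] , []
    chain⇒crossing {a} {i} {b} a≤b (Cut.add {i′ = i′} {j = j} p q r _ t c) with e , refl , refl , σe ← pair-true σ {i′} {j} t
      with E , (len , cs) , ps , bs ← chain⇒crossing (ℕ.≤-trans a≤b (ℕ.≤-trans r (ℕ.n≤1+n _))) c =
      e ∷ E , (cong suc len , All.map (λ { (u , v , w) → inj₁ (u , ℕ.<-≤-trans v (ℕ.≤-trans a≤b r) , w) }) bs ∷ cs) , σe ∷ ps ,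
      (p , q , r) ∷ All.map (λ { (u , v , w) → ℕ.≤-trans p (ℕ.≤-trans (ℕ.n≤1+n _) u) , v , ℕ.≤-trans r (ℕ.≤-trans (ℕ.n≤1+n _) w) }) bs

    chain-shorten : ∀ {a i b r r′} → r′ ℕ.≤ r → Cut.Chain n a i b r → Cut.Chain n a i b r′
    chain-shorten z≤n     c                          = Cut.[]
    chain-shorten (s≤s l) (Cut.add p q r t u c) = Cut.add p q r t u (chain-shorten l c)

  Free : ℕ → (Edge n → Bool) → Set
  Free k σ = ¬ (∃[ E ] IsCrossing (suc k) E × All (Selected σ) E)

  free-chain : ∀ {k σ} → Free k σ → ∀ {a r} → Network.Cut.Chain (pair σ) n a 0 a r → r ℕ.≤ k
  free-chain {k} {σ} free {a} {r} c with r ℕ.≤? k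
  ... | yes p = p
  ... | no ¬p with E , cr , ps , _ ← chain⇒crossing σ ℕ.≤-refl (chain-shorten σ (ℕ.≰⇒> ¬p) c) = contradiction (E , cr , ps) free

  chain-free : ∀ {k σ} → (∀ {a r} → a ℕ.≤ n → Network.Cut.Chain (pair σ) n a 0 a r → r ℕ.≤ k) → Free k σ
  chain-free {k} {σ} bound (E , cr , ps) with a , c ← crossing⇒chain σ E cr ps = ℕ.<-irrefl refl (bound (a≤n c) c)
    where
    a≤n : ∀ {a r} → Network.Cut.Chain (pair σ) n a 0 a (suc r) → a ℕ.≤ n
    a≤n (Network.Cut.add _ _ p q _ _) = ℕ.≤-trans p (ℕ.<⇒≤ q)

  Short : ℕ → Edge n → Set
  Short k e = toℕ (hi e) ℕ.≤ k ℕ.+ toℕ (lo e)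

  withShort : ℕ → (Edge n → Bool) → Edge n → Bool
  withShort k σ e = σ e ∨ does (toℕ (hi e) ℕ.≤? k ℕ.+ toℕ (lo e))

  withShort-⊇ : ∀ k σ e → σ e ≡ true → withShort k σ e ≡ true
  withShort-⊇ k σ e eq rewrite eq = refl

  withShort-short : ∀ k σ e → Short k e → withShort k σ e ≡ true
  withShort-short k σ e sh with σ e
  ... | true  = refl
  ... | false = dec-true (toℕ (hi e) ℕ.≤? k ℕ.+ toℕ (lo e)) sh

  -- Between the endpoints of an edge of a crossing there is an endpoint of every other edge.
  free-withShort : ∀ {k σ} → Free k σ → Free k (withShort k σ)
  free-withShort {k} {σ} free (E , cr , ps) with a , c ← crossing⇒chain (withShort k σ) E cr ps =
    ℕ.<-irrefl refl (free-chain {k} {σ} free (long 0 (ℕ.≤-reflexive (ℕ.+-identityʳ a)) refl c))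
    where
    long : ∀ {a i b r} t → a ℕ.+ t ℕ.≤ b → t ℕ.+ r ≡ suc k → Network.Cut.Chain (pair (withShort k σ)) n a i b r → Network.Cut.Chain (pair σ) n a i b r
    long t le eq Network.Cut.[] = Network.Cut.[]
    long {a} {i} {b} {suc r} t le eq (Network.Cut.add {i′ = i′} {j = j} p q u v w c) = Network.Cut.add p q u v keep
      (long (suc t) (ℕ.≤-trans (ℕ.≤-reflexive (ℕ.+-suc a t)) (s≤s (ℕ.≤-trans le u))) (trans (sym (ℕ.+-suc t r)) eq) c)
      where
      far : k ℕ.+ i′ ℕ.< j
      far = ℕ.≤-trans (ℕ.≤-reflexive (trans (cong (ℕ._+ i′) (sym eq)) (rearrange t r i′)))
        (ℕ.≤-trans (ℕ.+-monoˡ-≤ t (Network.Cut.chain-rows (pair (withShort k σ)) n a q c)) (ℕ.≤-trans le u))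
        where
        open +-*-Solver
        rearrange : ∀ t r i → (t ℕ.+ suc r) ℕ.+ i ≡ (r ℕ.+ suc i) ℕ.+ t
        rearrange = solve 3 (λ t r i → (t :+ (con 1 :+ r)) :+ i := (r :+ (con 1 :+ i)) :+ t) refl
      keep : pair σ i′ j ≡ true
      keep with e , refl , refl , eq ← pair-true (withShort k σ) {i′} {j} w with σ e in σe
      ... | true  = trans (pair-edge σ e) σe
      ... | false = contradiction far (ℕ.≤⇒≯ (short-true (toℕ (hi e) ℕ.≤? k ℕ.+ toℕ (lo e)) eq))
        where
        short-true : ∀ {A : Set} (d : Dec A) → does d ≡ true → A
        short-true (yes a) _ = a

  -- Maximal free sets have the largest size

  adjoin : (Edge n → Bool) → Edge n → Edge n → Bool
  adjoin σ e f = σ f ∨ does (e ≟ᵉ f)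

  adjoin-≡ : ∀ σ e → adjoin σ e e ≡ true
  adjoin-≡ σ e with σ e
  ... | true  = refl
  ... | false = dec-true (e ≟ᵉ e) refl

  adjoin-⊇ : ∀ σ e f → σ f ≡ true → adjoin σ e f ≡ true
  adjoin-⊇ σ e f eq rewrite eq = refl

  adjoin⁻ : ∀ σ e f → adjoin σ e f ≡ true → σ f ≡ true ⊎ e ≡ f
  adjoin⁻ σ e f eq with σ f | e ≟ᵉ f
  ... | true  | _      = inj₁ refl
  ... | false | yes e≡f = inj₂ e≡f
  adjoin⁻ σ e f () | false | no _

  free-⊆ : ∀ {k σ τ} → (∀ e → σ e ≡ true → τ e ≡ true) → Free k τ → Free k σ
  free-⊆ imp free (E , cr , ps) = free (E , cr , All.map (imp _) ps)

  module _ (k : ℕ) (0<k : 0 ℕ.< k) (2k≤n : k ℕ.+ k ℕ.≤ n) where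
    open Word n k 0<k 2k≤n

    free⇒network : ∀ {σ} → Free k σ → (∀ e → Short k e → σ e ≡ true) → ∃[ t ] Network.Runs (pair σ) 0 (word n k 0 n) t
    free⇒network {σ} free short = free⇒runs (pair σ) (free-chain {k} {σ} free) λ {i} {j} i<j le j<n →
      trans (pair-mkEdge σ i<j j<n) (short _ (ℕ.≤-trans (ℕ.≤-reflexive (Fin.toℕ-fromℕ< j<n)) (ℕ.≤-trans le (ℕ.≤-reflexive (cong (k ℕ.+_) (sym (Fin.toℕ-fromℕ< _)))))))

    triangle-word : ∀ h → triangle 0 (length (word n k 0 n)) h ≡ triangle 0 n h
    triangle-word h = cong (λ m → triangle 0 m h) (word-length n k 0 n)

    free-missing : ∀ {σ} → Free k σ → ascents (word n k 0 n) ℕ.≤ missing σ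
    free-missing {σ} free with t , r ← free⇒network {withShort k σ} (free-withShort {k} {σ} free) (withShort-short k σ) =
      ℕ.≤-trans (ℕ.≤-reflexive (Network.ascents-runs _ r)) (ℕ.≤-trans (runs-exchanges r) (ℕ.≤-trans (ℕ.≤-reflexive (trans (triangle-word _) (sym (missing-triangle (withShort k σ))))) (fewer (allEdges n))))
      where
      fewer : ∀ es → ℕ-Sum.fold (λ e → if withShort k σ e then 0 else 1) es ℕ.≤ ℕ-Sum.fold (λ e → if σ e then 0 else 1) es
      fewer [] = z≤n
      fewer (e ∷ es) = ℕ.+-mono-≤ (one-edge (σ e) (does (toℕ (hi e) ℕ.≤? k ℕ.+ toℕ (lo e)))) (fewer es)
        where
        one-edge : ∀ b c → (if b ∨ c then 0 else 1) ℕ.≤ (if b then 0 else 1)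
        one-edge true  c     = z≤n
        one-edge false true  = z≤n
        one-edge false false = ℕ.≤-refl

    maximal-short : ∀ {σ} → Free k σ → (∀ e → σ e ≡ false → ¬ Free k (adjoin σ e)) → ∀ e → Short k e → σ e ≡ true
    maximal-short {σ} free maximal e sh with σ e in eq
    ... | true  = refl
    ... | false = contradiction (free-⊆ {k} {adjoin σ e} {withShort k σ} included (free-withShort {k} {σ} free)) (maximal e eq)
      where
      included : ∀ f → adjoin σ e f ≡ true → withShort k σ f ≡ true
      included f p with adjoin⁻ σ e f p
      ... | inj₁ q    = withShort-⊇ k σ f q
      ... | inj₂ refl = withShort-short k σ f sh

    maximal-missing : ∀ {σ} → Free k σ → (∀ e → σ e ≡ false → ¬ Free k (adjoin σ e)) → missing σ ≡ ascents (word n k 0 n)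
    maximal-missing {σ} free maximal with t , r ← free⇒network {σ} free (maximal-short {σ} free maximal) with runs-tight r
    ... | inj₁ eq = trans (missing-triangle σ) (trans (sym (triangle-word _)) (trans (sym eq) (sym (Network.ascents-runs _ r))))
    ... | inj₂ (i₀ , j₀ , _ , i₀<j₀ , j₀< , out , lift-runs) = contradiction
      (chain-free {k} {adjoin σ e} (λ {a} {r} a≤n → runs⇒free (pair (adjoin σ e)) (lift-runs extends) {a} a≤n {r})) (maximal e (trans (sym (pair-mkEdge σ i₀<j₀ j₀<n)) out))
      where
      j₀<n : j₀ ℕ.< n
      j₀<n = ℕ.≤-trans j₀< (ℕ.≤-reflexive (word-length n k 0 n))
      e = mkEdge i₀<j₀ j₀<n
      extends : Extends (pair σ) (pair (adjoin σ e)) i₀ j₀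
      extends = record { old = λ {i} {j} → pair-mono {σ} {adjoin σ e} (adjoin-⊇ σ e) {i} {j} ; new = new }
        where
        new : ∀ {i j} → pair (adjoin σ e) i j ≡ true → pair σ i j ≡ true ⊎ (i ≡ i₀ × j ≡ j₀)
        new {i} {j} p with f , refl , refl , q ← pair-true (adjoin σ e) {i} {j} p with adjoin⁻ σ e f q
        ... | inj₁ r    = inj₁ (trans (pair-edge σ f) r)
        ... | inj₂ refl = inj₂ (Fin.toℕ-fromℕ< _ , Fin.toℕ-fromℕ< j₀<n)

¬¬-dec : ∀ {a} (A : Set a) → ¬ ¬ Dec A
¬¬-dec A ¬d = ¬d (no λ a → ¬d (yes a))

¬¬-all : ∀ {a p} {A : Set a} {P : A → Set p} xs → (∀ x → ¬ ¬ P x) → ¬ ¬ All P xs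
¬¬-all []       f k = k []
¬¬-all (x ∷ xs) f k = f x λ p → ¬¬-all xs f λ ps → k (p ∷ ps)

-- Normal forms and leading parts of polynomials

module Leading {c ℓ₁ ℓ₂} (K : HeytingField c ℓ₁ ℓ₂) (n : ℕ) where
  open Evaluation K n

  Distinct : Terms → Set c
  Distinct = AllPairs (λ t t′ → ¬ (proj₂ t ≐ proj₂ t′))

  NonZero : Terms → Set (c ⊔ ℓ₁)
  NonZero = All (λ t → ¬ (proj₁ t K.≈ K.0#))

  normalForm : ∀ p → ¬ ¬ (∃[ q ] _≈ᵖ_ K n p q × Distinct q × NonZero q)
  normalForm [] k = k ([] , (λ _ → K.refl) , [] , [])
  normalForm ((a , m) ∷ p) k = normalForm p λ { (q , p≈q , dis , nz) →
    let b  = a K.+ coeff K n q m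
        ≉? = λ (t : K.Carrier × Monomial n) → ¬? (proj₂ t ≐? m)
        q′ = filter ≉? q
        dis′ = AllPairs.filter⁺ ≉? dis
        nz′  = All.filter⁺ ≉? nz
    in ¬¬-dec (b K.≈ K.0#) λ
      { (yes b≈0) → k (q′ , (λ m′ → K.trans (collect q p≈q m′) (K.trans (K.+-congʳ (zero-head b≈0 m′)) (K.+-identityˡ _))) , dis′ , nz′)
      ; (no b≉0)  → k ((b , m) ∷ q′ , collect q p≈q , All.map (λ ≉ eq → ≉ (≗⇒≐ λ e → sym (≐⇒≗ eq e))) (All.all-filter ≉? q) ∷ dis′ , b≉0 ∷ nz′) } }
    where
    zero-head : ∀ {b} → b K.≈ K.0# → ∀ m′ → (if does (m ≐? m′) then b else K.0#) K.≈ K.0#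
    zero-head b≈0 m′ with does (m ≐? m′)
    ... | true  = b≈0
    ... | false = K.refl

    collect : ∀ q → _≈ᵖ_ K n p q → ∀ m′ → coeff K n ((a , m) ∷ p) m′
      K.≈ coeff K n ((a K.+ coeff K n q m , m) ∷ filter (λ t → ¬? (proj₂ t ≐? m)) q) m′
    collect q p≈q m′ with co ← coeff-others m q m′ with m ≐? m′
    ... | yes eq = K.trans (K.+-congˡ (K.trans (p≈q m′) (coeff-cong q (≗⇒≐ λ e → sym (≐⇒≗ eq e)))))
      (K.sym (K.trans (K.+-congˡ co) (K.+-identityʳ _)))
    ... | no _   = K.+-congˡ (K.trans (p≈q m′) (K.sym co))

  coeff-absent : ∀ q m → All (λ t → ¬ (proj₂ t ≐ m)) q → coeff K n q m K.≈ K.0#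
  coeff-absent []             m []       = K.refl
  coeff-absent ((a , m′) ∷ q) m (p ∷ ps) with m′ ≐? m
  ... | yes eq = contradiction eq p
  ... | no _   = K.trans (K.+-identityˡ _) (coeff-absent q m ps)

  coeff-distinct : ∀ {q a m} → Distinct q → (a , m) ∈ˡ q → coeff K n q m K.≈ a
  coeff-distinct {(a , m) ∷ q} (d ∷ _) (here refl) with m ≐? m
  ... | yes _ = K.trans (K.+-congˡ (coeff-absent q m (All.map (λ ≉ eq → ≉ (≗⇒≐ λ e → sym (≐⇒≗ eq e))) d))) (K.+-identityʳ a)
  ... | no ¬p = contradiction (≗⇒≐ (λ _ → refl)) ¬p
  coeff-distinct {(a , m) ∷ q} {m = m′} (d ∷ dis) (there t∈) with m ≐? m′
  ... | yes eq = contradiction eq (All.lookup d t∈)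
  ... | no _   = K.trans (K.+-identityˡ _) (coeff-distinct dis t∈)

  lowest : ∀ (ω : Monomial n → ℕ) {g : Terms} → g ≢ [] → ∃[ k ] (∀ {t} → t ∈ˡ g → k ℕ.≤ ω (proj₂ t)) × (∃[ t ] t ∈ˡ g × ω (proj₂ t) ≡ k)
  lowest ω {[]} ne = contradiction refl ne
  lowest ω {t ∷ []} ne = ω (proj₂ t) , (λ { (here refl) → ℕ.≤-refl }) , t , here refl , refl
  lowest ω {t ∷ g@(_ ∷ _)} ne with k , low , s , s∈ , eq ← lowest ω {g} (λ ()) with ℕ.≤-total k (ω (proj₂ t))
  ... | inj₁ le = k , (λ { (here refl) → le ; (there p) → low p }) , s , there s∈ , eq
  ... | inj₂ le = ω (proj₂ t) , (λ { (here refl) → ℕ.≤-refl ; (there p) → ℕ.≤-trans le (low p) }) , t , here refl , refl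

  select : (Edge n → ℕ) → ℕ → Terms → Terms
  select δ k = filter (λ t → wt δ (proj₂ t) ℕ.≟ k)

  record Part (δ : Edge n → ℕ) (g : Terms) : Set c where
    field
      level : ℕ
      below : ∀ {t} → t ∈ˡ g → level ℕ.≤ wt δ (proj₂ t)
      some  : select δ level g ≢ []

    part : Terms
    part = select δ level g

    part-⊆ : ∀ {t} → t ∈ˡ part → t ∈ˡ g
    part-⊆ t∈ = proj₁ (List.∈-filter⁻ (λ t → wt δ (proj₂ t) ℕ.≟ level) {xs = g} t∈)

    part-level : ∀ {t} → t ∈ˡ part → wt δ (proj₂ t) ≡ level
    part-level t∈ = proj₂ (List.∈-filter⁻ (λ t → wt δ (proj₂ t) ℕ.≟ level) {xs = g} t∈)

  leading : ∀ δ {g} → g ≢ [] → Part δ g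
  leading δ {g} ne with k , low , t , t∈ , eq ← lowest (wt δ) ne = record
    { level = k ; below = low
    ; some = λ empty → contradiction (subst (t ∈ˡ_) empty (List.∈-filter⁺ (λ t → wt δ (proj₂ t) ℕ.≟ k) t∈ eq)) λ () }

  Constant : (Edge n → ℕ) → Terms → Set c
  Constant δ g = ∀ {t t′} → t ∈ˡ g → t′ ∈ˡ g → wt δ (proj₂ t) ≡ wt δ (proj₂ t′)

  part-constant : ∀ {δ g} (P : Part δ g) → Constant δ (Part.part P)
  part-constant P t∈ t′∈ = trans (Part.part-level P t∈) (sym (Part.part-level P t′∈))

  module _ {a b} (F : CommutativeRing a b) (ι : Hom KR F) where
    private
      module F = CommutativeRing F
      S = PowerSeries.series F
      module S = CommutativeRing S
      open PowerSeries F using (X; X⊛-suc; ⊛-constˡ)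
      open CommutativeExp S.commutativeSemiring using (_^_)
      module ∑F = Big F.+-commutativeMonoid
      module ∑S = Big S.+-commutativeMonoid

    X^-low : ∀ j f i → i ℕ.< j → (X ^ j S.* f) i F.≈ F.0#
    X^-low (suc j) f zero    _        = F.trans (S.*-assoc X (X ^ j) f 0) (F.zeroˡ _)
    X^-low (suc j) f (suc i) (s≤s lt) = F.trans (S.*-assoc X (X ^ j) f (suc i)) (F.trans (X⊛-suc _ i) (X^-low j f i lt))

    X^-at : ∀ j f → (X ^ j S.* f) j F.≈ f 0
    X^-at zero    f = S.*-identityˡ f 0
    X^-at (suc j) f = F.trans (S.*-assoc X (X ^ j) f (suc j)) (F.trans (X⊛-suc _ j) (X^-at j f))

    -- The coefficient of X ^ level is the value of the leading part at the constant terms.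
    extract : ∀ {δ g} (P : Part δ g) u → eval S (const-hom F ∘-hom ι) (λ e → X ^ δ e S.* u e) g S.≈ S.0# →
      eval F ι (λ e → u e 0) (Part.part P) F.≈ F.0#
    extract {δ} {g} P u z = F.trans (∑F.fold-filter _ (term F ι (λ e → u e 0)) g) (F.trans (F.sym (F.trans (coefficient g) (∑F.fold-cong∈ g same))) (z level))
      where
      open Part P
      coefficient : ∀ g → ∑S.fold (term S (const-hom F ∘-hom ι) (λ e → X ^ δ e S.* u e)) g level
        F.≈ ∑F.fold (λ t → term S (const-hom F ∘-hom ι) (λ e → X ^ δ e S.* u e) t level) g
      coefficient []      = F.refl
      coefficient (t ∷ g) = F.+-congˡ (coefficient g)

      at-level : ∀ a m → term S (const-hom F ∘-hom ι) (λ e → X ^ δ e S.* u e) (a , m) level F.≈ Hom.⟦_⟧ ι a F.* (X ^ wt δ m S.* MonomialValue.mon S n u m) level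
      at-level a m = F.trans (S.*-congˡ (MonomialValue.mon-scale S n X δ u m) level) (⊛-constˡ _ _ level)

      same : ∀ {t} → t ∈ˡ g → term S (const-hom F ∘-hom ι) (λ e → X ^ δ e S.* u e) t level F.≈ (if does (wt δ (proj₂ t) ℕ.≟ level) then term F ι (λ e → u e 0) t else F.0#)
      same {a , m} t∈ = go (wt δ m ℕ.≟ level)
        where
        go : (d : Dec (wt δ m ≡ level)) → term S (const-hom F ∘-hom ι) (λ e → X ^ δ e S.* u e) (a , m) level F.≈ (if does d then term F ι (λ e → u e 0) (a , m) else F.0#)
        go (yes eq) = F.trans (at-level a m) (F.*-congˡ (F.trans (F.reflexive (cong (X ^ wt δ m S.* MonomialValue.mon S n u m) (sym eq)))
          (F.trans (X^-at (wt δ m) (MonomialValue.mon S n u m)) (⟦⟧-mon (constantTerm F) u m))))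
        go (no ≢)   = F.trans (at-level a m) (F.trans (F.*-congˡ (X^-low (wt δ m) _ level (ℕ.≤∧≢⇒< (below t∈) (≢ ∘ sym)))) (F.zeroʳ _))

    eval-point : ∀ {u v} → (∀ e → u e F.≈ v e) → ∀ g → eval F ι u g F.≈ eval F ι v g
    eval-point eq g = ∑F.fold-cong g (λ t → F.*-congˡ (MonomialValue.mon-cong F n {m = proj₂ t} (λ _ → refl) (λ e → inj₂ (eq e))))

  -- From skew matrices of rank 2k to matrices of rank k

  product : ∀ {a b} (F : CommutativeRing a b) → List (Exterior.Vector F n × Exterior.Vector F n) → Edge n → CommutativeRing.Carrier F
  product F L e = Big.fold (CommutativeRing.+-commutativeMonoid F) (λ { (a , b) → CommutativeRing._*_ F (a (lo e)) (b (hi e)) }) L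

  SkewZero ProductZero : ℕ → Terms → Set (lsuc (c ⊔ ℓ₁))
  SkewZero k g = ∀ (F : CommutativeRing c ℓ₁) ι L → length L ≡ k → CommutativeRing._≈_ F (eval F ι (Exterior.skew F L) g) (CommutativeRing.0# F)
  ProductZero k g = ∀ (F : CommutativeRing c ℓ₁) ι L → length L ≡ k → CommutativeRing._≈_ F (eval F ι (product F L) g) (CommutativeRing.0# F)

  column : ℕ → Edge n → ℕ
  column c e = [ toℕ (hi e) ℕ.≤? c ]

  module _ (F : CommutativeRing c ℓ₁) (ι : Hom KR F) where
    private
      module F = CommutativeRing F
      S = PowerSeries.series F
      module S = CommutativeRing S
      open PowerSeries F using (X; const)
      open CommutativeExp S.commutativeSemiring using (_^_; ^-homo-*; ^-congʳ)
      module ∑S = Big S.+-commutativeMonoid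
      module ×S = SemigroupProperties S.*-commutativeSemigroup

    skew-extract : ∀ {k g} (P : Part (toℕ ∘ lo) g) → SkewZero k g → ∀ L → length L ≡ k → eval F ι (product F L) (Part.part P) F.≈ F.0#
    skew-extract {g = g} P z L len = F.trans (eval-point F ι (λ e → F.sym (at-zero L e)) (Part.part P)) (extract F ι P (λ e → ∑S.fold (u e) L)
      (S.trans (eval-point S (const-hom F ∘-hom ι) (λ e → S.sym (skew-scaled L e)) g) (z S (const-hom F ∘-hom ι) (map twist L) (trans (List.length-map twist L) len))))
      where
      open Exterior S using (σ)
      twist : Exterior.Vector F n × Exterior.Vector F n → Exterior.Vector S n × Exterior.Vector S n
      twist (a , b) = (λ v → X ^ toℕ v S.* const (a v)) , (λ v → const (b v))

      gap : Edge n → ℕ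
      gap e = toℕ (hi e) ℕ.∸ suc (toℕ (lo e))

      u : Edge n → Exterior.Vector F n × Exterior.Vector F n → S.Carrier
      u e (a , b) = const (a (lo e)) S.* const (b (hi e)) S.+ σ S.* (const (b (lo e)) S.* (X S.* (X ^ gap e S.* const (a (hi e)))))

      at-zero : ∀ L e → ∑S.fold (u e) L 0 F.≈ product F L e
      at-zero []            e = F.refl
      at-zero ((a , b) ∷ L) e = F.+-cong (F.trans (F.+-congˡ (F.trans (F.*-congˡ (F.trans (F.*-congˡ (F.zeroˡ _)) (F.zeroʳ _))) (F.zeroʳ _))) (F.+-identityʳ _)) (at-zero L e)

      skew-scaled : ∀ L e → Exterior.skew S (map twist L) e S.≈ X ^ toℕ (lo e) S.* ∑S.fold (u e) L
      skew-scaled []            e = S.sym (S.zeroʳ _)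
      skew-scaled ((a , b) ∷ L) e = S.trans (S.+-cong (S.+-cong (S.*-assoc _ _ _) (S.*-congˡ
          (S.trans (S.*-congˡ (S.trans (S.*-congʳ (S.trans (^-congʳ X (sym (trans (ℕ.+-suc (toℕ (lo e)) (gap e)) (ℕ.m+[n∸m]≡n (lo<hi e))))) (^-homo-* X (toℕ (lo e)) (suc (gap e))))) (S.trans (S.*-assoc _ _ _) (S.*-congˡ (S.*-assoc _ _ _)))))
          (×S.x∙yz≈y∙xz _ _ _)))) (skew-scaled L e))
        (S.trans (S.+-congʳ (S.trans (S.+-congˡ (×S.x∙yz≈y∙xz _ _ _)) (S.sym (S.distribˡ _ _ _)))) (S.sym (S.distribˡ _ _ _)))

    column-extract : ∀ {k g} c₀ (P : Part (column c₀) g) → ProductZero k g → ∀ L → length L ≡ k → eval F ι (product F L) (Part.part P) F.≈ F.0#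
    column-extract {g = g} c₀ P z L len = F.trans (eval-point F ι (λ e → F.refl) (Part.part P)) (extract F ι P (λ e → const (product F L e))
      (S.trans (eval-point S (const-hom F ∘-hom ι) (λ e → S.sym (scaled L e)) g) (z S (const-hom F ∘-hom ι) (map twist L) (trans (List.length-map twist L) len))))
      where
      twist : Exterior.Vector F n × Exterior.Vector F n → Exterior.Vector S n × Exterior.Vector S n
      twist (a , b) = (λ v → const (a v)) , (λ v → X ^ [ toℕ v ℕ.≤? c₀ ] S.* const (b v))

      scaled : ∀ L e → product S (map twist L) e S.≈ X ^ column c₀ e S.* const (product F L e)
      scaled []            e = S.sym (S.trans (S.*-congˡ {X ^ column c₀ e} (Hom.⟦⟧-0 (const-hom F))) (S.zeroʳ _))
      scaled ((a , b) ∷ L) e = S.trans (S.+-cong (S.trans (×S.x∙yz≈y∙xz _ _ _) (S.*-congˡ {X ^ column c₀ e} (S.sym (Hom.⟦⟧-* (const-hom F) _ _)))) (scaled L e))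
        (S.trans (S.sym (S.distribˡ _ _ _)) (S.*-congˡ {X ^ column c₀ e} (S.sym (Hom.⟦⟧-+ (const-hom F) _ _))))

  record Refined (g g′ : Terms) : Set c where
    field
      nonempty : g′ ≢ []
      included : ∀ {t} → t ∈ˡ g′ → t ∈ˡ g
      distinct : Distinct g → Distinct g′

  refine-part : ∀ {δ g} (P : Part δ g) → Refined g (Part.part P)
  refine-part P = record { nonempty = Part.some P ; included = Part.part-⊆ P ; distinct = AllPairs.filter⁺ _ }

  refine-trans : ∀ {g g′ g″} → Refined g g′ → Refined g′ g″ → Refined g g″
  refine-trans r r′ = record { nonempty = nonempty r′ ; included = included r ∘ included r′ ; distinct = distinct r′ ∘ distinct r }
    where open Refined

  homogeneous-product : ∀ {k g} → g ≢ [] → SkewZero k g → ∃[ g′ ] Refined g g′ × ProductZero k g′ × (∀ {c₀} → c₀ ℕ.< n → Constant (column c₀) g′)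
  homogeneous-product {k} {g} ne z = let g₀ , r , z′ , const′ = columns n in
    g₀ , refine-trans (refine-part P) r , z′ , const′
    where
    P = leading (toℕ ∘ lo) ne
    columns : ∀ m → ∃[ g′ ] Refined (Part.part P) g′ × ProductZero k g′ × (∀ {c₀} → c₀ ℕ.< m → Constant (column c₀) g′)
    columns zero    = Part.part P , record { nonempty = Part.some P ; included = id ; distinct = id } , (λ F ι L len → skew-extract F ι P z L len) , λ ()
    columns (suc m) with g₁ , r , z₁ , const₁ ← columns m =
      Part.part Q , refine-trans r (refine-part Q) , (λ F ι L len → column-extract F ι m Q z₁ L len) , all
      where
      Q = leading (column m) (Refined.nonempty r)
      all : ∀ {c₀} → c₀ ℕ.< suc m → Constant (column c₀) (Part.part Q)
      all {c₀} lt with ℕ.m≤n⇒m<n∨m≡n (ℕ.s≤s⁻¹ lt)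
      ... | inj₁ c₀<m = λ p q → const₁ c₀<m (Part.part-⊆ Q p) (Part.part-⊆ Q q)
      ... | inj₂ refl = part-constant Q

-- Triangular frames

-- An entry consists of a letter w, a vector vanishing before row w, and a matrix column.
module Frame {c ℓ} (F : CommutativeRing c ℓ) where
  open CommutativeRing F hiding (zero) renaming (refl to ≈-refl; sym to ≈-sym; trans to ≈-trans)
  open SemiringSolver commutativeSemiring using (solve; _:=_; _:+_; _:*_)

  Column : Set c
  Column = ℕ → Carrier

  unitColumn : ℕ → Column
  unitColumn i r = if does (r ℕ.≟ i) then 1# else 0#

  unitColumn-≡ : ∀ i → unitColumn i i ≈ 1#
  unitColumn-≡ i = reflexive (cong (λ b → if b then 1# else 0#) (dec-true (i ℕ.≟ i) refl))

  unitColumn-≢ : ∀ {i r} → r ≢ i → unitColumn i r ≈ 0#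
  unitColumn-≢ {i} {r} r≢i = reflexive (cong (λ b → if b then 1# else 0#) (dec-false (r ℕ.≟ i) r≢i))

  Entry : Set c
  Entry = ℕ × Column × Column

  Span : List Entry → Column → Set (c ⊔ ℓ)
  Span []              D = Lift c (∀ r → D r ≈ 0#)
  Span ((w , v , C) ∷ t) D = ∃[ y ] Σ Column λ D′ → (∀ r → D r ≈ y * v r + D′ r) × Span t D′

  Low : ℕ → Column → Set ℓ
  Low w v = ∀ {r} → r ℕ.< w → v r ≈ 0#

  Good : List Entry → Set (c ⊔ ℓ)
  Good []                = Poly.⊤
  Good ((w , v , C) ∷ t) = Low w v × (Σ Column λ D → (∀ r → C r ≈ v r + D r) × Span t D) × Good t

  span-combine : ∀ t {D D′} x y → Span t D → Span t D′ → Span t (λ r → x * D r + y * D′ r)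
  span-combine [] x y (lift z) (lift z′) = lift λ r → ≈-trans (+-cong (≈-trans (*-congˡ (z r)) (zeroʳ x)) (≈-trans (*-congˡ (z′ r)) (zeroʳ y))) (+-identityˡ 0#)
  span-combine (_ ∷ t) x y (p , D , eq , s) (q , D′ , eq′ , s′) = x * p + y * q , _ ,
    (λ r → ≈-trans (+-cong (*-congˡ (eq r)) (*-congˡ (eq′ r)))
      (solve 7 (λ x y p q v d d′ → x :* (p :* v :+ d) :+ y :* (q :* v :+ d′) := (x :* p :+ y :* q) :* v :+ (x :* d :+ y :* d′)) ≈-refl x y p q _ _ _)) ,
    span-combine t x y s s′

  span-append : ∀ t z {D} → Span t D → Span (t ++ z ∷ []) D
  span-append []      (w , v , C) {D} (lift z) = 0# , D , (λ r → ≈-sym (≈-trans (+-congʳ (zeroˡ (v r))) (+-identityˡ _))) , lift z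
  span-append (_ ∷ t) z (y , D , eq , s) = y , D , eq , span-append t z s

  good-append : ∀ t {i} → Good t → Good (t ++ (i , unitColumn i , unitColumn i) ∷ [])
  good-append [] _ = (λ r<i → unitColumn-≢ (ℕ.<⇒≢ r<i)) , ((λ _ → 0#) , (λ r → ≈-sym (+-identityʳ _)) , lift λ _ → ≈-refl) , _
  good-append (_ ∷ t) (low , (D , eq , s) , g) = low , (D , eq , span-append t _ s) , good-append t g

  triples : (ℕ → Column) → ℕ → List (ℕ × Column) → List Entry
  triples C j []            = []
  triples C j ((w , v) ∷ t) = (w , v , C j) ∷ triples C (suc j) t

  -- The columns left of j are kept on a stack whose top is column j - 1.
  unstack : (ℕ → Column) → ℕ → List (ℕ × Column) → List Entry → List Entry
  unstack C (suc j) ((w , v) ∷ O) t = unstack C j O ((w , v , C j) ∷ t)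
  unstack C _       _             t = t

  unstack-triples : ∀ C j L O t → unstack C (j ℕ.+ length L) (L ʳ++ O) t ≡ unstack C j O (triples C j L ++ t)
  unstack-triples C j [] O t = cong (λ j → unstack C j O t) (ℕ.+-identityʳ j)
  unstack-triples C j (x ∷ L) O t = trans (cong (λ j → unstack C j (L ʳ++ x ∷ O) t) (ℕ.+-suc j (length L))) (unstack-triples C (suc j) L (x ∷ O) t)

module Transfer {a b p q} (A : CommutativeRing a p) (B : CommutativeRing b q) where
  private
    module A = CommutativeRing A
    module B = CommutativeRing B
    module FA = Frame A
    module FB = Frame B

  record Semilinear (H : FA.Column → FB.Column) : Set (a ⊔ b ⊔ p ⊔ q) where
    field
      ρ        : A.Carrier → B.Carrier
      H-linear : ∀ {C D} y v → (∀ r → C r A.≈ y A.* v r A.+ D r) → ∀ r → H C r B.≈ ρ y B.* H v r B.+ H D r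
      H-add    : ∀ {C D} v → (∀ r → C r A.≈ v r A.+ D r) → ∀ r → H C r B.≈ H v r B.+ H D r
      H-zero   : ∀ {D} → (∀ r → D r A.≈ A.0#) → ∀ r → H D r B.≈ B.0#
      H-low    : ∀ {w v} → FA.Low w v → FB.Low w (H v)

  module _ {H} (sl : Semilinear H) where
    open Semilinear sl

    mapE : List (ℕ × FA.Column) → List (ℕ × FB.Column)
    mapE = map λ { (w , v) → w , H v }

    mapE-letters : ∀ O → map proj₁ (mapE O) ≡ map proj₁ O
    mapE-letters []      = refl
    mapE-letters (_ ∷ O) = cong (_ ∷_) (mapE-letters O)

    Related : List FA.Entry → List FB.Entry → Set (a ⊔ b ⊔ p ⊔ q)
    Related t t′ = (FA.Good t → FB.Good t′) × (∀ {D} → FA.Span t D → FB.Span t′ (H D))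

    related-∷ : ∀ {t t′} w v {C C′} → (∀ r → C′ r B.≈ H C r) → Related t t′ → Related ((w , v , C) ∷ t) ((w , H v , C′) ∷ t′)
    related-∷ w v eq (good , span) =
      (λ { (low , (D , p , s) , g) → H-low low , (H D , (λ r → B.trans (eq r) (H-add v p r)) , span s) , good g }) ,
      (λ { (y , D , p , s) → ρ y , H D , H-linear y v p , span s })

    related-[] : Related [] []
    related-[] = (λ _ → _) , λ { (lift z) → lift (H-zero z) }

    related-triples : ∀ {C C′} L j → (∀ {c} → j ℕ.≤ c → ∀ r → C′ c r B.≈ H (C c) r) → Related (FA.triples C j L) (FB.triples C′ j (mapE L))
    related-triples []            j eq = related-[]
    related-triples ((w , v) ∷ L) j eq = related-∷ w v (eq ℕ.≤-refl) (related-triples L (suc j) (λ le → eq (ℕ.≤-trans (ℕ.n≤1+n j) le)))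

    related-unstack : ∀ {C C′} O j {t t′} → (∀ {c} → c ℕ.< j → ∀ r → C′ c r B.≈ H (C c) r) → Related t t′ →
      Related (FA.unstack C j O t) (FB.unstack C′ j (mapE O) t′)
    related-unstack []            zero    eq r = r
    related-unstack []            (suc j) eq r = r
    related-unstack (_ ∷ O)       zero    eq r = r
    related-unstack ((w , v) ∷ O) (suc j) eq r = related-unstack O j (λ lt → eq (ℕ.<-trans lt (ℕ.n<1+n j))) (related-∷ w v (eq (ℕ.n<1+n j)) r)

-- The degeneration

Processed : ∀ {n} → ℕ → ℕ → Edge n → Set
Processed i j e = toℕ (lo e) ℕ.< i ⊎ (toℕ (lo e) ≡ i × toℕ (hi e) ℕ.< j)

processed? : ∀ {n} i j (e : Edge n) → Dec (Processed i j e)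
processed? i j e = (toℕ (lo e) ℕ.<? i) ⊎-dec ((toℕ (lo e) ℕ.≟ i) ×-dec (toℕ (hi e) ℕ.<? j))

module Degeneration {c ℓ₁ ℓ₂} (K : HeytingField c ℓ₁ ℓ₂) (n : ℕ) where
  open Evaluation K n
  open Leading K n

  module _ (F : CommutativeRing c ℓ₁) where
    open CommutativeRing F using (Carrier; _≈_; 0#; 1#)
    open Frame F

    value : ℕ → ℕ → (ℕ → Column) → Edge n → Carrier
    value i j C e = if does (processed? i j e) then 1# else C (toℕ (hi e)) (toℕ (lo e))

    value-processed : ∀ {i j e} C → Processed i j e → value i j C e ≡ 1#
    value-processed {i} {j} {e} C p = cong (λ b → if b then 1# else C (toℕ (hi e)) (toℕ (lo e))) (dec-true (processed? i j e) p)

    value-unprocessed : ∀ {i j e} C → ¬ Processed i j e → value i j C e ≡ C (toℕ (hi e)) (toℕ (lo e))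
    value-unprocessed {i} {j} {e} C p = cong (λ b → if b then 1# else C (toℕ (hi e)) (toℕ (lo e))) (dec-false (processed? i j e) p)

    record Point (i j : ℕ) (os : List ℕ) (κ : ℕ) (xs : List ℕ) : Set (c ⊔ ℓ₁) where
      field
        C         : ℕ → Column
        O         : List (ℕ × Column)
        v         : Column
        X         : List (ℕ × Column)
        O-letters : map proj₁ O ≡ os
        X-letters : map proj₁ X ≡ xs
        left      : ∀ {c r} → i ℕ.< c → c ℕ.< j → r ℕ.≤ i → C c r ≈ 0#
        right     : ∀ {c r} → j ℕ.≤ c → r ℕ.< i → C c r ≈ 0#
        good      : Good (unstack C j O ((κ , v , unitColumn i) ∷ triples C j X))

  Vanishes : ℕ → ℕ → List ℕ → ℕ → List ℕ → Terms → Set (lsuc (c ⊔ ℓ₁))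
  Vanishes i j os κ xs g = ∀ (F : CommutativeRing c ℓ₁) ι (P : Point F i j os κ xs) → CommutativeRing._≈_ F (eval F ι (value F i j (Point.C P)) g) (CommutativeRing.0# F)

  module _ (s : ℕ → ℕ → Bool) where

    record State (i j : ℕ) (g : Terms) : Set (c ⊔ ℓ₁) where
      field
        nonempty    : g ≢ []
        nonzero     : NonZero g
        distinct    : Distinct g
        supported   : ∀ {t} → t ∈ˡ g → ∀ e → s (toℕ (lo e)) (toℕ (hi e)) ≡ false → proj₂ t e ≡ 0
        homogeneous : ∀ {c₀} → c₀ ℕ.< n → Constant (column c₀) g
        agree       : ∀ {t t′} → t ∈ˡ g → t′ ∈ˡ g → ∀ e → Processed i j e → proj₂ t e ≡ proj₂ t′ e

    -- The column weight of j is constant on g and splits into the weight δ, the contribution of processed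
    -- edges and the exponent of (i , j); so the terms of least weight with respect to δ agree in this exponent.
    module Stay {i j} (i<j : i ℕ.< j) (j<n : j ℕ.< n) where

      δ : Edge n → ℕ
      δ e = if does (processed? i (suc j) e) then 0 else column j e

      processed-step : ∀ (e : Edge n) → Processed i (suc j) e → Processed i j e ⊎ (toℕ (lo e) ≡ i × toℕ (hi e) ≡ j)
      processed-step e (inj₁ p) = inj₁ (inj₁ p)
      processed-step e (inj₂ (p , q)) with ℕ.m≤n⇒m<n∨m≡n (ℕ.s≤s⁻¹ q)
      ... | inj₁ r = inj₁ (inj₂ (p , r))
      ... | inj₂ r = inj₂ (p , r)

      processed-mono : ∀ (e : Edge n) → Processed i j e → Processed i (suc j) e
      processed-mono e = Sum.map₂ λ { (p , q) → p , ℕ.<-trans q (ℕ.n<1+n j) }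

      state : ∀ {g} (st : State i j g) (P : Part δ g) → State i (suc j) (Part.part P)
      state {g} st P = record
        { nonempty    = Part.some P
        ; nonzero     = All.filter⁺ _ (nonzero st)
        ; distinct    = AllPairs.filter⁺ _ (distinct st)
        ; supported   = supported st ∘ Part.part-⊆ P
        ; homogeneous = λ lt p q → homogeneous st lt (Part.part-⊆ P p) (Part.part-⊆ P q)
        ; agree       = agree′
        }
        where
        open State
        ρ : Edge n → ℕ
        ρ e = if does (processed? i j e) then column j e else 0

        agree′ : ∀ {t t′} → t ∈ˡ Part.part P → t′ ∈ˡ Part.part P → ∀ e → Processed i (suc j) e → proj₂ t e ≡ proj₂ t′ e
        agree′ {t} {t′} p q e pr = Sum.[ agree st (Part.part-⊆ P p) (Part.part-⊆ P q) e , (λ { (lo≡ , hi≡) → at-edge lo≡ hi≡ }) ]′ (processed-step e pr)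
          where
          at-edge : toℕ (lo e) ≡ i → toℕ (hi e) ≡ j → proj₂ t e ≡ proj₂ t′ e
          at-edge lo≡ hi≡ = trans (sym (wt-var-coefficient e (proj₂ t))) (trans (ℕ.+-cancelˡ-≡ (wt δ (proj₂ t) ℕ.+ wt ρ (proj₂ t)) _ _ equal) (wt-var-coefficient e (proj₂ t′)))
            where
            split : ∀ m → wt δ m ℕ.+ wt ρ m ℕ.+ wt (var e) m ≡ wt (column j) m
            split m = trans (cong (ℕ._+ wt (var e) m) (sym (wt-+ δ ρ m))) (trans (sym (wt-+ (λ f → δ f ℕ.+ ρ f) (var e) m))
              (wt-cong (λ f → δ f ℕ.+ ρ f ℕ.+ var e f) (column j) m m (λ f → cong (ℕ._* m f) (cell f))))
              where
              cell : ∀ f → δ f ℕ.+ ρ f ℕ.+ var e f ≡ column j f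
              cell f = go (processed? i (suc j) f) (processed? i j f)
                where
                go : (d : Dec (Processed i (suc j) f)) (d′ : Dec (Processed i j f)) →
                  (if does d then 0 else column j f) ℕ.+ (if does d′ then column j f else 0) ℕ.+ var e f ≡ column j f
                go (no ¬p) (yes p) = contradiction (processed-mono f p) ¬p
                go (yes _) (yes p) = trans (cong (column j f ℕ.+_) (var-≢ e f λ { refl → Sum.[ (λ lt → ℕ.<-irrefl lo≡ lt) , (λ { (_ , lt) → ℕ.<-irrefl hi≡ lt }) ]′ p })) (ℕ.+-identityʳ _)
                go (no ¬p) (no _)  = trans (cong₂ ℕ._+_ (ℕ.+-identityʳ (column j f)) (var-≢ e f λ { refl → ¬p pr })) (ℕ.+-identityʳ _)
                go (yes p) (no ¬p) = Sum.[ (λ old → contradiction old ¬p) , (λ { (lo≡′ , hi≡′) → trans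
                  (trans (cong (var e) (sym (edge-≡ (Fin.toℕ-injective (trans lo≡ (sym lo≡′))) (Fin.toℕ-injective (trans hi≡ (sym hi≡′)))))) (var-refl e))
                  (sym ([]-yes {d = toℕ (hi f) ℕ.≤? j} (ℕ.≤-reflexive hi≡′))) }) ]′ (processed-step f p)

            ρ-equal : wt ρ (proj₂ t) ≡ wt ρ (proj₂ t′)
            ρ-equal = wt-cong ρ ρ (proj₂ t) (proj₂ t′) cell
              where
              cell : ∀ f → ρ f ℕ.* proj₂ t f ≡ ρ f ℕ.* proj₂ t′ f
              cell f = go (processed? i j f)
                where
                go : (d : Dec (Processed i j f)) → (if does d then column j f else 0) ℕ.* proj₂ t f ≡ (if does d then column j f else 0) ℕ.* proj₂ t′ f
                go (yes old) = cong (column j f ℕ.*_) (agree st (Part.part-⊆ P p) (Part.part-⊆ P q) f old)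
                go (no _)    = refl

            equal : wt δ (proj₂ t) ℕ.+ wt ρ (proj₂ t) ℕ.+ wt (var e) (proj₂ t) ≡ wt δ (proj₂ t) ℕ.+ wt ρ (proj₂ t) ℕ.+ wt (var e) (proj₂ t′)
            equal = trans (split (proj₂ t)) (trans (homogeneous st j<n (Part.part-⊆ P p) (Part.part-⊆ P q)) (trans (sym (split (proj₂ t′)))
              (cong (ℕ._+ wt (var e) (proj₂ t′)) (cong₂ ℕ._+_ (part-constant P q p) (sym ρ-equal)))))

      module _ (F : CommutativeRing c ℓ₁) where
        private
          module F = CommutativeRing F
          S = PowerSeries.series F
          module S = CommutativeRing S
          module FF = Frame F
          module FS = Frame S
          open PowerSeries F using (X; const)
          open CommutativeExp S.commutativeSemiring using (_^_; ^-congʳ)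
          open SemiringSolver S.commutativeSemiring using (solve; _:=_; _:+_; _:*_; con)
          open Transfer F S
          κ-hom = const-hom F
          open Hom κ-hom

        -- Row i, scaled by X times the column B, is added to the other rows.
        shear : FF.Column → FF.Column → FS.Column
        shear B D r = const (D r) S.+ X S.* const (D i F.* B r)

        module _ {B : FF.Column} (B-left : ∀ {r} → r ℕ.≤ i → B r F.≈ F.0#) where

          shear-semilinear : Semilinear (shear B)
          shear-semilinear = record
            { ρ = const
            ; H-linear = λ {C} {D} y v eq r → S.trans (S.+-cong (S.trans (⟦⟧-cong (eq r)) (S.trans (⟦⟧-+ _ _) (S.+-congʳ (⟦⟧-* _ _))))
                (S.*-congˡ (S.trans (⟦⟧-cong (F.trans (F.*-congʳ (eq i)) (F.trans (F.distribʳ _ _ _) (F.+-congʳ (F.*-assoc _ _ _))))) (S.trans (⟦⟧-+ _ _) (S.+-congʳ (⟦⟧-* _ _))))))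
                (solve 6 (λ y v d x p q → (y :* v :+ d) :+ x :* (y :* p :+ q) := y :* (v :+ x :* p) :+ (d :+ x :* q)) S.refl (const y) (const (v r)) (const (D r)) X (const (v i F.* B r)) (const (D i F.* B r)))
            ; H-add = λ {C} {D} v eq r → S.trans (S.+-cong (S.trans (⟦⟧-cong (eq r)) (⟦⟧-+ _ _)) (S.*-congˡ (S.trans (⟦⟧-cong (F.trans (F.*-congʳ (eq i)) (F.distribʳ _ _ _))) (⟦⟧-+ _ _))))
                (solve 5 (λ v d x p q → (v :+ d) :+ x :* (p :+ q) := (v :+ x :* p) :+ (d :+ x :* q)) S.refl (const (v r)) (const (D r)) X (const (v i F.* B r)) (const (D i F.* B r)))
            ; H-zero = λ z r → zero-shear (z r) (F.trans (F.*-congʳ (z i)) (F.zeroˡ _))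
            ; H-low = λ {w} {v} low {r} r<w → zero-shear (low r<w) (below low r<w)
            }
            where
            zero-shear : ∀ {x y} → x F.≈ F.0# → y F.≈ F.0# → const x S.+ X S.* const y S.≈ S.0#
            zero-shear p q = S.trans (S.+-cong (S.trans (⟦⟧-cong p) ⟦⟧-0) (S.trans (S.*-congˡ {X} (S.trans (⟦⟧-cong q) ⟦⟧-0)) (S.zeroʳ X))) (S.+-identityˡ S.0#)
            below : ∀ {w v r} → FF.Low w v → r ℕ.< w → v i F.* B r F.≈ F.0#
            below {w} {v} {r} low r<w with i ℕ.<? w
            ... | yes i<w = F.trans (F.*-congʳ (low i<w)) (F.zeroˡ _)
            ... | no i≮w  = F.trans (F.*-congˡ (B-left (ℕ.≤-trans (ℕ.<⇒≤ r<w) (ℕ.≮⇒≥ i≮w)))) (F.zeroʳ _)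

          scaled-semilinear : Semilinear (λ D r → X S.* shear B D r)
          scaled-semilinear = record
            { ρ = ρ
            ; H-linear = λ {C} {D} y v eq r → S.trans (S.*-congˡ (H-linear y v eq r)) (solve 4 (λ x y v d → x :* (y :* v :+ d) := y :* (x :* v) :+ x :* d) S.refl X (ρ y) (shear B v r) (shear B D r))
            ; H-add = λ v eq r → S.trans (S.*-congˡ (H-add v eq r)) (S.distribˡ _ _ _)
            ; H-zero = λ z r → S.trans (S.*-congˡ {X} (H-zero z r)) (S.zeroʳ X)
            ; H-low = λ low r<w → S.trans (S.*-congˡ {X} (H-low low r<w)) (S.zeroʳ X)
            }
            where open Semilinear shear-semilinear

          ν : S.Carrier
          ν = S.- X

          related-pair : ∀ {a b va vb t t′ Cj} → Related shear-semilinear t t′ → (∀ r → Cj r S.≈ shear B (FF.unitColumn i) r) →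
            Related scaled-semilinear ((a , va , B) ∷ (b , vb , FF.unitColumn i) ∷ t)
              ((a , (λ r → ν S.* shear B va r) , FS.unitColumn i) ∷ (b , shear B vb , Cj) ∷ t′)
          related-pair {a} {b} {va} {vb} {t} {t′} {Cj} (good , span) eqj = good′ , span′
            where
            open Semilinear shear-semilinear
            A = FF.unitColumn i

            unit-const : ∀ r → FS.unitColumn i r S.≈ const (A r)
            unit-const r with does (r ℕ.≟ i)
            ... | true  = S.sym ⟦⟧-1
            ... | false = S.sym ⟦⟧-0

            ν-inverse : X S.+ ν S.≈ S.0#
            ν-inverse = S.-‿inverseʳ X

            unit-shear : ∀ r → FS.unitColumn i r S.≈ shear B A r S.+ ν S.* shear B B r
            unit-shear r = S.trans (unit-const r) (S.sym (S.trans (S.+-cong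
                (S.+-congˡ {const (A r)} (S.*-congˡ {X} (⟦⟧-cong (F.trans (F.*-congʳ (FF.unitColumn-≡ i)) (F.*-identityˡ _)))))
                (S.*-congˡ {ν} (S.trans (S.+-congˡ {const (B r)} (S.trans (S.*-congˡ {X} (S.trans (⟦⟧-cong (F.trans (F.*-congʳ (B-left ℕ.≤-refl)) (F.zeroˡ _))) ⟦⟧-0)) (S.zeroʳ X))) (S.+-identityʳ _))))
              (S.trans (solve 4 (λ u x ν b → (u :+ x :* b) :+ ν :* b := u :+ (x :+ ν) :* b) S.refl (const (A r)) X ν (const (B r)))
              (S.trans (S.+-congˡ {const (A r)} (S.trans (S.*-congʳ ν-inverse) (S.zeroˡ _))) (S.+-identityʳ _)))))

            ν-low : ∀ {w v} → FF.Low w v → FS.Low w (λ r → ν S.* shear B v r)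
            ν-low low r<w = S.trans (S.*-congˡ {ν} (H-low low r<w)) (S.zeroʳ ν)

            good′ : FF.Good ((a , va , B) ∷ (b , vb , A) ∷ t) → FS.Good ((a , (λ r → ν S.* shear B va r) , FS.unitColumn i) ∷ (b , shear B vb , Cj) ∷ t′)
            good′ (low-a , (D , eqB , y , D′ , eqD , sp) , low-b , (E , eqA , sp′) , g) =
              ν-low low-a ,
              (_ , (λ r → S.trans (unit-shear r) (S.trans (S.+-cong (H-add vb eqA r) (S.*-congˡ {ν} (S.trans (H-add va eqB r) (S.+-congˡ {shear B va r} (H-linear y vb eqD r)))))
                 (solve 6 (λ ν p q y d e → (q :+ e) :+ ν :* (p :+ (y :* q :+ d)) := ν :* p :+ ((con 1 :+ ν :* y) :* q :+ (con 1 :* e :+ ν :* d))) S.refl ν (shear B va r) (shear B vb r) (ρ y) (shear B D′ r) (shear B E r)))) ,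
               S.1# S.+ ν S.* ρ y , _ , (λ r → S.refl) , FS.span-combine t′ S.1# ν (span sp′) (span sp)) ,
              H-low low-b , (shear B E , (λ r → S.trans (eqj r) (H-add vb eqA r)) , span sp′) , good g

            span′ : ∀ {D} → FF.Span ((a , va , B) ∷ (b , vb , A) ∷ t) D → FS.Span ((a , (λ r → ν S.* shear B va r) , FS.unitColumn i) ∷ (b , shear B vb , Cj) ∷ t′) (λ r → X S.* shear B D r)
            span′ {D} (y , D₁ , eq₁ , z , D₂ , eq₂ , sp) = S.- ρ y , _ ,
              (λ r → S.trans (S.*-congˡ {X} (S.trans (H-linear y va eq₁ r) (S.+-congˡ {ρ y S.* shear B va r} (H-linear z vb eq₂ r))))
                (S.trans (solve 6 (λ x y p z q d → x :* (y :* p :+ (z :* q :+ d)) := (y :* (x :* p)) :+ ((x :* z) :* q :+ (x :* d :+ con 0 :* d))) S.refl X (ρ y) (shear B va r) (ρ z) (shear B vb r) (shear B D₂ r))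
                (S.+-congʳ (S.sym (S.trans (S.*-congˡ {S.- ρ y} (S.sym (RingProperties.-‿distribˡ-* S.ring X (shear B va r))))
                  (S.trans (S.sym (RingProperties.-‿distribˡ-* S.ring _ _)) (S.trans (S.-‿cong (S.sym (RingProperties.-‿distribʳ-* S.ring _ _))) (RingProperties.-‿involutive S.ring _)))))))) ,
              X S.* ρ z , _ , (λ r → S.refl) , FS.span-combine t′ X S.0# (span sp) (span sp)

          module _ (C′ : ℕ → FF.Column) where

            column′ : ℕ → FS.Column
            column′ c₀ with ℕ.<-cmp c₀ j
            ... | tri< _ _ _ = λ r → X S.* shear B (C′ c₀) r
            ... | tri≈ _ _ _ = shear B (FF.unitColumn i)
            ... | tri> _ _ _ = shear B (C′ c₀)

            column′-< : ∀ {c₀} → c₀ ℕ.< j → column′ c₀ ≡ (λ r → X S.* shear B (C′ c₀) r)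
            column′-< {c₀} lt with ℕ.<-cmp c₀ j
            ... | tri< _ _ _ = refl
            ... | tri≈ ¬p _ _ = contradiction lt ¬p
            ... | tri> ¬p _ _ = contradiction lt ¬p

            column′-≡ : column′ j ≡ shear B (FF.unitColumn i)
            column′-≡ with ℕ.<-cmp j j
            ... | tri< _ ¬p _ = contradiction refl ¬p
            ... | tri≈ _ _ _ = refl
            ... | tri> _ ¬p _ = contradiction refl ¬p

            column′-> : ∀ {c₀} → j ℕ.< c₀ → column′ c₀ ≡ shear B (C′ c₀)
            column′-> {c₀} gt with ℕ.<-cmp c₀ j
            ... | tri< _ _ ¬p = contradiction gt ¬p
            ... | tri≈ _ _ ¬p = contradiction gt ¬p
            ... | tri> _ _ _ = refl

        lift-point : ∀ {os κ x xs} → Point F i (suc j) (κ ∷ os) x xs → Point S i j os κ (x ∷ xs)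
        lift-point record { O = [] ; O-letters = () }
        lift-point {os} {κ} {x} {xs} record { C = C′ ; O = (κ , va) ∷ O ; v = vb ; X = Xs ; O-letters = refl ; X-letters = refl ; left = left ; right = right ; good = good } = record
          { C = col
          ; O = mapE scaled O
          ; v = λ r → ν B-left S.* shear (C′ j) va r
          ; X = (x , shear (C′ j) vb) ∷ mapE sheared Xs
          ; O-letters = mapE-letters scaled O
          ; X-letters = cong (x ∷_) (mapE-letters sheared Xs)
          ; left = λ {c₀} {r} i<c₀ c₀<j r≤i → S.trans (S.reflexive (cong (λ D → D r) (column′-< B-left C′ c₀<j)))
              (S.trans (S.*-congˡ {X} (shear-zero (left i<c₀ (ℕ.<-trans c₀<j (ℕ.n<1+n j)) r≤i) r≤i)) (S.zeroʳ X))
          ; right = right′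
          ; good = proj₁ (related-unstack scaled O j (λ lt r → S.reflexive (cong (λ D → D r) (column′-< B-left C′ lt)))
              (related-pair B-left {t′ = FS.triples col (suc j) (mapE sheared Xs)} (related-triples sheared Xs (suc j) (λ le r → S.reflexive (cong (λ D → D r) (column′-> B-left C′ le))))
                (λ r → S.reflexive (cong (λ D → D r) (column′-≡ B-left C′))))) good
          }
          where
          B-left : ∀ {r} → r ℕ.≤ i → C′ j r F.≈ F.0#
          B-left = left i<j (ℕ.n<1+n j)
          sheared = shear-semilinear B-left
          scaled  = scaled-semilinear B-left
          col = column′ B-left C′

          shear-zero : ∀ {D r} → D r F.≈ F.0# → r ℕ.≤ i → shear (C′ j) D r S.≈ S.0#
          shear-zero p le = S.trans (S.+-cong (S.trans (⟦⟧-cong p) ⟦⟧-0) (S.trans (S.*-congˡ {X} (S.trans (⟦⟧-cong (F.trans (F.*-congˡ (B-left le)) (F.zeroʳ _))) ⟦⟧-0)) (S.zeroʳ X))) (S.+-identityˡ S.0#)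

          right′ : ∀ {c₀ r} → j ℕ.≤ c₀ → r ℕ.< i → col c₀ r S.≈ S.0#
          right′ {c₀} {r} le r<i with ℕ.m≤n⇒m<n∨m≡n le
          ... | inj₁ lt   = S.trans (S.reflexive (cong (λ D → D r) (column′-> B-left C′ lt))) (shear-zero {C′ c₀} (right lt r<i) (ℕ.<⇒≤ r<i))
          ... | inj₂ refl = S.trans (S.reflexive (cong (λ D → D r) (column′-≡ B-left C′))) (shear-zero {FF.unitColumn i} (FF.unitColumn-≢ (ℕ.<⇒≢ r<i)) (ℕ.<⇒≤ r<i))

        factor : ∀ {os κ x xs} (P : Point F i (suc j) (κ ∷ os) x xs) → Σ (Edge n → S.Carrier) λ u →
          (∀ e → value S i j (Point.C (lift-point P)) e S.≈ X ^ δ e S.* u e) × (∀ e → u e 0 F.≈ value F i (suc j) (Point.C P) e)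
        factor record { O = [] ; O-letters = () }
        factor {os} {κ} {x} {xs} P@record { C = C′ ; O = (κ , va) ∷ O ; O-letters = refl ; X-letters = refl ; left = left } =
          (λ e → proj₁ (parts e)) , (λ e → proj₁ (proj₂ (parts e))) , (λ e → proj₂ (proj₂ (parts e)))
          where
          B-left : ∀ {r} → r ℕ.≤ i → C′ j r F.≈ F.0#
          B-left = left i<j (ℕ.n<1+n j)
          col = column′ B-left C′
          colP = Point.C (lift-point P)

          X¹ : ∀ e f → X ^ δ e S.≈ X ^ 1 → X S.* f S.≈ X ^ δ e S.* f
          X¹ e f p = S.*-congʳ {f} {X} {X ^ δ e} (S.trans (S.sym (S.*-identityʳ X)) (S.sym p))
          X⁰ : ∀ e f → X ^ δ e S.≈ X ^ 0 → f S.≈ X ^ δ e S.* f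
          X⁰ e f p = S.trans (S.sym (S.*-identityˡ f)) (S.*-congʳ {f} {S.1#} {X ^ δ e} (S.sym p))

          X0 : ∀ x y → x F.+ F.0# F.* y F.≈ x
          X0 x y = F.trans (F.+-congˡ (F.zeroˡ _)) (F.+-identityʳ x)

          parts : ∀ e → Σ S.Carrier λ u → (value S i j colP e S.≈ X ^ δ e S.* u) × (u 0 F.≈ value F i (suc j) C′ e)
          parts e = go (processed? i (suc j) e) (processed? i j e) refl
            where
            d≡ : ∀ {b k} → does (processed? i (suc j) e) ≡ b → (if b then 0 else column j e) ≡ k → X ^ δ e S.≈ X ^ k
            d≡ p q = ^-congʳ X (trans (cong (λ b → if b then 0 else column j e) p) q)

            go : (d : Dec (Processed i (suc j) e)) (d′ : Dec (Processed i j e)) → does (processed? i (suc j) e) ≡ does d →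
              Σ S.Carrier λ u → (value S i j colP e S.≈ X ^ δ e S.* u) × (u 0 F.≈ value F i (suc j) C′ e)
            go (yes p) (yes p′) eq = S.1# , S.trans (S.reflexive (value-processed S {i} {j} {e} colP p′)) (X⁰ e S.1# (d≡ eq refl)) ,
              F.reflexive (sym (value-processed F {i} {suc j} {e} C′ p))
            go (yes p) (no ¬p′) eq = Sum.[ (λ old → contradiction old ¬p′) , (λ { (lo≡ , hi≡) → shear (C′ j) (FF.unitColumn i) i ,
              S.trans (S.reflexive (trans (value-unprocessed S {i} {j} {e} colP ¬p′) (trans (cong₂ colP hi≡ lo≡) (cong (λ D → D i) (column′-≡ B-left C′))))) (X⁰ e (shear (C′ j) (FF.unitColumn i) i) (d≡ eq refl)) ,
              F.trans (X0 _ _) (F.trans (FF.unitColumn-≡ i) (F.reflexive (sym (value-processed F {i} {suc j} {e} C′ p)))) }) ]′ (processed-step e p)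
            go (no ¬p) (yes p′) eq = contradiction (processed-mono e p′) ¬p
            go (no ¬p) (no ¬p′) eq = compare (ℕ.<-cmp (toℕ (hi e)) j)
              where
              compare : Tri (toℕ (hi e) ℕ.< j) (toℕ (hi e) ≡ j) (toℕ (hi e) ℕ.> j) → Σ S.Carrier λ u → (value S i j colP e S.≈ X ^ δ e S.* u) × (u 0 F.≈ value F i (suc j) C′ e)
              compare (tri< hi<j _ _) = shear (C′ j) (C′ (toℕ (hi e))) (toℕ (lo e)) ,
                S.trans (S.reflexive (trans (value-unprocessed S {i} {j} {e} colP ¬p′) (cong (λ D → D (toℕ (lo e))) (column′-< B-left C′ hi<j))))
                  (X¹ e (shear (C′ j) (C′ (toℕ (hi e))) (toℕ (lo e))) (d≡ eq ([]-yes {d = toℕ (hi e) ℕ.≤? j} (ℕ.<⇒≤ hi<j)))) ,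
                F.trans (X0 _ _) (F.reflexive (sym (value-unprocessed F {i} {suc j} {e} C′ ¬p)))
              compare (tri> _ _ hi>j) = shear (C′ j) (C′ (toℕ (hi e))) (toℕ (lo e)) ,
                S.trans (S.reflexive (trans (value-unprocessed S {i} {j} {e} colP ¬p′) (cong (λ D → D (toℕ (lo e))) (column′-> B-left C′ hi>j))))
                  (X⁰ e (shear (C′ j) (C′ (toℕ (hi e))) (toℕ (lo e))) (d≡ eq ([]-no {d = toℕ (hi e) ℕ.≤? j} (ℕ.<⇒≱ hi>j)))) ,
                F.trans (X0 _ _) (F.reflexive (sym (value-unprocessed F {i} {suc j} {e} C′ ¬p)))
              compare (tri≈ _ hi≡j _) = const (C′ j (toℕ (lo e))) ,
                S.trans (S.reflexive (trans (value-unprocessed S {i} {j} {e} colP ¬p′) (trans (cong (λ c₀ → colP c₀ (toℕ (lo e))) hi≡j) (cong (λ D → D (toℕ (lo e))) (column′-≡ B-left C′)))))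
                  (S.trans (S.trans (S.+-cong (S.trans (⟦⟧-cong (FF.unitColumn-≢ lo≢i)) ⟦⟧-0) (S.*-congˡ {X} (⟦⟧-cong (F.trans (F.*-congʳ (FF.unitColumn-≡ i)) (F.*-identityˡ _))))) (S.+-identityˡ _))
                  (X¹ e (const (C′ j (toℕ (lo e)))) (d≡ eq ([]-yes {d = toℕ (hi e) ℕ.≤? j} (ℕ.≤-reflexive hi≡j))))) ,
                F.reflexive (trans (cong (λ c₀ → C′ c₀ (toℕ (lo e))) (sym hi≡j)) (sym (value-unprocessed F {i} {suc j} {e} C′ ¬p)))
                where
                lo≢i : toℕ (lo e) ≢ i
                lo≢i lo≡ = ¬p (inj₂ (lo≡ , s≤s (ℕ.≤-reflexive hi≡j)))

      vanishes : ∀ {os κ x xs g} (P : Part δ g) → Vanishes i j os κ (x ∷ xs) g → Vanishes i (suc j) (κ ∷ os) x xs (Part.part P)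
      vanishes {g = g} P z F ι pt with u , eq , eq₀ ← factor F pt =
        CommutativeRing.trans F (eval-point F ι (λ e → CommutativeRing.sym F (eq₀ e)) (Part.part P))
          (extract F ι P u (CommutativeRing.trans S (eval-point S (const-hom F ∘-hom ι) (λ e → CommutativeRing.sym S (eq e)) g) (z S (const-hom F ∘-hom ι) (lift-point F pt))))
        where S = PowerSeries.series F

module Independence {c ℓ₁ ℓ₂} (K : HeytingField c ℓ₁ ℓ₂) (n : ℕ) where
  open Evaluation K n
  open Leading K n
  open Degeneration K n

  eval-point∈ : ∀ {a b} (F : CommutativeRing a b) ι {u v} g → (∀ {t} → t ∈ˡ g → ∀ e → proj₂ t e ≡ 0 ⊎ CommutativeRing._≈_ F (u e) (v e)) →
    CommutativeRing._≈_ F (eval F ι u g) (eval F ι v g)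
  eval-point∈ F ι g eq = Big.fold-cong∈ F.+-commutativeMonoid g (λ {t} t∈ → F.*-congˡ (MonomialValue.mon-cong F n {m = proj₂ t} (λ _ → refl) (eq t∈)))
    where module F = CommutativeRing F

  module _ (s : ℕ → ℕ → Bool) where

    module Swap {i j} (i<j : i ℕ.< j) (j<n : j ℕ.< n) (s-off : s i j ≡ false) where

      state : ∀ {g} → State s i j g → State s i (suc j) g
      state st = record
        { nonempty = nonempty ; nonzero = nonzero ; distinct = distinct ; supported = supported ; homogeneous = homogeneous
        ; agree = λ {t} {t′} p q e → λ
          { (inj₁ r) → agree p q e (inj₁ r)
          ; (inj₂ (lo≡ , hi<)) → case ℕ.m≤n⇒m<n∨m≡n (ℕ.s≤s⁻¹ hi<) of λ
            { (inj₁ hi<j) → agree p q e (inj₂ (lo≡ , hi<j))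
            ; (inj₂ hi≡) → trans (supported p e (off e lo≡ hi≡)) (sym (supported q e (off e lo≡ hi≡))) } }
        }
        where
        open State st
        off : ∀ (e : Edge n) → toℕ (lo e) ≡ i → toℕ (hi e) ≡ j → s (toℕ (lo e)) (toℕ (hi e)) ≡ false
        off e p q = trans (cong₂ s p q) s-off

      module _ (F : CommutativeRing c ℓ₁) where
        open CommutativeRing F hiding (zero) renaming (refl to ≈-refl; sym to ≈-sym; trans to ≈-trans)
        open Frame F
        open Transfer F F
        open SemiringSolver commutativeSemiring using (solve; _:=_; _:+_; _:*_; con)

        identity-semilinear : Semilinear id
        identity-semilinear = record { ρ = id ; H-linear = λ _ _ eq → eq ; H-add = λ _ eq → eq ; H-zero = id ; H-low = id }

        unstack-good : ∀ C j O t → Good (unstack C j O t) → Good t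
        unstack-good C zero    []      t g = g
        unstack-good C (suc j) []      t g = g
        unstack-good C zero    (_ ∷ O) t g = g
        unstack-good C (suc j) (_ ∷ O) t g = proj₂ (proj₂ (unstack-good C j O _ g))

        shift : (ℕ → Column) → Carrier → ℕ → Column
        shift C y c₀ with c₀ ℕ.≟ j
        ... | yes _ = λ r → C j r + (- y) * unitColumn i r
        ... | no _  = C c₀

        shift-≡ : ∀ C y → shift C y j ≡ (λ r → C j r + (- y) * unitColumn i r)
        shift-≡ C y with j ℕ.≟ j
        ... | yes _ = refl
        ... | no ¬p = contradiction refl ¬p

        shift-≢ : ∀ C y {c₀} → c₀ ≢ j → shift C y c₀ ≡ C c₀
        shift-≢ C y {c₀} ≢ with c₀ ℕ.≟ j
        ... | yes p = contradiction p ≢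
        ... | no _  = refl

        lift-point : ∀ {os κ x xs} (P : Point F i (suc j) (x ∷ os) κ xs) → Σ (Point F i j os κ (x ∷ xs)) λ P′ → ∃[ y ] Point.C P′ ≡ shift (Point.C P) y
        lift-point record { O = [] ; O-letters = () }
        lift-point {os} {κ} {x} {xs} record { C = C ; O = (x , va) ∷ O ; v = vb ; X = Xs ; O-letters = refl ; X-letters = refl ; left = left ; right = right ; good = good }
          with unstack-good C j O _ good
        ... | low-a , (D , eqB , y , D′ , eqD , sp) , low-b , (E , eqA , sp′) , g = record
          { C = C′
          ; O = mapE identity-semilinear O
          ; v = vb
          ; X = (x , va) ∷ mapE identity-semilinear Xs
          ; O-letters = mapE-letters identity-semilinear O
          ; X-letters = cong (x ∷_) (mapE-letters identity-semilinear Xs)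
          ; left = λ {c₀} {r} i<c₀ c₀<j r≤i → ≈-trans (reflexive (cong (λ D → D r) (shift-≢ C y (ℕ.<⇒≢ c₀<j)))) (left i<c₀ (ℕ.<-trans c₀<j (ℕ.n<1+n j)) r≤i)
          ; right = right′
          ; good = proj₁ (related-unstack identity-semilinear O j (λ lt r → reflexive (cong (λ D → D r) (shift-≢ C y (ℕ.<⇒≢ lt)))) related) good
          } , y , refl
          where
          C′ = shift C y
          A = unitColumn i

          right′ : ∀ {c₀ r} → j ℕ.≤ c₀ → r ℕ.< i → C′ c₀ r ≈ 0#
          right′ {c₀} {r} le r<i with ℕ.m≤n⇒m<n∨m≡n le
          ... | inj₁ lt   = ≈-trans (reflexive (cong (λ D → D r) (shift-≢ C y (ℕ.>⇒≢ lt)))) (right lt r<i)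
          ... | inj₂ refl = ≈-trans (reflexive (cong (λ D → D r) (shift-≡ C y)))
            (≈-trans (+-cong (left i<j (ℕ.n<1+n j) (ℕ.<⇒≤ r<i)) (≈-trans (*-congˡ (unitColumn-≢ (ℕ.<⇒≢ r<i))) (zeroʳ _))) (+-identityˡ 0#))

          T′ = triples C′ (suc j) (mapE identity-semilinear Xs)
          tail = related-triples identity-semilinear {C} {C′} Xs (suc j) (λ le r → reflexive (cong (λ D → D r) (shift-≢ C y (ℕ.>⇒≢ le))))

          related : Related identity-semilinear ((x , va , C j) ∷ (κ , vb , A) ∷ triples C (suc j) Xs) ((κ , vb , A) ∷ (x , va , C′ j) ∷ T′)
          related = (λ _ →
              low-b , (E , eqA , 0# , E , (λ r → ≈-sym (≈-trans (+-congʳ (zeroˡ _)) (+-identityˡ _))) , proj₂ tail sp′) ,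
              low-a , (_ , (λ r → ≈-trans (reflexive (cong (λ D → D r) (shift-≡ C y))) (≈-trans (+-cong (≈-trans (eqB r) (+-congˡ (eqD r))) (*-congˡ (eqA r)))
                (≈-trans (solve 6 (λ v y w d e z → (v :+ (y :* w :+ d)) :+ z :* (w :+ e) := (v :+ (con 1 :* d :+ z :* e)) :+ (y :+ z) :* w) ≈-refl (va r) y (vb r) (D′ r) (E r) (- y))
                  (≈-trans (+-congˡ (≈-trans (*-congʳ (-‿inverseʳ y)) (zeroˡ _))) (+-identityʳ _))))) ,
                span-combine T′ 1# (- y) (proj₂ tail sp) (proj₂ tail sp′)) , proj₁ tail g) ,
            λ { (p , D₁ , eq₁ , q , D₂ , eq₂ , sp₂) → q , (λ r → p * va r + D₂ r) ,
              (λ r → ≈-trans (eq₁ r) (≈-trans (+-congˡ (eq₂ r)) (SemigroupProperties.x∙yz≈y∙xz +-commutativeSemigroup _ _ _))) , p , D₂ , (λ _ → ≈-refl) , proj₂ tail sp₂ }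

      vanishes : ∀ {os κ x xs g} → State s i j g → Vanishes i j os κ (x ∷ xs) g → Vanishes i (suc j) (x ∷ os) κ xs g
      vanishes {g = g} st z F ι P with P′ , y , refl ← lift-point F P =
        ≈-trans (eval-point∈ F ι g (λ {t} t∈ e → agreement t∈ e (processed? i j e) (processed? i (suc j) e))) (z F ι P′)
        where
        open CommutativeRing F using (_≈_; reflexive; +-congˡ; +-identityʳ; *-congˡ; zeroʳ) renaming (sym to ≈-sym; trans to ≈-trans)
        C = Point.C P

        agreement : ∀ {t} → t ∈ˡ g → ∀ e → Dec (Processed i j e) → Dec (Processed i (suc j) e) → proj₂ t e ≡ 0 ⊎ value F i (suc j) C e ≈ value F i j (shift F C y) e
        agreement t∈ e (yes p) (yes p′) = inj₂ (reflexive (trans (value-processed F {i} {suc j} {e} C p′) (sym (value-processed F {i} {j} {e} (shift F C y) p))))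
        agreement t∈ e (yes p) (no ¬p′) = contradiction (Stay.processed-mono s i<j j<n e p) ¬p′
        agreement t∈ e (no ¬p) (yes p′) = Sum.[ (λ old → contradiction old ¬p) , (λ { (lo≡ , hi≡) → inj₁ (State.supported st t∈ e (trans (cong₂ s lo≡ hi≡) s-off)) }) ]′ (Stay.processed-step s i<j j<n e p′)
        agreement t∈ e (no ¬p) (no ¬p′) = inj₂ (≈-trans (reflexive (value-unprocessed F {i} {suc j} {e} C ¬p′)) (≈-trans same (reflexive (sym (value-unprocessed F {i} {j} {e} (shift F C y) ¬p)))))
          where
          same : C (toℕ (hi e)) (toℕ (lo e)) ≈ shift F C y (toℕ (hi e)) (toℕ (lo e))
          same = go (toℕ (hi e) ℕ.≟ j)
            where
            go : Dec (toℕ (hi e) ≡ j) → C (toℕ (hi e)) (toℕ (lo e)) ≈ shift F C y (toℕ (hi e)) (toℕ (lo e))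
            go (no ≢)    = reflexive (sym (cong (λ D → D (toℕ (lo e))) (shift-≢ F C y ≢)))
            go (yes hi≡) = ≈-sym (≈-trans (reflexive (trans (cong (λ c₀ → shift F C y c₀ (toℕ (lo e))) hi≡) (cong (λ D → D (toℕ (lo e))) (shift-≡ F C y))))
              (≈-trans (+-congˡ (≈-trans (*-congˡ (Frame.unitColumn-≢ F (λ lo≡ → ¬p′ (inj₂ (lo≡ , s≤s (ℕ.≤-reflexive hi≡)))))) (zeroʳ _)))
              (≈-trans (+-identityʳ _) (reflexive (cong (λ c₀ → C c₀ (toℕ (lo e))) (sym hi≡))))))

    next-row-state : ∀ {i g} → State s i n g → State s (suc i) (suc (suc i)) g
    next-row-state {i} st = record
      { nonempty = nonempty ; nonzero = nonzero ; distinct = distinct ; supported = supported ; homogeneous = homogeneous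
      ; agree = λ {t} {t′} p q e → λ
        { (inj₁ lo≤) → case ℕ.m≤n⇒m<n∨m≡n (ℕ.s≤s⁻¹ lo≤) of λ
          { (inj₁ lo<) → agree p q e (inj₁ lo<)
          ; (inj₂ lo≡) → agree p q e (inj₂ (lo≡ , Fin.toℕ<n (hi e))) }
        ; (inj₂ (lo≡ , hi<)) → contradiction (ℕ.≤-trans (s≤s (lo<hi e)) hi<) (λ lt → ℕ.<-irrefl refl (ℕ.≤-trans (s≤s (ℕ.≤-trans (ℕ.≤-reflexive (cong suc (sym lo≡))) ℕ.≤-refl)) lt)) }
      }
      where open State st

    next-row-vanishes : ∀ {i κ xs g} → suc (suc i) ℕ.+ length xs ≡ n → Vanishes i n ((κ ∷ xs) ʳ++ []) i [] g → Vanishes (suc i) (suc (suc i)) [] κ xs g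
    next-row-vanishes {i} {κ} {xs} {g} size z F ι P@record { C = C ; O = [] ; v = v ; X = Xs ; X-letters = refl ; right = right ; good = good } =
      ≈-trans (eval-point F ι agreement g) (z F ι P′)
      where
      open CommutativeRing F using (_≈_; 0#; reflexive) renaming (trans to ≈-trans)
      open Frame F

      C′ : ℕ → Column
      C′ c₀ = if does (c₀ ℕ.≟ suc i) then unitColumn (suc i) else C c₀

      C′-≡ : C′ (suc i) ≡ unitColumn (suc i)
      C′-≡ = cong (λ b → if b then unitColumn (suc i) else C (suc i)) (dec-true (suc i ℕ.≟ suc i) refl)

      C′-> : ∀ {c₀} → suc (suc i) ℕ.≤ c₀ → C′ c₀ ≡ C c₀
      C′-> {c₀} le = cong (λ b → if b then unitColumn (suc i) else C c₀) (dec-false (c₀ ℕ.≟ suc i) (ℕ.>⇒≢ le))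

      L : List (ℕ × Column)
      L = (κ , v) ∷ Xs

      good-L : Good (triples C′ (suc i) L)
      good-L = move good
        where
        transport : ∀ L j → suc (suc i) ℕ.≤ j → (Good (triples C j L) → Good (triples C′ j L)) × (∀ {D} → Span (triples C j L) D → Span (triples C′ j L) D)
        transport []            j le = id , id
        transport ((w , v) ∷ L) j le = let good , span = transport L (suc j) (ℕ.m≤n⇒m≤1+n le) in
          (λ { (low , (D , p , s) , g) → low , (D , (λ r → ≈-trans (reflexive (cong (λ D → D r) (C′-> le))) (p r)) , span s) , good g }) ,
          (λ { (y , D , p , s) → y , D , p , span s })
        move : Good ((κ , v , unitColumn (suc i)) ∷ triples C (suc (suc i)) Xs) → Good (triples C′ (suc i) L)
        move (low , (D , eq , sp) , g) = low , (D , (λ r → ≈-trans (reflexive (cong (λ D → D r) C′-≡)) (eq r)) , proj₂ (transport Xs (suc (suc i)) ℕ.≤-refl) sp) , proj₁ (transport Xs (suc (suc i)) ℕ.≤-refl) g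

      letters : ∀ (A B : List (ℕ × Column)) → map proj₁ (A ʳ++ B) ≡ map proj₁ A ʳ++ map proj₁ B
      letters []      B = refl
      letters (a ∷ A) B = letters A (a ∷ B)

      P′ : Point F i n ((κ ∷ map proj₁ Xs) ʳ++ []) i []
      P′ = record
        { C = C′ ; O = L ʳ++ [] ; v = unitColumn i ; X = [] ; O-letters = letters L [] ; X-letters = refl
        ; left = left′
        ; right = λ {c₀} {r} le r<i → right′ le (ℕ.m≤n⇒m≤1+n r<i)
        ; good = subst Good (sym (trans (cong (λ m → unstack C′ m (L ʳ++ []) ((i , unitColumn i , unitColumn i) ∷ [])) (sym size′)) (unstack-triples C′ (suc i) L [] _))) (good-append (triples C′ (suc i) L) good-L)
        }
        where
        size′ : suc i ℕ.+ length L ≡ n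
        size′ = trans (ℕ.+-suc (suc i) (length Xs)) (trans (cong (suc (suc i) ℕ.+_) (sym (List.length-map proj₁ Xs))) size)
        right′ : ∀ {c₀ r} → n ℕ.≤ c₀ → r ℕ.< suc i → C′ c₀ r ≈ 0#
        right′ {c₀} {r} le r< = ≈-trans (reflexive (cong (λ D → D r) (C′-> le′))) (right le′ r<)
          where le′ = ℕ.≤-trans (ℕ.≤-trans (ℕ.m≤m+n (suc (suc i)) (length (map proj₁ Xs))) (ℕ.≤-reflexive size)) le
        left′ : ∀ {c₀ r} → i ℕ.< c₀ → c₀ ℕ.< n → r ℕ.≤ i → C′ c₀ r ≈ 0#
        left′ {c₀} {r} i<c₀ _ r≤i with ℕ.m≤n⇒m<n∨m≡n i<c₀
        ... | inj₁ lt   = ≈-trans (reflexive (cong (λ D → D r) (C′-> lt))) (right lt (s≤s r≤i))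
        ... | inj₂ refl = ≈-trans (reflexive (cong (λ D → D r) C′-≡)) (unitColumn-≢ (ℕ.<⇒≢ (s≤s r≤i)))

      agreement : ∀ e → value F (suc i) (suc (suc i)) C e ≈ value F i n C′ e
      agreement e = go (toℕ (lo e) ℕ.≤? i)
        where
        go : Dec (toℕ (lo e) ℕ.≤ i) → value F (suc i) (suc (suc i)) C e ≈ value F i n C′ e
        go (yes le) = reflexive (trans (value-processed F {suc i} {suc (suc i)} {e} C (inj₁ (s≤s le))) (sym (value-processed F {i} {n} {e} C′ (old (ℕ.m≤n⇒m<n∨m≡n le)))))
          where
          old : toℕ (lo e) ℕ.< i ⊎ toℕ (lo e) ≡ i → Processed i n e
          old = Sum.map₂ (_, Fin.toℕ<n (hi e))
        go (no ≰) = reflexive (trans (value-unprocessed F {suc i} {suc (suc i)} {e} C λ { (inj₁ (s≤s le)) → ≰ le ; (inj₂ (lo≡ , hi<)) → ℕ.<-irrefl refl (ℕ.≤-trans hi< far) })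
          (sym (trans (value-unprocessed F {i} {n} {e} C′ λ { (inj₁ lt) → ≰ (ℕ.<⇒≤ lt) ; (inj₂ (lo≡ , _)) → ≰ (ℕ.≤-reflexive lo≡) }) (cong (λ D → D (toℕ (lo e))) (C′-> far)))))
          where
          far : suc (suc i) ℕ.≤ toℕ (hi e)
          far = ℕ.≤-trans (s≤s (ℕ.≰⇒> ≰)) (lo<hi e)

    open Network s

    sweep-vanishes : ∀ {i j κ xs out κ′ t} → Sweep i j κ xs out κ′ t → i ℕ.< j → j ℕ.+ length xs ≡ n → ∀ {os g} → State s i j g → Vanishes i j os κ xs g →
      ∃[ g′ ] State s i n g′ × Vanishes i n (out ʳ++ os) κ′ [] g′
    sweep-vanishes {i} {j} done i<j size st z with refl ← trans (sym (ℕ.+-identityʳ j)) size = _ , st , z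
    sweep-vanishes {i} {j} {xs = _ ∷ xs} (stay _ w) i<j size {g = g} st z = sweep-vanishes w (ℕ.<-trans i<j (ℕ.n<1+n j)) size′ {g = Part.part P} (Stay.state s i<j j<n st P) (Stay.vanishes s i<j j<n {g = g} P z)
      where
      size′ = trans (sym (ℕ.+-suc j (length xs))) size
      j<n = ℕ.≤-trans (ℕ.m≤m+n (suc j) (length xs)) (ℕ.≤-reflexive size′)
      P = leading (Stay.δ s i<j j<n) (State.nonempty st)
    sweep-vanishes {i} {j} {xs = _ ∷ xs} (swap s-off _ w) i<j size {g = g} st z = sweep-vanishes w (ℕ.<-trans i<j (ℕ.n<1+n j)) size′ {g = g} (Swap.state i<j j<n s-off st) (Swap.vanishes i<j j<n s-off {g = g} st z)
      where
      size′ = trans (sym (ℕ.+-suc j (length xs))) size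
      j<n = ℕ.≤-trans (ℕ.m≤m+n (suc j) (length xs)) (ℕ.≤-reflexive size′)

    -- At the end all monomials agree, so g is a single nonzero term, whose value is its coefficient.
    final : ∀ {i g} → suc i ≡ n → State s i n g → Vanishes i n [] i [] g → ⊥
    final {i} {g} refl st z = single g nonzero distinct nonempty agree eval-zero′
      where
      open State st
      open MonomialValue KR n

      P : Point KR i n [] i []
      P = record
        { C = λ _ _ → K.0# ; O = [] ; v = unitColumn i ; X = [] ; O-letters = refl ; X-letters = refl
        ; left = λ _ _ _ → K.refl ; right = λ _ _ → K.refl ; good = good-append [] _ }
        where open Frame KR

      processed : ∀ e → Processed i n e
      processed e = Sum.map₂ (_, Fin.toℕ<n (hi e)) (ℕ.m≤n⇒m<n∨m≡n (ℕ.s≤s⁻¹ (Fin.toℕ<n (lo e))))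

      eval-zero′ : eval KR (id-hom KR) (λ _ → K.1#) g K.≈ K.0#
      eval-zero′ = K.trans (eval-point KR (id-hom KR) (λ e → K.reflexive (sym (value-processed KR {i} {n} {e} (λ _ _ → K.0#) (processed e)))) g) (z KR (id-hom KR) P)

      single : ∀ g → NonZero g → Distinct g → g ≢ [] → (∀ {t t′} → t ∈ˡ g → t′ ∈ˡ g → ∀ e → Processed i n e → proj₂ t e ≡ proj₂ t′ e) →
        eval KR (id-hom KR) (λ _ → K.1#) g K.≈ K.0# → ⊥
      single []                 _       _             ne _  _ = ne refl
      single ((a , m) ∷ [])     (p ∷ _) _             _  _  z = p (K.trans (K.sym (K.trans (K.+-identityʳ _) (K.trans (K.*-congˡ (all-ones m)) (K.*-identityʳ a)))) z)
        where
        all-ones : ∀ m → mon (λ _ → K.1#) m K.≈ K.1#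
        all-ones m = Big.fold-ε (CommutativeRing.*-commutativeMonoid KR) (allEdges n) (λ {e} _ → 1^ (m e))
      single (t ∷ t′ ∷ g)       _       ((d ∷ _) ∷ _) _  ag _ = d (≗⇒≐ λ e → ag (here refl) (there (here refl)) e (processed e))

    runs-vanishes : ∀ {i κ xs t} → Runs i (κ ∷ xs) t → suc i ℕ.+ length xs ≡ n → ∀ {g} → State s i (suc i) g → Vanishes i (suc i) [] κ xs g → ⊥
    runs-vanishes {i} {xs = xs} (row {out = out} w _ r) size {g} st z = finish r (trans (cong (suc i ℕ.+_) (sweep-length w)) size) (sweep-vanishes w (ℕ.n<1+n i) size {g = g} st z)
      where
      finish : ∀ {out t} → Runs (suc i) out t → suc i ℕ.+ length out ≡ n → ∃[ g′ ] State s i n g′ × Vanishes i n (out ʳ++ []) i [] g′ → ⊥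
      finish end size (g , st , z) = final {g = g} (trans (sym (ℕ.+-identityʳ (suc i))) size) st z
      finish {κ ∷ out} r size (g , st , z) = runs-vanishes r size′ {g} (next-row-state st) (next-row-vanishes {κ = κ} {g = g} size′ z)
        where size′ = trans (sym (ℕ.+-suc (suc i) (length out))) size

module InitialState {c ℓ₁ ℓ₂} (K : HeytingField c ℓ₁ ℓ₂) (n k : ℕ) (0<k : 0 ℕ.< k) (2k≤n : k ℕ.+ k ℕ.≤ n) where
  open Evaluation K n
  open Leading K n
  open Degeneration K n

  letter-late : ∀ {j q} → j ℕ.+ suc (q ℕ.+ k) ≡ n → j ℕ.≤ letter n k j
  letter-late {j} {q} eq with letter-cases n k j
  ... | inj₁ (j<k , l)          = subst (j ℕ.≤_) (sym l) (ℕ.m+n≤o⇒m≤o∸n j (ℕ.≤-trans (ℕ.+-mono-≤ (ℕ.<⇒≤ j<k) j<k) 2k≤n))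
  ... | inj₂ (inj₁ (n∸k≤j , _)) = contradiction (ℕ.≤-trans (s≤s (ℕ.m≤m+n j q)) (ℕ.≤-trans (ℕ.≤-reflexive (sym n∸k)) n∸k≤j)) (ℕ.<-irrefl refl)
    where
    n∸k : n ℕ.∸ k ≡ suc (j ℕ.+ q)
    n∸k = trans (cong (ℕ._∸ k) (trans (sym eq) (trans (ℕ.+-suc j (q ℕ.+ k)) (cong suc (sym (ℕ.+-assoc j q k)))))) (ℕ.m+n∸n≡m (suc (j ℕ.+ q)) k)
  ... | inj₂ (inj₂ (_ , _ , l)) = ℕ.≤-reflexive (sym l)

  letters-length : ∀ {a} {A : Set a} {j m} (X : List (ℕ × A)) → map proj₁ X ≡ word n k j m → length X ≡ m
  letters-length {j = j} {m} X eq = trans (sym (List.length-map proj₁ X)) (trans (cong length eq) (word-length n k j m))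

  module _ (F : CommutativeRing c ℓ₁) where
    open CommutativeRing F hiding (zero) renaming (refl to ≈-refl; sym to ≈-sym; trans to ≈-trans)
    open Frame F

    comb : List (ℕ × Column) → (ℕ → Carrier) → ℕ → Carrier
    comb []            y r = 0#
    comb ((_ , v) ∷ Z) y r = y 0 * v r + comb Z (y ∘ suc) r

    prepend : Carrier → (ℕ → Carrier) → ℕ → Carrier
    prepend x y zero    = x
    prepend x y (suc p) = y p

    span⇒comb : ∀ {C j D} Z → Span (triples C j Z) D → ∃[ y ] (∀ r → D r ≈ comb Z y r)
    span⇒comb []            (lift z) = (λ _ → 0#) , z
    span⇒comb ((_ , v) ∷ Z) (y , D , eq , sp) with ys , eqs ← span⇒comb Z sp = prepend y ys , λ r → ≈-trans (eq r) (+-congˡ (eqs r))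

    good⇒comb : ∀ {C j} Z → Good (triples C j Z) → ∀ {c₀} → j ℕ.≤ c₀ → c₀ ℕ.< j ℕ.+ length Z → ∃[ y ] (∀ r → C c₀ r ≈ comb Z y r)
    good⇒comb {j = j} [] g le lt = contradiction (ℕ.≤-trans lt (ℕ.≤-trans (ℕ.≤-reflexive (ℕ.+-identityʳ j)) le)) (ℕ.<-irrefl refl)
    good⇒comb {j = j} ((_ , v) ∷ Z) (_ , (D , eq , sp) , g) le lt with ℕ.m≤n⇒m<n∨m≡n le
    ... | inj₂ refl with ys , eqs ← span⇒comb Z sp = prepend 1# ys , λ r → ≈-trans (eq r) (+-cong (≈-sym (*-identityˡ _)) (eqs r))
    ... | inj₁ j<c with ys , eqs ← good⇒comb Z g j<c (ℕ.≤-trans lt (ℕ.≤-reflexive (ℕ.+-suc j (length Z)))) =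
      prepend 0# ys , λ r → ≈-trans (eqs r) (≈-sym (≈-trans (+-congʳ (zeroˡ _)) (+-identityˡ _)))

    -- The vectors of the first q entries vanish in the rows above j, so only the last k contribute.
    span-last : ∀ q {C j D} X → map proj₁ X ≡ word n k j (q ℕ.+ k) → j ℕ.+ (q ℕ.+ k) ≡ n → Good (triples C j X) → Span (triples C j X) D →
      ∃[ y ] (∀ {r} → r ℕ.< j → D r ≈ comb (drop q X) y r)
    span-last zero X _ _ g sp with ys , eqs ← span⇒comb X sp = ys , λ {r} _ → eqs r
    span-last (suc q) {j = j} ((_ , v) ∷ X) eq size (low , _ , g) (y , D , eqD , sp)
      with refl , eq′ ← List.∷-injective eq with ys , eqs ← span-last q X eq′ (trans (sym (ℕ.+-suc j _)) size) g sp =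
      ys , λ {r} r<j → ≈-trans (eqD r) (≈-trans (+-cong (≈-trans (*-congˡ (low (ℕ.<-≤-trans r<j (letter-late {j} {q} size)))) (zeroʳ _)) (eqs (ℕ.<-trans r<j (ℕ.n<1+n j)))) (+-identityˡ _))

    column-last : ∀ q {C j} X → map proj₁ X ≡ word n k j (q ℕ.+ k) → j ℕ.+ (q ℕ.+ k) ≡ n → Good (triples C j X) → ∀ {c₀} → j ℕ.≤ c₀ → c₀ ℕ.< n →
      ∃[ y ] (∀ {r} → r ℕ.< c₀ → C c₀ r ≈ comb (drop q X) y r)
    column-last zero {j = j} X eq size g le lt with ys , eqs ← good⇒comb X g le (ℕ.≤-trans lt (ℕ.≤-reflexive (trans (sym size) (cong (j ℕ.+_) (sym (letters-length X eq)))))) = ys , λ {r} _ → eqs r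
    column-last (suc q) {j = j} ((_ , v) ∷ X) eq size (low , (D , eqC , sp) , g) le lt
      with refl , eq′ ← List.∷-injective eq with ℕ.m≤n⇒m<n∨m≡n le
    ... | inj₁ j<c = column-last q X eq′ (trans (sym (ℕ.+-suc j _)) size) g j<c lt
    ... | inj₂ refl with ys , eqs ← span-last q X eq′ (trans (sym (ℕ.+-suc j _)) size) g sp =
      ys , λ {r} r<j → ≈-trans (eqC r) (≈-trans (+-cong (low (ℕ.<-≤-trans r<j (letter-late {j} {q} size))) (eqs (ℕ.<-trans r<j (ℕ.n<1+n j)))) (+-identityˡ _))

    factors : List (ℕ × Column) → (ℕ → ℕ → Carrier) → List (Exterior.Vector F n × Exterior.Vector F n)
    factors []            Y = []
    factors ((_ , v) ∷ Z) Y = ((λ r → v (toℕ r)) , (λ c₀ → Y (toℕ c₀) 0)) ∷ factors Z (λ c₀ → Y c₀ ∘ suc)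

    factors-length : ∀ Z Y → length (factors Z Y) ≡ length Z
    factors-length []      Y = refl
    factors-length (_ ∷ Z) Y = cong suc (factors-length Z _)

    factors-product : ∀ Z Y e → product F (factors Z Y) e ≈ comb Z (Y (toℕ (hi e))) (toℕ (lo e))
    factors-product []            Y e = ≈-refl
    factors-product ((_ , v) ∷ Z) Y e = +-cong (*-comm _ _) (factors-product Z _ e)

  initial-vanishes : ∀ {m g} → n ≡ suc m → ProductZero k g → Vanishes 0 1 [] (letter n k 0) (word n k 1 m) g
  initial-vanishes {m} {g} refl z F ι record { C = C ; O = [] ; X = X ; X-letters = letters ; good = _ , _ , good } =
    ≈-trans (eval-point F ι agreement g) (z F ι L (trans (factors-length F Z Y) size))
    where
    open CommutativeRing F using (_≈_; 0#; reflexive) renaming (sym to ≈-sym; trans to ≈-trans)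
    q = m ℕ.∸ k

    k≤m : k ℕ.≤ m
    k≤m = ℕ.s≤s⁻¹ (ℕ.≤-trans (ℕ.+-monoˡ-≤ k 0<k) 2k≤n)

    m≡ : q ℕ.+ k ≡ m
    m≡ = ℕ.m∸n+n≡m k≤m

    letters′ : map proj₁ X ≡ word n k 1 (q ℕ.+ k)
    letters′ = trans letters (cong (word n k 1) (sym m≡))

    Z = drop q X

    size : length Z ≡ k
    size = trans (List.length-drop q X) (trans (cong (ℕ._∸ q) (letters-length X letters′)) (ℕ.m+n∸m≡n q k))

    coefficients : ∀ c₀ → ∃[ y ] (1 ℕ.≤ c₀ → c₀ ℕ.< n → ∀ {r} → r ℕ.< c₀ → C c₀ r ≈ comb F Z y r)
    coefficients c₀ with 1 ℕ.≤? c₀ | c₀ ℕ.<? n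
    ... | no ¬p | _     = (λ _ → 0#) , λ p → contradiction p ¬p
    ... | yes _ | no ¬q = (λ _ → 0#) , λ _ q → contradiction q ¬q
    ... | yes p | yes lt with y , eq ← column-last F q X letters′ (cong suc m≡) good p lt = y , λ _ _ → eq

    Y = λ c₀ → proj₁ (coefficients c₀)
    L = factors F Z Y

    agreement : ∀ e → value F 0 1 C e ≈ product F L e
    agreement e = ≈-trans (reflexive (value-unprocessed F {0} {1} {e} C λ { (inj₁ ()) ; (inj₂ (_ , lt)) → contradiction (ℕ.≤-trans (s≤s (ℕ.≤-trans (s≤s z≤n) (lo<hi e))) lt) (ℕ.<-irrefl refl) }))
      (≈-trans (proj₂ (coefficients (toℕ (hi e))) (ℕ.≤-trans (s≤s z≤n) (lo<hi e)) (Fin.toℕ<n (hi e)) (lo<hi e)) (≈-sym (factors-product F Z Y e)))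

  independent : ∀ {σ : Edge n → Bool} {t} → Network.Runs (pair σ) 0 (word n k 0 n) t → ∀ {g} → g ≢ [] → Distinct g → NonZero g →
    (∀ {t} → t ∈ˡ g → ∀ e → σ e ≡ false → proj₂ t e ≡ 0) → SkewZero k g → ⊥
  independent {σ} runs {g} ne dis nz supp z with g′ , r , z′ , hom ← homogeneous-product {k} {g} ne z = start n refl runs
    where
    open Refined r
    start : ∀ {t} m → m ≡ n → Network.Runs (pair σ) 0 (word n k 0 m) t → ⊥
    start zero    eq runs = contradiction (ℕ.≤-trans 0<k (ℕ.≤-trans (ℕ.m≤m+n k k) 2k≤n)) λ lt → ℕ.<-irrefl eq lt
    start (suc m) eq runs = Independence.runs-vanishes K n (pair σ) runs (trans (cong suc (word-length n k 1 m)) eq) {g′}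
      (record
        { nonempty = nonempty ; nonzero = All.tabulate (λ t∈ → All.lookup nz (included t∈)) ; distinct = distinct dis
        ; supported = λ t∈ e off → supp (included t∈) e (trans (sym (pair-edge σ e)) off)
        ; homogeneous = hom
        ; agree = λ { _ _ e (inj₁ ()) ; _ _ e (inj₂ (_ , lt)) → contradiction (ℕ.≤-trans (s≤s (ℕ.≤-trans (s≤s z≤n) (lo<hi e))) lt) (ℕ.<-irrefl refl) } })
      (initial-vanishes {g = g′} (sym eq) z′)

¬¬-decide : ∀ {n} (S : EdgeSet n) → ¬ ¬ (Σ (Edge n → Bool) λ σ → (∀ e → σ e ≡ true → e ∈ S) × (∀ e → e ∈ S → σ e ≡ true))
¬¬-decide {n} S k = ¬¬-all (allEdges n) (λ e → ¬¬-dec (e ∈ S)) λ d → let dec = λ e → All.lookup d (∈-allEdges n e) in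
  k ((λ e → does (dec e)) , (λ e → true⁻ (dec e)) , (λ e → dec-true (dec e)))
  where
  true⁻ : ∀ {a} {A : Set a} (d : Dec A) → does d ≡ true → A
  true⁻ (yes a) _ = a

module _ {c ℓ₁ ℓ₂} (K : HeytingField c ℓ₁ ℓ₂) (n k : ℕ) (0<k : 0 ℕ.< k) (2k≤n : k ℕ.+ k ℕ.≤ n) where
  open Evaluation K n
  open Leading K n

  crossingFree⇒independent : ∀ (S : EdgeSet n) → CrossingFree (suc k) S → Independent K n k S
  crossingFree⇒independent S free (p , p∈I , p≉0 , p⊆S) = ¬¬-decide S λ { (σ , σ⇒S , S⇒σ) →
    normalForm p λ { (g , p≈g , dis , nz) →
      let free-σ : Free k σ
          free-σ = λ { (E , cr , ps) → free (E , cr , All.map (σ⇒S _) ps) }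
          t , runs = free⇒network k 0<k 2k≤n {withShort k σ} (free-withShort {k = k} {σ} free-σ) (withShort-short k σ)
      in InitialState.independent K n k 0<k 2k≤n {withShort k σ} runs {g}
        (λ { refl → p≉0 p≈g }) dis nz
        (λ {t} t∈ e off → case proj₂ t e ℕ.≟ 0 of λ
          { (yes z) → z
          ; (no nz′) → contradiction (withShort-⊇ k σ e (S⇒σ e (p⊆S (proj₂ t ,
              (λ z → All.lookup nz t∈ (K.trans (K.sym (coeff-distinct dis t∈)) (K.trans (K.sym (p≈g (proj₂ t))) z))) , nz′))))
              λ on → contradiction (trans (sym on) off) λ () })
        λ { F ι L refl → CommutativeRing.trans F (CommutativeRing.sym F (eval-cong F ι (Exterior.skew F L) p g p≈g))
              (PfaffianValue.eval-pfaffianIdeal K n F ι L p∈I) } } }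

module _ {a} {A : Set a} where

  ∈-++-middle⁻ : ∀ xs {x y : A} {ys} → y ∈ˡ xs ++ x ∷ ys → y ≢ x → y ∈ˡ xs ++ ys
  ∈-++-middle⁻ []       (here refl) y≢x = contradiction refl y≢x
  ∈-++-middle⁻ []       (there y∈)  y≢x = y∈
  ∈-++-middle⁻ (_ ∷ xs) (here refl) y≢x = here refl
  ∈-++-middle⁻ (_ ∷ xs) (there y∈)  y≢x = there (∈-++-middle⁻ xs y∈ y≢x)

  unique-⊆-length : ∀ {xs ys : List A} → Unique xs → (∀ {x} → x ∈ˡ xs → x ∈ˡ ys) → length xs ℕ.≤ length ys
  unique-⊆-length []      _ = z≤n
  unique-⊆-length {x ∷ xs} (x∉ ∷ u) sub with as , bs , refl ← List.∈-∃++ (sub (here refl)) =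
    ℕ.≤-trans (s≤s (unique-⊆-length u (λ y∈ → ∈-++-middle⁻ as (sub (there y∈)) (λ { refl → All.lookup x∉ y∈ refl }))))
      (ℕ.≤-reflexive (trans (cong suc (List.length-++ as)) (trans (sym (ℕ.+-suc (length as) (length bs))) (sym (List.length-++ as)))))

  unique-AllPairs : ∀ {r} {R : A → A → Set r} {xs} → Unique xs → (∀ {x y} → x ∈ˡ xs → y ∈ˡ xs → x ≢ y → R x y) → AllPairs R xs
  unique-AllPairs []       f = []
  unique-AllPairs (x∉ ∷ u) f = All.tabulate (λ y∈ → f (here refl) (there y∈) (All.lookup x∉ y∈)) ∷ unique-AllPairs u (λ p q → f (there p) (there q))

  AllPairs-∈ : ∀ {r} {R : A → A → Set r} {xs} → (∀ {x y} → R x y → R y x) → AllPairs R xs → ∀ {x y} → x ∈ˡ xs → y ∈ˡ xs → x ≢ y → R x y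
  AllPairs-∈ sy (_ ∷ _)  (here refl) (here refl) x≢y = contradiction refl x≢y
  AllPairs-∈ sy (p ∷ _)  (here refl) (there y∈)  _   = All.lookup p y∈
  AllPairs-∈ sy (p ∷ _)  (there x∈)  (here refl) _   = sy (All.lookup p x∈)
  AllPairs-∈ sy (_ ∷ ps) (there x∈)  (there y∈)  x≢y = AllPairs-∈ sy ps x∈ y∈ x≢y

  sublists-⊆ : ∀ {L E : List A} → E ∈ˡ sublists L → ∀ {x} → x ∈ˡ E → x ∈ˡ L
  sublists-⊆ {[]} (here refl) ()
  sublists-⊆ {y ∷ L} E∈ x∈ with List.∈-++⁻ (map (y ∷_) (sublists L)) E∈
  ... | inj₂ q = there (sublists-⊆ q x∈)
  ... | inj₁ p with E′ , E′∈ , refl ← List.∈-map⁻ (y ∷_) p with x∈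
  ...   | here refl = here refl
  ...   | there r   = there (sublists-⊆ E′∈ r)

  sublists-unique : ∀ {L : List A} → Unique L → Unique (sublists L)
  sublists-unique []       = [] ∷ []
  sublists-unique {y ∷ L} (y∉ ∷ u) = Unique.++⁺ (Unique.map⁺ List.∷-injectiveʳ (sublists-unique u)) (sublists-unique u) disjoint
    where
    disjoint : ∀ {E} → ¬ (E ∈ˡ map (y ∷_) (sublists L) × E ∈ˡ sublists L)
    disjoint (p , q) with _ , _ , refl ← List.∈-map⁻ (y ∷_) p = All.lookup y∉ (sublists-⊆ q (here refl)) refl

  sublists-ext : ∀ {L E E′ : List A} → Unique L → E ∈ˡ sublists L → E′ ∈ˡ sublists L →
    (∀ {x} → x ∈ˡ E → x ∈ˡ E′) → (∀ {x} → x ∈ˡ E′ → x ∈ˡ E) → E ≡ E′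
  sublists-ext []       (here refl) (here refl) _ _ = refl
  sublists-ext {y ∷ L} (y∉ ∷ u) E∈ E′∈ sub sub′ with List.∈-++⁻ (map (y ∷_) (sublists L)) E∈ | List.∈-++⁻ (map (y ∷_) (sublists L)) E′∈
  ... | inj₂ p | inj₂ q = sublists-ext u p q sub sub′
  ... | inj₁ p | inj₂ q with _ , _ , refl ← List.∈-map⁻ (y ∷_) p = contradiction refl (All.lookup y∉ (sublists-⊆ q (sub (here refl))))
  ... | inj₂ p | inj₁ q with _ , _ , refl ← List.∈-map⁻ (y ∷_) q = contradiction refl (All.lookup y∉ (sublists-⊆ p (sub′ (here refl))))
  ... | inj₁ p | inj₁ q with E₁ , E₁∈ , refl ← List.∈-map⁻ (y ∷_) p | E₂ , E₂∈ , refl ← List.∈-map⁻ (y ∷_) q =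
    cong (y ∷_) (sublists-ext u E₁∈ E₂∈ (strip E₁∈ sub) (strip E₂∈ sub′))
    where
    strip : ∀ {E E′ : List A} → E ∈ˡ sublists L → (∀ {x} → x ∈ˡ y ∷ E → x ∈ˡ y ∷ E′) → ∀ {x} → x ∈ˡ E → x ∈ˡ E′
    strip E∈ sub x∈ with sub (there x∈)
    ... | here refl = contradiction refl (All.lookup y∉ (sublists-⊆ E∈ x∈))
    ... | there r   = r

  filter-sublist : ∀ {p} {P : Pred A p} (P? : ∀ x → Dec (P x)) L → filter P? L ∈ˡ sublists L
  filter-sublist P? []      = here refl
  filter-sublist P? (x ∷ L) with does (P? x)
  ... | true  = List.∈-++⁺ˡ (List.∈-map⁺ (x ∷_) (filter-sublist P? L))
  ... | false = List.∈-++⁺ʳ (map (x ∷_) (sublists L)) (filter-sublist P? L)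

-- Mutually crossing perfect matchings

fold-≤ : ∀ {a} {A : Set a} {f g : A → ℕ} xs → (∀ x → f x ℕ.≤ g x) → ℕ-Sum.fold f xs ℕ.≤ ℕ-Sum.fold g xs
fold-≤ []       le = z≤n
fold-≤ (x ∷ xs) le = ℕ.+-mono-≤ (le x) (fold-≤ xs le)

fold-< : ∀ {a} {A : Set a} {f g : A → ℕ} {xs x} → (∀ x → f x ℕ.≤ g x) → x ∈ˡ xs → f x ℕ.< g x → ℕ-Sum.fold f xs ℕ.< ℕ-Sum.fold g xs
fold-< {xs = _ ∷ xs} le (here refl) lt = ℕ.+-mono-<-≤ lt (fold-≤ xs le)
fold-< {xs = y ∷ _}  le (there x∈)  lt = ℕ.+-mono-≤-< (le y) (fold-< le x∈ lt)

fold-positive : ∀ {a} {A : Set a} {f : A → ℕ} {xs x} → x ∈ˡ xs → 1 ℕ.≤ f x → 1 ℕ.≤ ℕ-Sum.fold f xs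
fold-positive (here refl) le = ℕ.≤-trans le (ℕ.m≤m+n _ _)
fold-positive (there x∈)  le = ℕ.≤-trans (fold-positive x∈ le) (ℕ.m≤n+m _ _)

positive-∈ : ∀ {a} {A : Set a} {f : A → ℕ} xs → 1 ℕ.≤ ℕ-Sum.fold f xs → ∃[ x ] x ∈ˡ xs × 1 ℕ.≤ f x
positive-∈ {f = f} (x ∷ xs) le with 1 ℕ.≤? f x
... | yes p = x , here refl , p
... | no ¬p with y , y∈ , q ← positive-∈ xs (subst (λ z → 1 ℕ.≤ z ℕ.+ ℕ-Sum.fold f xs) (ℕ.n<1⇒n≡0 (ℕ.≰⇒> ¬p)) le) = y , there y∈ , q

module _ {n : ℕ} where

  Cross-sym : ∀ {e f : Edge n} → Cross e f → Cross f e
  Cross-sym = Sum.swap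

  Cross-disjoint : ∀ {e f : Edge n} → Cross e f → ∀ {v} → Incident v e → ¬ Incident v f
  Cross-disjoint {e} (inj₁ (p , q , r)) (inj₁ refl) (inj₁ eq) = Fin.<⇒≢ p eq
  Cross-disjoint {e} (inj₁ (p , q , r)) (inj₁ refl) (inj₂ eq) = Fin.<⇒≢ (Fin.<-trans (lo<hi e) r) eq
  Cross-disjoint {e} (inj₁ (p , q , r)) (inj₂ refl) (inj₁ eq) = Fin.<⇒≢ q (sym eq)
  Cross-disjoint {e} (inj₁ (p , q , r)) (inj₂ refl) (inj₂ eq) = Fin.<⇒≢ r eq
  Cross-disjoint {e} (inj₂ (p , q , r)) (inj₁ refl) (inj₁ eq) = Fin.<⇒≢ p (sym eq)
  Cross-disjoint {e} (inj₂ (p , q , r)) (inj₁ refl) (inj₂ eq) = Fin.<⇒≢ q eq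
  Cross-disjoint {e} (inj₂ (p , q , r)) (inj₂ refl) (inj₁ eq) = Fin.<⇒≢ (Fin.<-trans p (lo<hi e)) (sym eq)
  Cross-disjoint {e} (inj₂ (p , q , r)) (inj₂ refl) (inj₂ eq) = Fin.<⇒≢ r (sym eq)

  Cross-≢ : ∀ {e f : Edge n} → Cross e f → e ≢ f
  Cross-≢ {e} c refl = Cross-disjoint {e} {e} c (inj₁ refl) (inj₁ refl)

  inside? : ∀ (f : Edge n) (v : Fin n) → Dec (lo f Fin.≤ v × v Fin.≤ hi f)
  inside? f v = lo f Fin.≤? v ×-dec v Fin.≤? hi f

  inn : Edge n → Fin n → Bool
  inn f v = does (inside? f v)

  separates both neither : Edge n → Edge n → ℕ
  separates f e = if inn f (lo e) then (if inn f (hi e) then 0 else 1) else (if inn f (hi e) then 1 else 0)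
  both f e = if inn f (lo e) then (if inn f (hi e) then 1 else 0) else 0
  neither f e = if inn f (lo e) then 0 else (if inn f (hi e) then 0 else 1)

  -- The sum of these weights over a perfect matching is largest when its edges are mutually crossing.
  crossingWeight : Edge n → ℕ
  crossingWeight e = ℕ-Sum.fold (λ f → separates f e) (allEdges n)

  separates-both : ∀ f e → bit (inn f (lo e)) ℕ.+ bit (inn f (hi e)) ≡ separates f e ℕ.+ 2 ℕ.* both f e
  separates-both f e with inn f (lo e) | inn f (hi e)
  ... | true  | true  = refl
  ... | true  | false = refl
  ... | false | true  = refl
  ... | false | false = refl

  separates-neither : ∀ f e → bit (not (inn f (lo e))) ℕ.+ bit (not (inn f (hi e))) ≡ separates f e ℕ.+ 2 ℕ.* neither f e
  separates-neither f e with inn f (lo e) | inn f (hi e)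
  ... | true  | true  = refl
  ... | true  | false = refl
  ... | false | true  = refl
  ... | false | false = refl

  both⁻ : ∀ {f e} → 1 ℕ.≤ both f e → (lo f Fin.≤ lo e) × (hi e Fin.≤ hi f)
  both⁻ {f} {e} le = go (inside? f (lo e)) (inside? f (hi e)) le
    where
    go : (d : Dec (lo f Fin.≤ lo e × lo e Fin.≤ hi f)) (d′ : Dec (lo f Fin.≤ hi e × hi e Fin.≤ hi f)) →
      1 ℕ.≤ (if does d then (if does d′ then 1 else 0) else 0) → (lo f Fin.≤ lo e) × (hi e Fin.≤ hi f)
    go (yes (p , _)) (yes (_ , q)) _ = p , q
    go (yes _) (no _) ()
    go (no _) _ ()

  both⁺ : ∀ {f e} → lo f Fin.≤ lo e → hi e Fin.≤ hi f → 1 ℕ.≤ both f e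
  both⁺ {f} {e} p q = ℕ.≤-reflexive (sym (cong₂ (λ b c → if b then (if c then 1 else 0) else 0)
    (dec-true (inside? f (lo e)) (p , ℕ.≤-trans (ℕ.<⇒≤ (lo<hi e)) q)) (dec-true (inside? f (hi e)) (ℕ.≤-trans p (ℕ.<⇒≤ (lo<hi e)) , q))))

  Outside : Edge n → Fin n → Set
  Outside f v = ¬ (lo f Fin.≤ v × v Fin.≤ hi f)

  neither⁻ : ∀ {f e} → 1 ℕ.≤ neither f e → Outside f (lo e) × Outside f (hi e)
  neither⁻ {f} {e} le = go (inside? f (lo e)) (inside? f (hi e)) le
    where
    go : (d : Dec (lo f Fin.≤ lo e × lo e Fin.≤ hi f)) (d′ : Dec (lo f Fin.≤ hi e × hi e Fin.≤ hi f)) →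
      1 ℕ.≤ (if does d then 0 else (if does d′ then 0 else 1)) → Outside f (lo e) × Outside f (hi e)
    go (yes _) _ ()
    go (no _) (yes _) ()
    go (no p) (no q) _ = p , q

  neither⁺ : ∀ {f e} → Outside f (lo e) → Outside f (hi e) → 1 ℕ.≤ neither f e
  neither⁺ {f} {e} p q = ℕ.≤-reflexive (sym (cong₂ (λ b c → if b then 0 else (if c then 0 else 1)) (dec-false (inside? f (lo e)) p) (dec-false (inside? f (hi e)) q)))

  both-neither-¬cross : ∀ {f e g : Edge n} → 1 ℕ.≤ both f e → 1 ℕ.≤ neither f g → ¬ Cross e g
  both-neither-¬cross {f} {e} {g} b c cr with both⁻ {f} {e} b | neither⁻ {f} {g} c | cr
  ... | p , q | out , _ | inj₁ (r , s , _) = out (ℕ.≤-trans p (ℕ.<⇒≤ r) , ℕ.≤-trans (ℕ.<⇒≤ s) q)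
  ... | p , q | _ , out | inj₂ (_ , r , s) = out (ℕ.≤-trans p (ℕ.<⇒≤ r) , ℕ.≤-trans (ℕ.<⇒≤ s) q)

  ¬cross-outside : ∀ {e f : Edge n} → ¬ Cross e f → (∀ {v} → Incident v e → ¬ Incident v f) →
    (Outside e (lo f) × Outside e (hi f)) ⊎ (Outside f (lo e) × Outside f (hi e))
  ¬cross-outside {e} {f} ¬c dis with Fin.<-cmp (lo e) (lo f)
  ... | tri≈ _ p _ = contradiction (inj₁ p) (dis (inj₁ refl))
  ... | tri< le<lf _ _ with Fin.<-cmp (hi e) (lo f)
  ...   | tri≈ _ p _ = contradiction (inj₁ p) (dis (inj₂ refl))
  ...   | tri< he<lf _ _ = inj₁ ((λ { (_ , q) → ℕ.<⇒≱ he<lf q }) , λ { (_ , q) → ℕ.<⇒≱ (Fin.<-trans he<lf (lo<hi f)) q })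
  ...   | tri> _ _ lf<he with Fin.<-cmp (hi e) (hi f)
  ...     | tri≈ _ p _ = contradiction (inj₂ p) (dis (inj₂ refl))
  ...     | tri< he<hf _ _ = contradiction (inj₁ (le<lf , lf<he , he<hf)) ¬c
  ...     | tri> _ _ hf<he = inj₂ ((λ { (p , _) → ℕ.<⇒≱ le<lf p }) , λ { (_ , q) → ℕ.<⇒≱ hf<he q })
  ¬cross-outside {e} {f} ¬c dis | tri> _ _ lf<le with Fin.<-cmp (hi f) (lo e)
  ...   | tri≈ _ p _ = contradiction (inj₂ (sym p)) (dis (inj₁ refl))
  ...   | tri< hf<le _ _ = inj₂ ((λ { (_ , q) → ℕ.<⇒≱ hf<le q }) , λ { (_ , q) → ℕ.<⇒≱ (Fin.<-trans hf<le (lo<hi e)) q })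
  ...   | tri> _ _ le<hf with Fin.<-cmp (hi f) (hi e)
  ...     | tri≈ _ p _ = contradiction (inj₂ (sym p)) (dis (inj₂ refl))
  ...     | tri< hf<he _ _ = contradiction (inj₂ (lf<le , le<hf , hf<he)) ¬c
  ...     | tri> _ _ he<hf = inj₁ ((λ { (p , _) → ℕ.<⇒≱ lf<le p }) , λ { (_ , q) → ℕ.<⇒≱ he<hf q })

  covers-sum : ∀ {U} {E Q : List (Edge n)} → Covers U E → Covers U Q → ∀ (g : Fin n → ℕ) → ℕ-Sum.fold (λ e → g (lo e) ℕ.+ g (hi e)) E ≡ ℕ-Sum.fold (λ e → g (lo e) ℕ.+ g (hi e)) Q
  covers-sum {U} {E} {Q} cE cQ g = trans (sym (degree-sum g E)) (trans (∑ᶠ-cong (λ v → cong (g v ℕ.*_) (trans (cE v) (sym (cQ v))))) (degree-sum g Q))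

  sum-split : ∀ (x : Edge n → ℕ) (s d : Edge n → ℕ) → (∀ e → x e ≡ s e ℕ.+ 2 ℕ.* d e) → ∀ E → ℕ-Sum.fold x E ≡ ℕ-Sum.fold s E ℕ.+ 2 ℕ.* ℕ-Sum.fold d E
  sum-split x s d eq []      = refl
  sum-split x s d eq (e ∷ E) = trans (cong₂ ℕ._+_ (eq e) (sum-split x s d eq E)) (rearrange (s e) (d e) (ℕ-Sum.fold s E) (ℕ-Sum.fold d E))
    where
    open +-*-Solver
    rearrange : ∀ a b c d → (a ℕ.+ 2 ℕ.* b) ℕ.+ (c ℕ.+ 2 ℕ.* d) ≡ (a ℕ.+ c) ℕ.+ 2 ℕ.* (b ℕ.+ d)
    rearrange = solve 4 (λ a b c d → (a :+ con 2 :* b) :+ (c :+ con 2 :* d) := (a :+ c) :+ con 2 :* (b :+ d)) refl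

  module _ {U : Subset n} {E Q : List (Edge n)} (cE : Covers U E) (cQ : Covers U Q) where

    private
      ∑ : (Edge n → ℕ) → List (Edge n) → ℕ
      ∑ = ℕ-Sum.fold

    balance-both : ∀ f → ∑ (separates f) E ℕ.+ 2 ℕ.* ∑ (both f) E ≡ ∑ (separates f) Q ℕ.+ 2 ℕ.* ∑ (both f) Q
    balance-both f = trans (sym (sum-split _ _ _ (separates-both f) E)) (trans (covers-sum {U} {E} {Q} cE cQ (bit ∘ inn f)) (sum-split _ _ _ (separates-both f) Q))

    balance-neither : ∀ f → ∑ (separates f) E ℕ.+ 2 ℕ.* ∑ (neither f) E ≡ ∑ (separates f) Q ℕ.+ 2 ℕ.* ∑ (neither f) Q
    balance-neither f = trans (sym (sum-split _ _ _ (separates-neither f) E)) (trans (covers-sum {U} {E} {Q} cE cQ (λ v → bit (not (inn f v)))) (sum-split _ _ _ (separates-neither f) Q))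

    covers-length : length E ≡ length Q
    covers-length = ℕ.*-cancelʳ-≡ (length E) (length Q) 2 (trans (sym (twice E)) (trans (covers-sum {U} {E} {Q} cE cQ (λ _ → 1)) (twice Q)))
      where
      twice : ∀ E → ∑ (λ _ → 2) E ≡ length E ℕ.* 2
      twice []      = refl
      twice (_ ∷ E) = cong (2 ℕ.+_) (twice E)

    module _ (crosses : ∀ {e f} → e ∈ˡ Q → f ∈ˡ Q → e ≢ f → Cross e f) where

      one-side : ∀ f → ∑ (both f) Q ≡ 0 ⊎ ∑ (neither f) Q ≡ 0
      one-side f with 1 ℕ.≤? ∑ (both f) Q | 1 ℕ.≤? ∑ (neither f) Q
      ... | no p  | _     = inj₁ (ℕ.n<1⇒n≡0 (ℕ.≰⇒> p))
      ... | yes _ | no q  = inj₂ (ℕ.n<1⇒n≡0 (ℕ.≰⇒> q))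
      ... | yes p | yes q with e , e∈ , be ← positive-∈ Q p | g , g∈ , ng ← positive-∈ Q q with e ≟ᵉ g
      ...   | no e≢g   = contradiction (crosses e∈ g∈ e≢g) (both-neither-¬cross {f} {e} {g} be ng)
      ...   | yes refl = contradiction (proj₁ (both⁻ {f} {e} be) , ℕ.≤-trans (ℕ.<⇒≤ (lo<hi e)) (proj₂ (both⁻ {f} {e} be))) (proj₁ (neither⁻ {f} {e} ng))

      separates-≤ : ∀ f → ∑ (separates f) E ℕ.≤ ∑ (separates f) Q
      separates-≤ f with one-side f
      ... | inj₁ z = ℕ.≤-trans (ℕ.m≤m+n _ _) (ℕ.≤-reflexive (trans (balance-both f) (trans (cong (λ z → ∑ (separates f) Q ℕ.+ 2 ℕ.* z) z) (ℕ.+-identityʳ _))))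
      ... | inj₂ z = ℕ.≤-trans (ℕ.m≤m+n _ _) (ℕ.≤-reflexive (trans (balance-neither f) (trans (cong (λ z → ∑ (separates f) Q ℕ.+ 2 ℕ.* z) z) (ℕ.+-identityʳ _))))

      separates-< : ∀ f → 1 ℕ.≤ ∑ (both f) E → 1 ℕ.≤ ∑ (neither f) E → ∑ (separates f) E ℕ.< ∑ (separates f) Q
      separates-< f p q with one-side f
      ... | inj₁ z = strict p (trans (balance-both f) (trans (cong (λ z → ∑ (separates f) Q ℕ.+ 2 ℕ.* z) z) (ℕ.+-identityʳ _)))
        where
        strict : ∀ {a b c} → 1 ℕ.≤ b → a ℕ.+ 2 ℕ.* b ≡ c → a ℕ.< c
        strict {a} {b} le refl = ℕ.≤-trans (ℕ.≤-reflexive (ℕ.+-comm 1 a)) (ℕ.+-monoʳ-≤ a (ℕ.≤-trans le (ℕ.m≤m+n b _)))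
      ... | inj₂ z = strict q (trans (balance-neither f) (trans (cong (λ z → ∑ (separates f) Q ℕ.+ 2 ℕ.* z) z) (ℕ.+-identityʳ _)))
        where
        strict : ∀ {a b c} → 1 ℕ.≤ b → a ℕ.+ 2 ℕ.* b ≡ c → a ℕ.< c
        strict {a} {b} le refl = ℕ.≤-trans (ℕ.≤-reflexive (ℕ.+-comm 1 a)) (ℕ.+-monoʳ-≤ a (ℕ.≤-trans le (ℕ.m≤m+n b _)))

      weight-< : ∀ {e g} → e ∈ˡ E → g ∈ˡ E → ¬ Cross e g → (∀ {v} → Incident v e → ¬ Incident v g) → ∑ crossingWeight E ℕ.< ∑ crossingWeight Q
      weight-< {e} {g} e∈ g∈ ¬c dis = subst₂ ℕ._<_ (ℕ-Sum.fold-swap (λ f e → separates f e) (allEdges n) E) (ℕ-Sum.fold-swap (λ f e → separates f e) (allEdges n) Q) strict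
        where
        strict : ∑ (λ f → ∑ (separates f) E) (allEdges n) ℕ.< ∑ (λ f → ∑ (separates f) Q) (allEdges n)
        strict with ¬cross-outside {e} {g} ¬c dis
        ... | inj₁ (p , q) = fold-< separates-≤ (∈-allEdges n e) (separates-< e (fold-positive e∈ (both⁺ {e} {e} ℕ.≤-refl ℕ.≤-refl)) (fold-positive g∈ (neither⁺ {e} {g} p q)))
        ... | inj₂ (p , q) = fold-< separates-≤ (∈-allEdges n g) (separates-< g (fold-positive g∈ (both⁺ {g} {g} ℕ.≤-refl ℕ.≤-refl)) (fold-positive e∈ (neither⁺ {g} {e} p q)))

  -- A mutually crossing matching has the edge e itself inside e and no edge outside e;
  -- by the balance of endpoints so has every other matching of the same vertices.
  contains-inner : ∀ {U} {E Q : List (Edge n)} → Covers U E → Covers U Q → (∀ {e f} → e ∈ˡ E → f ∈ˡ E → e ≢ f → Cross e f) →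
    ∀ {e} → e ∈ˡ E → ∃[ g ] g ∈ˡ Q × lo e Fin.≤ lo g × hi g Fin.≤ hi e
  contains-inner {U} {E} {Q} cE cQ crosses {e} e∈ with positive-∈ Q inner
    where
    none : ℕ-Sum.fold (neither e) E ≡ 0
    none with one-side {U} {E} {E} cE cE crosses e
    ... | inj₁ z = contradiction (fold-positive e∈ (both⁺ {e} {e} ℕ.≤-refl ℕ.≤-refl)) (λ p → contradiction (ℕ.≤-trans p (ℕ.≤-reflexive z)) λ ())
    ... | inj₂ z = z
    inner : 1 ℕ.≤ ℕ-Sum.fold (both e) Q
    inner = compare (ℕ-Sum.fold (separates e) E) (ℕ-Sum.fold (separates e) Q) (ℕ-Sum.fold (neither e) Q)
      (trans (sym (ℕ.+-identityʳ _)) (trans (cong (λ z → ℕ-Sum.fold (separates e) E ℕ.+ 2 ℕ.* z) (sym none)) (balance-neither {U} {E} {Q} cE cQ e)))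
      (balance-both {U} {E} {Q} cE cQ e) (fold-positive e∈ (both⁺ {e} {e} ℕ.≤-refl ℕ.≤-refl))
      where
      compare : ∀ a c d {b b′} → a ≡ c ℕ.+ 2 ℕ.* d → a ℕ.+ 2 ℕ.* b ≡ c ℕ.+ 2 ℕ.* b′ → 1 ℕ.≤ b → 1 ℕ.≤ b′
      compare a c d {b} {b′} refl eq le with 1 ℕ.≤? b′
      ... | yes p = p
      ... | no ¬p with refl ← ℕ.n<1⇒n≡0 (ℕ.≰⇒> ¬p) = contradiction (ℕ.≤-trans le (ℕ.≤-trans (ℕ.m≤m+n b _) (ℕ.≤-reflexive zero-b))) λ ()
        where
        zero-b : 2 ℕ.* b ≡ 0
        zero-b = ℕ.m+n≡0⇒n≡0 (2 ℕ.* d) (ℕ.+-cancelˡ-≡ c _ 0 (trans (sym (ℕ.+-assoc c (2 ℕ.* d) (2 ℕ.* b))) eq))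
  ... | g , g∈ , p with q , r ← both⁻ {e} {g} p = g , g∈ , q , r

  crossing-⊆ : ∀ {U} {E Q : List (Edge n)} → Covers U E → Covers U Q → (∀ {e f} → e ∈ˡ E → f ∈ˡ E → e ≢ f → Cross e f) →
    (∀ {e f} → e ∈ˡ Q → f ∈ˡ Q → e ≢ f → Cross e f) → ∀ {e} → e ∈ˡ E → e ∈ˡ Q
  crossing-⊆ {U} {E} {Q} cE cQ crE crQ {e} e∈ with g , g∈ , p , q ← contains-inner {U} {E} {Q} cE cQ crE e∈
    with e′ , e′∈ , p′ , q′ ← contains-inner {U} {Q} {E} cQ cE crQ g∈ with e ≟ᵉ e′
  ... | yes refl = subst (_∈ˡ Q) (edge-≡ (Fin.≤-antisym p′ p) (Fin.≤-antisym q q′)) g∈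
  ... | no e≢e′ with crE e∈ e′∈ e≢e′
  ...   | inj₁ (_ , _ , r) = contradiction (ℕ.≤-trans q′ q) (ℕ.<⇒≱ r)
  ...   | inj₂ (r , _ , _) = contradiction (ℕ.≤-trans p p′) (ℕ.<⇒≱ r)

  ¬AllPairs⇒pair : ∀ (E : List (Edge n)) → ¬ AllPairs Cross E → ∃[ e ] ∃[ F ] ∃[ g ] ∃[ D ] E ≡ D ++ e ∷ F × g ∈ˡ F × ¬ Cross e g
  ¬AllPairs⇒pair [] ¬a = contradiction [] ¬a
  ¬AllPairs⇒pair (e ∷ E) ¬a with All.all? (cross? e) E
  ... | no ¬c with g , g∈ , c ← List.find (All.¬All⇒Any¬ (cross? e) E ¬c) = e , E , g , [] , refl , g∈ , c
  ... | yes c with e′ , F , g , D , eq , g∈ , c′ ← ¬AllPairs⇒pair E (λ a → ¬a (c ∷ a)) = e′ , F , g , e ∷ D , cong (e ∷_) eq , g∈ , c′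

  degree-++ : ∀ v (D F : List (Edge n)) → degree v (D ++ F) ≡ degree v D ℕ.+ degree v F
  degree-++ v []      F = refl
  degree-++ v (d ∷ D) F = trans (degree-∷ v d (D ++ F)) (trans (cong ([ v Fin.≟ lo d ] ℕ.+ [ v Fin.≟ hi d ] ℕ.+_) (degree-++ v D F))
    (trans (sym (ℕ.+-assoc ([ v Fin.≟ lo d ] ℕ.+ [ v Fin.≟ hi d ]) (degree v D) (degree v F))) (cong (ℕ._+ degree v F) (sym (degree-∷ v d D)))))

  covers-disjoint : ∀ {U D e F g} → Covers U (D ++ e ∷ F) → g ∈ˡ F → ∀ {v} → Incident v e → ¬ Incident v g
  covers-disjoint {U} {D} {e} {F} {g} c g∈ {v} i i′ = contradiction
    (ℕ.≤-trans (ℕ.+-mono-≤ (one-end (v Fin.≟ lo e) (v Fin.≟ hi e) i) (degree-pos g∈ i′)) (ℕ.≤-trans (ℕ.≤-reflexive (sym (degree-∷ v e F)))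
      (ℕ.≤-trans (ℕ.m≤n+m _ (degree v D)) (ℕ.≤-trans (ℕ.≤-reflexive (sym (degree-++ v D (e ∷ F)))) (ℕ.≤-trans (ℕ.≤-reflexive (c v)) (bit≤1 (Vec.lookup U v))))))) λ { (s≤s ()) }
    where
    one-end : (d : Dec (v ≡ lo e)) (d′ : Dec (v ≡ hi e)) → Incident v e → 1 ℕ.≤ [ d ] ℕ.+ [ d′ ]
    one-end (yes _) _       _        = s≤s z≤n
    one-end (no _)  (yes _) _        = s≤s z≤n
    one-end (no p)  (no _)  (inj₁ q) = contradiction q p
    one-end (no _)  (no p)  (inj₂ q) = contradiction q p
    bit≤1 : ∀ b → bit b ℕ.≤ 1
    bit≤1 true  = ℕ.≤-refl
    bit≤1 false = z≤n

  matching-weight-< : ∀ {U} {E Q : List (Edge n)} → E ∈ˡ sublists (allEdges n) → Q ∈ˡ sublists (allEdges n) → Covers U E → Covers U Q →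
    AllPairs Cross Q → E ≢ Q → ℕ-Sum.fold crossingWeight E ℕ.< ℕ-Sum.fold crossingWeight Q
  matching-weight-< {U} {E} {Q} E∈ Q∈ cE cQ crQ E≢Q with AllPairs.allPairs? cross? E
  ... | yes crE = contradiction (sublists-ext (allEdges-unique n) E∈ Q∈ (crossing-⊆ {U} {E} {Q} cE cQ (AllPairs-∈ (λ {x} {y} → Cross-sym {x} {y}) crE) (AllPairs-∈ (λ {x} {y} → Cross-sym {x} {y}) crQ))
    (crossing-⊆ {U} {Q} {E} cQ cE (AllPairs-∈ (λ {x} {y} → Cross-sym {x} {y}) crQ) (AllPairs-∈ (λ {x} {y} → Cross-sym {x} {y}) crE))) E≢Q
  ... | no ¬crE with e , F , g , D , refl , g∈ , ¬c ← ¬AllPairs⇒pair E ¬crE =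
    weight-< {U} {E} {Q} cE cQ (AllPairs-∈ (λ {x} {y} → Cross-sym {x} {y}) crQ) (List.∈-++⁺ʳ D (here refl)) (List.∈-++⁺ʳ D (there g∈)) ¬c (covers-disjoint {U} {D} {e} {F} {g} cE g∈)

  crossing-degree : ∀ v (Q : List (Edge n)) → AllPairs Cross Q → degree v Q ≡ 0 ⊎ degree v Q ≡ 1
  crossing-degree v []      _        = inj₁ refl
  crossing-degree v (e ∷ Q) (c ∷ cs) = go (incident? v e)
    where
    go : Dec (Incident v e) → degree v (e ∷ Q) ≡ 0 ⊎ degree v (e ∷ Q) ≡ 1
    go (no ¬i) = Sum.map (trans (cong length (List.filter-reject (incident? v) ¬i))) (trans (cong length (List.filter-reject (incident? v) ¬i))) (crossing-degree v Q cs)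
    go (yes i) = inj₂ (trans (cong length (List.filter-accept (incident? v) i))
      (cong (suc ∘ length) (List.filter-none (incident? v) (All.map (λ {f} x → Cross-disjoint {e} {f} x i) c))))

  vertices : List (Edge n) → Subset n
  vertices Q = Vec.tabulate λ v → does (degree v Q ℕ.≟ 1)

  vertices-covers : ∀ Q → AllPairs Cross Q → Covers (vertices Q) Q
  vertices-covers Q cs v = trans (go (crossing-degree v Q cs)) (cong bit (sym (lookup∘tabulate (λ v → does (degree v Q ℕ.≟ 1)) v)))
    where
    go : degree v Q ≡ 0 ⊎ degree v Q ≡ 1 → degree v Q ≡ bit (does (degree v Q ℕ.≟ 1))
    go (inj₁ eq) rewrite eq = refl
    go (inj₂ eq) rewrite eq = refl

  size-∑ : ∀ {m} (U : Subset m) → ∣ U ∣ ≡ ∑ᶠ (λ v → bit (Vec.lookup U v))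
  size-∑ []          = refl
  size-∑ (true ∷ U)  = cong suc (size-∑ U)
  size-∑ (false ∷ U) = size-∑ U

  vertices-size : ∀ Q → AllPairs Cross Q → ∣ vertices Q ∣ ≡ 2 ℕ.* length Q
  vertices-size Q cs = trans (size-∑ (vertices Q)) (trans (∑ᶠ-cong (λ v → trans (sym (vertices-covers Q cs v)) (sym (ℕ.+-identityʳ _))))
    (trans (degree-sum (λ _ → 1) Q) (twice Q)))
    where
    twice : ∀ Q → ℕ-Sum.fold (λ _ → 2) Q ≡ 2 ℕ.* length Q
    twice []      = refl
    twice (_ ∷ Q) = trans (cong (2 ℕ.+_) (twice Q)) (sym (ℕ.*-suc 2 (length Q)))

  -- perfectMatchings lists each matching in the order of allEdges, so a crossing is put in that order.
  arrange : List (Edge n) → List (Edge n)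
  arrange Q = filter (λ e → Any.any? (e ≟ᵉ_) Q) (allEdges n)

  ∈-arrange⁺ : ∀ {Q e} → e ∈ˡ Q → e ∈ˡ arrange Q
  ∈-arrange⁺ {Q} {e} e∈ = List.∈-filter⁺ (λ e → Any.any? (e ≟ᵉ_) Q) (∈-allEdges n e) e∈

  ∈-arrange⁻ : ∀ {Q e} → e ∈ˡ arrange Q → e ∈ˡ Q
  ∈-arrange⁻ {Q} e∈ = proj₂ (List.∈-filter⁻ (λ e → Any.any? (e ≟ᵉ_) Q) {xs = allEdges n} e∈)

  arrange-unique : ∀ Q → Unique (arrange Q)
  arrange-unique Q = Unique.filter⁺ (λ e → Any.any? (e ≟ᵉ_) Q) (allEdges-unique n)

  arrange-crossing : ∀ {Q} → AllPairs Cross Q → AllPairs Cross (arrange Q)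
  arrange-crossing {Q} cs = unique-AllPairs (arrange-unique Q) λ p q e≢f → AllPairs-∈ (λ {x} {y} → Cross-sym {x} {y}) cs (∈-arrange⁻ {Q} p) (∈-arrange⁻ {Q} q) e≢f

  arrange-length : ∀ {Q} → AllPairs Cross Q → length (arrange Q) ≡ length Q
  arrange-length {Q} cs = ℕ.≤-antisym (unique-⊆-length (arrange-unique Q) (∈-arrange⁻ {Q})) (unique-⊆-length (AllPairs.map (λ {x} {y} → Cross-≢ {x} {y}) cs) (∈-arrange⁺ {Q}))

module _ {n : ℕ} where

  edgeProduct-∉ : ∀ {e : Edge n} E → ¬ (e ∈ˡ E) → edgeProduct E e ≡ 0
  edgeProduct-∉ []      _  = refl
  edgeProduct-∉ {e} (f ∷ E) e∉ = cong₂ ℕ._+_ (var-≢ f e (λ f≡e → e∉ (here (sym f≡e)))) (edgeProduct-∉ E (e∉ ∘ there))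

  edgeProduct-∈ : ∀ {e : Edge n} {E} → Unique E → e ∈ˡ E → edgeProduct E e ≡ 1
  edgeProduct-∈ {e} {f ∷ E} (f∉ ∷ _) (here refl) = cong₂ ℕ._+_ (var-refl e) (edgeProduct-∉ E (λ e∈ → All.lookup f∉ e∈ refl))
  edgeProduct-∈ {e} {f ∷ E} (f∉ ∷ u) (there e∈)  = cong₂ ℕ._+_ (var-≢ f e (All.lookup f∉ e∈)) (edgeProduct-∈ u e∈)

  support : Monomial n → Edge n → Bool
  support m e = does (1 ℕ.≤? m e)

  support⁻ : ∀ m e → support m e ≡ true → 1 ℕ.≤ m e
  support⁻ m e = go (1 ℕ.≤? m e)
    where
    go : (d : Dec (1 ℕ.≤ m e)) → does d ≡ true → 1 ℕ.≤ m e
    go (yes p) _ = p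

  total : Monomial n → ℕ
  total = wt (λ _ → 1)

module _ {a ℓ} (M : CommutativeMonoid a ℓ) where
  open CommutativeMonoid M renaming (refl to ≈-refl; sym to ≈-sym; trans to ≈-trans)
  open Big M

  fold-extract : ∀ {b} {B : Set b} (_≟_ : ∀ (x y : B) → Dec (x ≡ y)) (f : B → Carrier) {x xs} → Unique xs → x ∈ˡ xs →
    fold f xs ≈ f x ∙ fold f (filter (λ y → ¬? (y ≟ x)) xs)
  fold-extract _≟_ f {x} {y ∷ ys} (y∉ ∷ u) x∈ with y ≟ x
  ... | yes refl = ∙-congˡ (reflexive (cong (fold f) (sym (List.filter-all (λ z → ¬? (z ≟ y)) (All.map (λ ≢ → ≢ ∘ sym) y∉)))))
  ... | no y≢x with x∈
  ...   | here eq  = contradiction (sym eq) y≢x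
  ...   | there x∈ = ≈-trans (∙-congˡ (fold-extract _≟_ f u x∈)) (SemigroupProperties.x∙yz≈y∙xz commutativeSemigroup _ _ _)

module Spanning {c ℓ₁ ℓ₂} (K : HeytingField c ℓ₁ ℓ₂) (n k : ℕ) where
  open Evaluation K n
  open CommutativeExp (CommutativeRing.commutativeSemiring KR) using (_^_; ^-distrib-*; ^-congˡ)
  private
    module ∑K = Big (CommutativeRing.+-commutativeMonoid KR)
    module +K = SemigroupProperties (CommutativeMonoid.commutativeSemigroup (CommutativeRing.+-commutativeMonoid KR))

  I : Pred Terms (c ⊔ ℓ₁)
  I = PfaffianIdeal K n k

  Standard : Monomial n → Set
  Standard m = Free k (support m)

  StandardTerms : ℕ → Terms → Set c
  StandardTerms d r = ∀ {t} → t ∈ˡ r → Standard (proj₂ t) × total (proj₂ t) ≡ d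

  Reduces : ℕ → Terms → Set (c ⊔ ℓ₁)
  Reduces d ts = ∃[ r ] StandardTerms d r × (ts ++ r) ∈ I

  I-respects : ∀ {p q} → p ∈ I → (∀ m → coeff K n q m K.≈ coeff K n p m) → q ∈ I
  I-respects p∈ eq = respects (λ m → K.sym (eq m)) p∈

  I-scale : ∀ a {p} → p ∈ I → scale a p ∈ I
  I-scale a {p} p∈ = subst I (List.++-identityʳ (map _ p)) (multiple ((a , one) ∷ []) p∈)

  scale-standard : ∀ {d} a {r} → StandardTerms d r → StandardTerms d (scale a r)
  scale-standard a {r} st t∈ with _ , u∈ , refl ← List.∈-map⁻ _ t∈ = st u∈

  negate-coeff : ∀ r m → coeff K n (scale (K.- K.1#) r) m K.≈ K.- coeff K n r m
  negate-coeff r m = K.trans (coeff-scale (K.- K.1#) r m) (RingProperties.-1*x≈-x (CommutativeRing.ring KR) _)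

  I-difference : ∀ {p q r} → (p ++ q) ∈ I → (q ++ r) ∈ I → (p ++ scale (K.- K.1#) r) ∈ I
  I-difference {p} {q} {r} pq qr = I-respects (add pq (I-scale (K.- K.1#) qr)) λ m →
    K.trans (coeff-++ p _ m) (K.sym (K.trans (coeff-++ (p ++ q) _ m) (K.trans
      (K.+-cong (coeff-++ p q m) (K.trans (negate-coeff (q ++ r) m) (K.trans (K.-‿cong (coeff-++ q r m)) (K.sym (RingProperties.-‿+-comm (CommutativeRing.ring KR) _ _)))))
      (K.trans (K.+-assoc _ _ _) (K.+-congˡ (K.trans (K.sym (K.+-assoc _ _ _)) (K.trans (K.+-congʳ (K.-‿inverseʳ _)) (K.trans (K.+-identityˡ _) (K.sym (negate-coeff r m))))))))))

  reduce-terms : ∀ d ts → (∀ {t} → t ∈ˡ ts → ¬ ¬ Reduces d ((K.1# , proj₂ t) ∷ [])) → ¬ ¬ Reduces d ts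
  reduce-terms d []             red κ = κ ([] , (λ ()) , IdealGenerated.zero)
  reduce-terms d ((a , m) ∷ ts) red κ = red (here refl) λ { (r , st , r∈) → reduce-terms d ts (red ∘ there) λ { (r′ , st′ , r′∈) →
    κ (scale a r ++ r′ ,
       (λ t∈ → Sum.[ scale-standard a st , st′ ]′ (List.∈-++⁻ (scale a r) t∈)) ,
       I-respects (add (I-scale a r∈) r′∈) λ m′ →
         K.trans (K.+-congˡ (K.trans (coeff-++ ts _ m′) (K.trans (K.+-congˡ (coeff-++ (scale a r) r′ m′)) (+K.x∙yz≈y∙xz _ _ _))))
         (K.sym (K.trans (K.+-cong (head m′) (K.trans (coeff-++ (scale a r) _ m′) (K.+-congˡ (coeff-++ ts r′ m′)))) K.refl))) } }
    where
    head : ∀ m′ → (if does (m ≐? m′) then a K.* K.1# else K.0#) K.≈ (if does (m ≐? m′) then a else K.0#)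
    head m′ with does (m ≐? m′)
    ... | true  = K.*-identityʳ a
    ... | false = K.refl

  -- The Pfaffian of the vertices of a crossing, times a monomial, rewrites the product of the
  -- crossing in terms of monomials of smaller weight.
  module Rewrite (m : Monomial n) {E : List (Edge n)} (cr-E : IsCrossing (suc k) E) (E⊆m : All (Selected (support m)) E) where

    Q : List (Edge n)
    Q = arrange E

    crosses : AllPairs Cross Q
    crosses = arrange-crossing {Q = E} (proj₂ cr-E)

    U : Subset n
    U = vertices Q

    _≟E_ : ∀ (E F : List (Edge n)) → Dec (E ≡ F)
    _≟E_ = List.≡-dec _≟ᵉ_

    Q∈ : Q ∈ˡ perfectMatchings U
    Q∈ = List.∈-filter⁺ (perfectMatching? U) (filter-sublist (λ e → Any.any? (e ≟ᵉ_) E) (allEdges n)) (Covers⇒PM {U = U} {Q} (vertices-covers Q crosses))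

    others : List (List (Edge n))
    others = filter (λ F → ¬? (F ≟E Q)) (perfectMatchings U)

    m′ : Monomial n
    m′ e = m e ℕ.∸ edgeProduct Q e

    m′-· : ∀ e → (m′ · edgeProduct Q) e ≡ m e
    m′-· e = ℕ.m∸n+n≡m (divides (Any.any? (e ≟ᵉ_) Q))
      where
      divides : Dec (e ∈ˡ Q) → edgeProduct Q e ℕ.≤ m e
      divides (yes e∈) = ℕ.≤-trans (ℕ.≤-reflexive (edgeProduct-∈ (arrange-unique E) e∈)) (support⁻ m e (All.lookup E⊆m (∈-arrange⁻ {Q = E} e∈)))
      divides (no e∉)  = ℕ.≤-trans (ℕ.≤-reflexive (edgeProduct-∉ Q e∉)) z≤n

    sign : List (Edge n) → K.Carrier
    sign F = (K.- K.1#) ^ cr F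

    sign-square : sign Q K.* sign Q K.≈ K.1#
    sign-square = K.trans (K.sym (^-distrib-* (K.- K.1#) (K.- K.1#) (cr Q))) (K.trans (^-congˡ (cr Q)
      (K.trans (RingProperties.-1*x≈-x (CommutativeRing.ring KR) _) (RingProperties.-‿involutive (CommutativeRing.ring KR) _))) (MonomialValue.1^ KR n (cr Q)))

    entry : List (Edge n) → K.Carrier × Monomial n
    entry F = sign Q K.* sign F , m′ · edgeProduct F

    multiplied : map entry (perfectMatchings U) ∈ I
    multiplied = subst I (trans (List.++-identityʳ _) (sym (List.map-∘ (perfectMatchings U)))) (multiple ((sign Q , m′) ∷ [])
      (generator (U , trans (vertices-size Q crosses) (cong (2 ℕ.*_) (trans (arrange-length {Q = E} (proj₂ cr-E)) (proj₁ cr-E))) , refl)))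

    rewritten : ((K.1# , m) ∷ map entry others) ∈ I
    rewritten = I-respects multiplied λ m₁ → K.sym (K.trans (collect m₁ (perfectMatchings U))
      (K.trans (fold-extract (CommutativeRing.+-commutativeMonoid KR) _≟E_ (contribution m₁) (Unique.filter⁺ (perfectMatching? U) (sublists-unique (allEdges-unique n))) Q∈)
        (K.+-cong (leading-term m₁) (K.sym (collect m₁ others)))))
      where
      contribution : Monomial n → List (Edge n) → K.Carrier
      contribution m₁ F = if does ((m′ · edgeProduct F) ≐? m₁) then sign Q K.* sign F else K.0#

      collect : ∀ m₁ Fs → coeff K n (map entry Fs) m₁ K.≈ ∑K.fold (contribution m₁) Fs
      collect m₁ Fs = K.trans (coeff-∑ (map entry Fs) m₁) (K.reflexive (∑K.fold-map (λ { (a , m′) → if does (m′ ≐? m₁) then a else K.0# }) entry Fs))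

      leading-term : ∀ m₁ → contribution m₁ Q K.≈ (if does (m ≐? m₁) then K.1# else K.0#)
      leading-term m₁ = go ((m′ · edgeProduct Q) ≐? m₁) (m ≐? m₁)
        where
        go : (d : Dec ((m′ · edgeProduct Q) ≐ m₁)) (d′ : Dec (m ≐ m₁)) → (if does d then sign Q K.* sign Q else K.0#) K.≈ (if does d′ then K.1# else K.0#)
        go (yes _) (yes _) = sign-square
        go (no _)  (no _)  = K.refl
        go (yes p) (no ¬q) = contradiction (≗⇒≐ λ e → trans (sym (m′-· e)) (≐⇒≗ p e)) ¬q
        go (no ¬p) (yes q) = contradiction (≗⇒≐ λ e → trans (m′-· e) (≐⇒≗ q e)) ¬p

    module _ {F} (F∈ : F ∈ˡ others) where
      private
        F-matching = List.∈-filter⁻ (λ F → ¬? (F ≟E Q)) {xs = perfectMatchings U} F∈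
        F-sublist  = List.∈-filter⁻ (perfectMatching? U) {xs = sublists (allEdges n)} (proj₁ F-matching)
        F-covers : Covers U F
        F-covers = PM⇒Covers {U = U} {F} (proj₂ F-sublist)

      wt-split : ∀ δ F → wt δ (m′ · edgeProduct F) ≡ wt δ m′ ℕ.+ ℕ-Sum.fold δ F
      wt-split δ F = trans (wt-· δ m′ (edgeProduct F)) (cong (wt δ m′ ℕ.+_) (wt-edgeProduct δ F))

      wt-m : ∀ δ → wt δ m ≡ wt δ m′ ℕ.+ ℕ-Sum.fold δ Q
      wt-m δ = trans (wt-cong δ δ m (m′ · edgeProduct Q) (λ e → cong (δ e ℕ.*_) (sym (m′-· e)))) (wt-split δ Q)

      smaller : wt crossingWeight (m′ · edgeProduct F) ℕ.< wt crossingWeight m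
      smaller = ℕ.≤-trans (s≤s (ℕ.≤-reflexive (wt-split crossingWeight F))) (ℕ.≤-trans (ℕ.+-monoʳ-< (wt crossingWeight m′)
        (matching-weight-< {U = U} {F} {Q} (proj₁ F-sublist) (filter-sublist (λ e → Any.any? (e ≟ᵉ_) E) (allEdges n)) F-covers (vertices-covers Q crosses) crosses (proj₂ F-matching)))
        (ℕ.≤-reflexive (sym (wt-m crossingWeight))))

      same-total : total (m′ · edgeProduct F) ≡ total m
      same-total = trans (wt-split (λ _ → 1) F) (trans (cong (total m′ ℕ.+_) (trans (count F) (trans (covers-length {U = U} {F} {Q} F-covers (vertices-covers Q crosses)) (sym (count Q)))))
        (sym (wt-m (λ _ → 1))))
        where
        count : ∀ F → ℕ-Sum.fold (λ _ → 1) F ≡ length F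
        count []      = refl
        count (_ ∷ F) = cong suc (count F)

  reduce : ∀ b m → wt crossingWeight m ℕ.< b → ¬ ¬ Reduces (total m) ((K.1# , m) ∷ [])
  reduce (suc b) m (s≤s lt) κ = ¬¬-dec (∃[ E ] IsCrossing (suc k) E × All (Selected (support m)) E) λ
    { (no free) → κ ((K.- K.1# , m) ∷ [] , (λ { (here refl) → free , refl }) , I-respects IdealGenerated.zero (cancel m))
    ; (yes (E , cr-E , E⊆m)) → let open Rewrite m cr-E E⊆m in
        reduce-terms (total m) (map entry others) (λ t∈ → let F , F∈ , eq = List.∈-map⁻ entry t∈ in
            subst (λ t → ¬ ¬ Reduces (total m) ((K.1# , proj₂ t) ∷ [])) (sym eq)
              (subst (λ d → ¬ ¬ Reduces d ((K.1# , m′ · edgeProduct F) ∷ [])) (same-total F∈) (reduce b _ (ℕ.<-≤-trans (smaller F∈) lt))))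
          λ { (r , st , r∈) → κ (scale (K.- K.1#) r , scale-standard (K.- K.1#) st , I-difference {(K.1# , m) ∷ []} {map entry others} rewritten r∈) } }
    where
    cancel : ∀ m m₁ → coeff K n ((K.1# , m) ∷ (K.- K.1# , m) ∷ []) m₁ K.≈ K.0#
    cancel m m₁ with does (m ≐? m₁)
    ... | true  = K.trans (K.+-congˡ (K.+-identityʳ _)) (K.-‿inverseʳ K.1#)
    ... | false = K.trans (K.+-identityˡ _) (K.+-identityˡ _)

module LinearDependence {c ℓ₁ ℓ₂} (K : HeytingField c ℓ₁ ℓ₂) (n : ℕ) where
  open Evaluation K n using (module K; KR)
  private
    module +K = SemigroupProperties (CommutativeMonoid.commutativeSemigroup (CommutativeRing.+-commutativeMonoid KR))
    open RingProperties (CommutativeRing.ring KR) using (-‿distribˡ-*)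

  Σᶠ : ∀ {r} → (Fin r → K.Carrier) → K.Carrier
  Σᶠ {zero}  f = K.0#
  Σᶠ {suc r} f = f zero K.+ Σᶠ (f ∘ suc)

  Σᶠ-cong : ∀ {r} {f g : Fin r → K.Carrier} → (∀ i → f i K.≈ g i) → Σᶠ f K.≈ Σᶠ g
  Σᶠ-cong {zero}  eq = K.refl
  Σᶠ-cong {suc r} eq = K.+-cong (eq zero) (Σᶠ-cong (eq ∘ suc))

  Σᶠ-0 : ∀ {r} {f : Fin r → K.Carrier} → (∀ i → f i K.≈ K.0#) → Σᶠ f K.≈ K.0#
  Σᶠ-0 {zero}  eq = K.refl
  Σᶠ-0 {suc r} eq = K.trans (K.+-cong (eq zero) (Σᶠ-0 (eq ∘ suc))) (K.+-identityˡ _)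

  Σᶠ-+ : ∀ {r} (f g : Fin r → K.Carrier) → Σᶠ (λ i → f i K.+ g i) K.≈ Σᶠ f K.+ Σᶠ g
  Σᶠ-+ {zero}  f g = K.sym (K.+-identityˡ _)
  Σᶠ-+ {suc r} f g = K.trans (K.+-congˡ (Σᶠ-+ (f ∘ suc) (g ∘ suc))) (+K.interchange _ _ _ _)

  Σᶠ-* : ∀ {r} (f : Fin r → K.Carrier) x → Σᶠ (λ i → f i K.* x) K.≈ Σᶠ f K.* x
  Σᶠ-* {zero}  f x = K.sym (K.zeroˡ x)
  Σᶠ-* {suc r} f x = K.trans (K.+-congˡ (Σᶠ-* (f ∘ suc) x)) (K.sym (K.distribʳ _ _ _))

  Σᶠ-remove : ∀ {r} (f : Fin (suc r) → K.Carrier) i → Σᶠ f K.≈ f i K.+ Σᶠ (f ∘ Fin.punchIn i)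
  Σᶠ-remove f zero = K.refl
  Σᶠ-remove {suc r} f (suc i) = K.trans (K.+-congˡ (Σᶠ-remove (f ∘ suc) i)) (+K.x∙yz≈y∙xz _ _ _)

  1≉0 : ¬ (K.1# K.≈ K.0#)
  1≉0 eq = proj₂ (K.tight K.1# K.0#) eq (K.invertible⇒# (K.1# , one-inverse , one-inverse))
    where
    one-inverse : ∀ {x} → x K.≈ K.1#
    one-inverse = K.trans (K.sym (K.*-identityʳ _)) (K.trans (K.*-congˡ eq) (K.trans (K.zeroʳ _) (K.sym eq)))

  dependent : ∀ m (v : Fin (suc m) → Fin m → K.Carrier) →
    ¬ ¬ (Σ (Fin (suc m) → K.Carrier) λ x → (∃[ i ] ¬ (x i K.≈ K.0#)) × (∀ j → Σᶠ (λ i → x i K.* v i j) K.≈ K.0#))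
  dependent zero    v κ = κ ((λ _ → K.1#) , (zero , 1≉0) , λ ())
  dependent (suc m) v κ = ¬¬-dec (∃[ i ] v i zero K.# K.0#) λ
    { (no all-zero) → dependent m (λ i j → v (suc i) (suc j)) λ { (x , (i , x≉0) , eq) → κ
        ( VecF._∷_ K.0# x , (suc i , x≉0)
        , λ { zero    → Σᶠ-0 {f = λ i → VecF._∷_ K.0# x i K.* v i zero} λ i → K.trans (K.*-congˡ (proj₁ (K.tight _ _) λ # → all-zero (i , #))) (K.zeroʳ (VecF._∷_ K.0# x i))
            ; (suc j) → K.trans (K.+-cong (K.zeroˡ _) (eq j)) (K.+-identityˡ _) }) }
    ; (yes (i , v#0)) → let y , _ , vy = K.#⇒invertible v#0 in pivot i y (K.trans (K.*-congʳ (K.sym (K.trans (K.+-congˡ -0#≈0#) (K.+-identityʳ _)))) vy) }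
    where
    open RingProperties (CommutativeRing.ring KR) using (-0#≈0#)

    pivot : ∀ i y → v i zero K.* y K.≈ K.1# → ⊥
    pivot i y vy = dependent m (λ p j → v (Fin.punchIn i p) (suc j) K.- ratio p K.* v i (suc j)) λ { (x , (p , x≉0) , eq) →
      let s  = K.- Σᶠ (λ p → x p K.* ratio p)
          x′ = insertAt x i s
      in κ (x′ , (Fin.punchIn i p , λ z → x≉0 (K.trans (K.reflexive (sym (insertAt-punchIn x i s p))) z)) , λ
          { zero → K.trans (expand x zero) (Σᶠ-0 {f = λ p → x p K.* (v (Fin.punchIn i p) zero K.- ratio p K.* v i zero)} λ p → K.trans (K.*-congˡ (K.trans (K.+-congˡ (K.-‿cong (ratio-zero p))) (K.-‿inverseʳ _))) (K.zeroʳ (x p)))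
          ; (suc j) → K.trans (expand x (suc j)) (eq j) }) }
      where
      ratio : Fin (suc m) → K.Carrier
      ratio p = v (Fin.punchIn i p) zero K.* y

      ratio-zero : ∀ p → ratio p K.* v i zero K.≈ v (Fin.punchIn i p) zero
      ratio-zero p = K.trans (K.*-assoc _ _ _) (K.trans (K.*-congˡ (K.trans (K.*-comm _ _) vy)) (K.*-identityʳ _))

      expand : ∀ (x : Fin (suc m) → K.Carrier) j → let s = K.- Σᶠ (λ p → x p K.* ratio p) in
        Σᶠ (λ q → insertAt x i s q K.* v q j) K.≈ Σᶠ (λ p → x p K.* (v (Fin.punchIn i p) j K.- ratio p K.* v i j))
      expand x j = K.trans (Σᶠ-remove (λ q → insertAt x i s q K.* v q j) i) (K.trans
        (K.+-cong (K.*-congʳ (K.reflexive (insertAt-lookup x i s))) (Σᶠ-cong {f = λ p → insertAt x i s (Fin.punchIn i p) K.* v (Fin.punchIn i p) j} {old} (λ p → K.*-congʳ (K.reflexive (insertAt-punchIn x i s p)))))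
        (K.trans (K.+-comm _ _) (K.sym (K.trans
          (Σᶠ-cong {g = λ p → old p K.+ K.- weighted p K.* v i j} λ p → K.trans (K.distribˡ _ _ _) (K.+-congˡ (K.trans (K.sym (-‿distribʳ-* _ _)) (K.trans (K.-‿cong (K.sym (K.*-assoc _ _ _))) (-‿distribˡ-* _ _)))))
          (K.trans (Σᶠ-+ old (λ p → K.- weighted p K.* v i j)) (K.+-congˡ (K.trans (Σᶠ-* (λ p → K.- weighted p) (v i j)) (K.*-congʳ (negate weighted)))))))))
        where
        open RingProperties (CommutativeRing.ring KR) using (-‿distribʳ-*; -‿+-comm)
        weighted old : Fin (suc m) → K.Carrier
        weighted p = x p K.* ratio p
        old p = x p K.* v (Fin.punchIn i p) j
        s = K.- Σᶠ weighted
        negate : ∀ {r} (f : Fin r → K.Carrier) → Σᶠ (λ p → K.- f p) K.≈ K.- Σᶠ f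
        negate {zero}  f = K.sym -0#≈0#
        negate {suc r} f = K.trans (K.+-congˡ (negate (f ∘ suc))) (-‿+-comm _ _)

-- Monomials in given variables with bounded exponents

module _ {n : ℕ} where

  raise : Edge n → ℕ → Monomial n → Monomial n
  raise e d m f = d ℕ.* var e f ℕ.+ m f

  box : ℕ → List (Edge n) → List (Monomial n)
  box b []      = one ∷ []
  box b (e ∷ T) = cartesianProductWith (raise e) (upTo (suc b)) (box b T)

  length-cartesianProductWith : ∀ {a b c} {A : Set a} {B : Set b} {C : Set c} (f : A → B → C) xs ys →
    length (cartesianProductWith f xs ys) ≡ length xs ℕ.* length ys
  length-cartesianProductWith f []       ys = refl
  length-cartesianProductWith f (x ∷ xs) ys = trans (List.length-++ (map (f x) ys)) (cong₂ ℕ._+_ (List.length-map (f x) ys) (length-cartesianProductWith f xs ys))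

  box-length : ∀ b T → length (box b T) ≡ suc b ℕ.^ length T
  box-length b []      = refl
  box-length b (e ∷ T) = trans (length-cartesianProductWith (raise e) (upTo (suc b)) (box b T)) (cong₂ ℕ._*_ (List.length-upTo (suc b)) (box-length b T))

  box-outside : ∀ b T {m e} → m ∈ˡ box b T → ¬ (e ∈ˡ T) → m e ≡ 0
  box-outside b []      (here refl) _ = refl
  box-outside b (f ∷ T) {e = e} m∈ e∉ with d , m′ , _ , m′∈ , refl ← List.∈-cartesianProductWith⁻ (raise f) (upTo (suc b)) (box b T) m∈ =
    cong₂ ℕ._+_ (trans (cong (d ℕ.*_) (var-≢ f e (λ f≡e → e∉ (here (sym f≡e))))) (ℕ.*-zeroʳ d)) (box-outside b T m′∈ (e∉ ∘ there))

  box-total : ∀ b T {m} → m ∈ˡ box b T → total m ℕ.≤ length T ℕ.* b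
  box-total b []      (here refl) = ℕ.≤-reflexive (ℕ-Sum.fold-ε (allEdges n) (λ _ → refl))
  box-total b (e ∷ T) m∈ with d , m′ , d∈ , m′∈ , refl ← List.∈-cartesianProductWith⁻ (raise e) (upTo (suc b)) (box b T) m∈ =
    ℕ.≤-trans (ℕ.≤-reflexive (trans (wt-· (λ _ → 1) (λ f → d ℕ.* var e f) m′) (cong (ℕ._+ total m′) (scaled (allEdges n) (allEdges-unique n) (∈-allEdges n e)))))
      (ℕ.+-mono-≤ (ℕ.s≤s⁻¹ (List.∈-upTo⁻ d∈)) (box-total b T m′∈))
    where
    scaled : ∀ es → Unique es → e ∈ˡ es → ℕ-Sum.fold (λ f → 1 ℕ.* (d ℕ.* var e f)) es ≡ d
    scaled es u e∈ = trans (ℕ-Sum.fold-single u e∈ (λ f f≢e → trans (ℕ.*-identityˡ _) (trans (cong (d ℕ.*_) (var-≢ e f (f≢e ∘ sym))) (ℕ.*-zeroʳ d))))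
      (trans (ℕ.*-identityˡ _) (trans (cong (d ℕ.*_) (var-refl e)) (ℕ.*-identityʳ d)))

  box-complete : ∀ b T → Unique T → ∀ m → (∀ e → m e ℕ.≤ b) → (∀ e → ¬ (e ∈ˡ T) → m e ≡ 0) → ∃[ m′ ] m′ ∈ˡ box b T × (∀ e → m e ≡ m′ e)
  box-complete b []      u m le off = one , here refl , λ e → off e λ ()
  box-complete b (e ∷ T) (e∉ ∷ u) m le off = let m′ , m′∈ , eq = box-complete b T u (λ f → if does (e ≟ᵉ f) then 0 else m f) le′ off′ in
    raise e (m e) m′ , List.∈-cartesianProductWith⁺ (raise e) (List.∈-upTo⁺ (s≤s (le e))) m′∈ , λ f → trans (split f (e ≟ᵉ f)) (cong (m e ℕ.* var e f ℕ.+_) (eq f))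
    where
    le′ : ∀ f → (if does (e ≟ᵉ f) then 0 else m f) ℕ.≤ b
    le′ f with does (e ≟ᵉ f)
    ... | true  = z≤n
    ... | false = le f
    off′ : ∀ f → ¬ (f ∈ˡ T) → (if does (e ≟ᵉ f) then 0 else m f) ≡ 0
    off′ f f∉ = go (e ≟ᵉ f)
      where
      go : (d : Dec (e ≡ f)) → (if does d then 0 else m f) ≡ 0
      go (yes _)   = refl
      go (no e≢f) = off f λ { (here f≡e) → e≢f (sym f≡e) ; (there f∈) → f∉ f∈ }
    split : ∀ f (d : Dec (e ≡ f)) → m f ≡ m e ℕ.* (if does d then 1 else 0) ℕ.+ (if does d then 0 else m f)
    split f (yes refl) = sym (trans (ℕ.+-identityʳ _) (ℕ.*-identityʳ (m f)))
    split f (no _)     = sym (cong (ℕ._+ m f) (ℕ.*-zeroʳ (m e)))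

  Different : Monomial n → Monomial n → Set
  Different m m′ = ¬ (m ≐ m′)

  box-distinct : ∀ b T → Unique T → AllPairs Different (box b T)
  box-distinct b []      u        = [] ∷ []
  box-distinct b (e ∷ T) (e∉ ∷ u) = rows (upTo (suc b)) (Unique.upTo⁺ (suc b))
    where
    value-at : ∀ d {m} → m ∈ˡ box b T → raise e d m e ≡ d
    value-at d m∈ = trans (cong₂ ℕ._+_ (trans (cong (d ℕ.*_) (var-refl e)) (ℕ.*-identityʳ d)) (box-outside b T m∈ (λ e∈ → All.lookup e∉ e∈ refl))) (ℕ.+-identityʳ d)
    rows : ∀ ds → Unique ds → AllPairs Different (cartesianProductWith (raise e) ds (box b T))
    rows []       _        = []
    rows (d ∷ ds) (d∉ ∷ v) = AllPairs.++⁺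
      (AllPairs.map⁺ (AllPairs.map (λ {m} {m′} ≢ eq → ≢ (≗⇒≐ λ f → ℕ.+-cancelˡ-≡ (d ℕ.* var e f) (m f) (m′ f) (≐⇒≗ eq f))) (box-distinct b T u)))
      (rows ds v)
      (All.tabulate λ p → All.tabulate λ q eq → let m , m∈ , eq₁ = List.∈-map⁻ (raise e d) p
                                                    d′ , m′ , d′∈ , m′∈ , eq₂ = List.∈-cartesianProductWith⁻ (raise e) ds (box b T) q in
        All.lookup d∉ d′∈ (trans (sym (value-at d m∈)) (trans (sym (cong (λ m → m e) eq₁)) (trans (≐⇒≗ eq e) (trans (cong (λ m → m e) eq₂) (value-at d′ m′∈))))))

  smallMonomials : ℕ → ℕ → List (Monomial n)
  smallMonomials b N = concatMap (box b) (filter (λ F → length F ℕ.≤? N) (sublists (allEdges n)))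

  sublists-length : ∀ {a} {A : Set a} (L : List A) → length (sublists L) ≡ 2 ℕ.^ length L
  sublists-length []      = refl
  sublists-length (x ∷ L) = trans (List.length-++ (map (x ∷_) (sublists L))) (cong₂ ℕ._+_ (trans (List.length-map (x ∷_) (sublists L)) (sublists-length L))
    (trans (sublists-length L) (sym (ℕ.+-identityʳ _))))

  smallMonomials-length : ∀ b N → length (smallMonomials b N) ℕ.≤ 2 ℕ.^ length (allEdges n) ℕ.* suc b ℕ.^ N
  smallMonomials-length b N = ℕ.≤-trans (bounded (filter (λ F → length F ℕ.≤? N) (sublists (allEdges n))) (All.all-filter (λ F → length F ℕ.≤? N) (sublists (allEdges n))))
    (ℕ.*-monoˡ-≤ (suc b ℕ.^ N) (ℕ.≤-trans (List.length-filter (λ F → length F ℕ.≤? N) (sublists (allEdges n))) (ℕ.≤-reflexive (sublists-length (allEdges n)))))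
    where
    bounded : ∀ Fs → All (λ F → length F ℕ.≤ N) Fs → length (concatMap (box b) Fs) ℕ.≤ length Fs ℕ.* suc b ℕ.^ N
    bounded []       []       = z≤n
    bounded (F ∷ Fs) (p ∷ ps) = ℕ.≤-trans (ℕ.≤-reflexive (List.length-++ (box b F)))
      (ℕ.+-mono-≤ (ℕ.≤-trans (ℕ.≤-reflexive (box-length b F)) (ℕ.^-monoʳ-≤ (suc b) p)) (bounded Fs ps))

  chosen : (Edge n → Bool) → List (Edge n)
  chosen σ = filter (λ e → σ e Bool.≟ true) (allEdges n)

  chosen-missing : ∀ σ → length (chosen σ) ℕ.+ missing σ ≡ length (allEdges n)
  chosen-missing σ = go (allEdges n)
    where
    go : ∀ es → length (filter (λ e → σ e Bool.≟ true) es) ℕ.+ ℕ-Sum.fold (λ e → if σ e then 0 else 1) es ≡ length es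
    go [] = refl
    go (e ∷ es) with σ e
    ... | true  = cong suc (go es)
    ... | false = trans (ℕ.+-suc _ _) (cong suc (go es))

  ∈-chosen⁺ : ∀ σ {e} → σ e ≡ true → e ∈ˡ chosen σ
  ∈-chosen⁺ σ {e} eq = List.∈-filter⁺ (λ e → σ e Bool.≟ true) (∈-allEdges n e) eq

  ∈-chosen⁻ : ∀ σ {e} → e ∈ˡ chosen σ → σ e ≡ true
  ∈-chosen⁻ σ e∈ = proj₂ (List.∈-filter⁻ (λ e → σ e Bool.≟ true) {xs = allEdges n} e∈)

  exponent-total : ∀ m (e : Edge n) → m e ℕ.≤ total m
  exponent-total m e = go (∈-allEdges n e)
    where
    go : ∀ {es} → e ∈ˡ es → m e ℕ.≤ ℕ-Sum.fold (λ e → 1 ℕ.* m e) es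
    go (here refl) = ℕ.≤-trans (ℕ.≤-reflexive (sym (ℕ.*-identityˡ (m e)))) (ℕ.m≤m+n _ _)
    go (there e∈)  = ℕ.≤-trans (go e∈) (ℕ.m≤n+m _ _)

  smallMonomials-complete : ∀ b N m → length (chosen (support m)) ℕ.≤ N → total m ℕ.≤ b → ∃[ m′ ] m′ ∈ˡ smallMonomials b N × (∀ e → m e ≡ m′ e)
  smallMonomials-complete b N m size le = let m′ , m′∈ , eq = box-complete b (chosen (support m)) (Unique.filter⁺ _ (allEdges-unique n)) m (λ e → ℕ.≤-trans (exponent-total m e) le) off in
    m′ , List.∈-concatMap⁺ (box b) (List.lose (List.∈-filter⁺ (λ F → length F ℕ.≤? N) (filter-sublist (λ e → support m e Bool.≟ true) (allEdges n)) size) m′∈) , eq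
    where
    off : ∀ e → ¬ (e ∈ˡ chosen (support m)) → m e ≡ 0
    off e e∉ = ℕ.n<1⇒n≡0 (ℕ.≰⇒> λ pos → e∉ (∈-chosen⁺ (support m) (dec-true (1 ℕ.≤? m e) pos)))

¬¬-Fin : ∀ {p} r {P : Fin r → Set p} → (∀ i → ¬ ¬ P i) → ¬ ¬ (∀ i → P i)
¬¬-Fin zero    f κ = κ λ ()
¬¬-Fin (suc r) f κ = f zero λ p → ¬¬-Fin r (f ∘ suc) λ ps → κ λ { zero → p ; (suc i) → ps i }

AllPairs-lookup : ∀ {a r} {A : Set a} {R : A → A → Set r} → (∀ {x y} → R x y → R y x) → ∀ {xs} → AllPairs R xs →
  ∀ i j → i ≢ j → R (Data.List.Base.lookup xs i) (Data.List.Base.lookup xs j)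
AllPairs-lookup sy (p ∷ ps) zero    zero    i≢j = contradiction refl i≢j
AllPairs-lookup sy (p ∷ ps) zero    (suc j) i≢j = All.lookup p (List.∈-lookup j)
AllPairs-lookup sy (p ∷ ps) (suc i) zero    i≢j = sy (All.lookup p (List.∈-lookup i))
AllPairs-lookup sy (p ∷ ps) (suc i) (suc j) i≢j = AllPairs-lookup sy ps i j (i≢j ∘ cong suc)

^-distrib-* : ∀ m n o → (m ℕ.* n) ℕ.^ o ≡ m ℕ.^ o ℕ.* n ℕ.^ o
^-distrib-* m n zero    = refl
^-distrib-* m n (suc o) = trans (cong (m ℕ.* n ℕ.*_) (^-distrib-* m n o)) (ℕ.[m*n]*[o*p]≡[m*o]*[n*p] m n (m ℕ.^ o) (n ℕ.^ o))

-- With b = 2 ^ e * (N + 2) ^ N there are more monomials in N + 1 variables with exponents at most b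
-- than monomials of total degree at most (N + 1) * b in at most N of e variables.
box-outgrows : ∀ e N → let b = 2 ℕ.^ e ℕ.* (2 ℕ.+ N) ℕ.^ N in 2 ℕ.^ e ℕ.* suc (suc N ℕ.* b) ℕ.^ N ℕ.< suc b ℕ.^ suc N
box-outgrows e N = ℕ.≤-trans (s≤s (ℕ.≤-trans (ℕ.*-monoʳ-≤ (2 ℕ.^ e) (ℕ.^-monoˡ-≤ N base)) (ℕ.≤-reflexive (trans (cong (2 ℕ.^ e ℕ.*_) (^-distrib-* (2 ℕ.+ N) (suc b) N)) (sym (ℕ.*-assoc (2 ℕ.^ e) _ _))))))
  (ℕ.+-monoˡ-≤ (b ℕ.* suc b ℕ.^ N) (ℕ.m^n>0 (suc b) N))
  where
  b = 2 ℕ.^ e ℕ.* (2 ℕ.+ N) ℕ.^ N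
  base : suc (suc N ℕ.* b) ℕ.≤ (2 ℕ.+ N) ℕ.* suc b
  base = ℕ.≤-trans (ℕ.m≤m+n _ (suc N ℕ.+ b)) (ℕ.≤-reflexive (solve 2 (λ N b → (con 1 :+ (con 1 :+ N) :* b) :+ ((con 1 :+ N) :+ b) := (con 2 :+ N) :* (con 1 :+ b)) refl N b))
    where open +-*-Solver

module Bases {c ℓ₁ ℓ₂} (K : HeytingField c ℓ₁ ℓ₂) (n k : ℕ) (0<k : 0 ℕ.< k) (2k≤n : k ℕ.+ k ℕ.≤ n) where
  open Evaluation K n
  open Leading K n using (coeff-absent)
  open Spanning K n k
  open LinearDependence K n

  rank : ℕ
  rank = length (allEdges n) ℕ.∸ ascents (word n k 0 n)

  free-size : ∀ {σ} → Free k σ → length (chosen σ) ℕ.≤ rank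
  free-size {σ} free = ℕ.m+n≤o⇒m≤o∸n (length (chosen σ)) (ℕ.≤-trans (ℕ.+-monoʳ-≤ (length (chosen σ)) (free-missing k 0<k 2k≤n {σ} free)) (ℕ.≤-reflexive (chosen-missing σ)))

  maximal-size : ∀ {σ} → Free k σ → (∀ e → σ e ≡ false → ¬ Free k (adjoin σ e)) → length (chosen σ) ≡ rank
  maximal-size {σ} free maximal = sym (trans (cong (ℕ._∸ ascents (word n k 0 n)) (trans (sym (chosen-missing σ)) (cong (length (chosen σ) ℕ.+_) (maximal-missing k 0<k 2k≤n {σ} free maximal))))
    (ℕ.m+n∸n≡m (length (chosen σ)) (ascents (word n k 0 n))))

  ⨁ : ∀ {r} → (Fin r → Terms) → Terms
  ⨁ {zero}  f = []
  ⨁ {suc r} f = f zero ++ ⨁ (f ∘ suc)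

  coeff-⨁ : ∀ {r} (f : Fin r → Terms) m → coeff K n (⨁ f) m K.≈ Σᶠ (λ i → coeff K n (f i) m)
  coeff-⨁ {zero}  f m = K.refl
  coeff-⨁ {suc r} f m = K.trans (coeff-++ (f zero) _ m) (K.+-congˡ (coeff-⨁ (f ∘ suc) m))

  ⨁-I : ∀ {r} (f : Fin r → Terms) → (∀ i → f i ∈ I) → ⨁ f ∈ I
  ⨁-I {zero}  f f∈ = IdealGenerated.zero
  ⨁-I {suc r} f f∈ = add (f∈ zero) (⨁-I (f ∘ suc) (f∈ ∘ suc))

  module Elimination (d : ℕ) (small : List (Monomial n)) (small-complete : ∀ m → Standard m → total m ℕ.≤ d → ∃[ s ] s ∈ˡ small × (∀ e → m e ≡ s e))
    (mono : Fin (suc (length small)) → Monomial n) (mono-distinct : ∀ i j → i ≢ j → ¬ (mono i ≐ mono j)) (mono-total : ∀ i → total (mono i) ℕ.≤ d) where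

    module _ (r : Fin (suc (length small)) → Terms) (standard : ∀ i → StandardTerms (total (mono i)) (r i)) (r∈ : ∀ i → ((K.1# , mono i) ∷ r i) ∈ I)
      (x : Fin (suc (length small)) → K.Carrier) (i₀ : Fin (suc (length small))) (x≉0 : ¬ (x i₀ K.≈ K.0#))
      (eq : ∀ j → Σᶠ (λ i → x i K.* coeff K n (r i) (Data.List.Base.lookup small j)) K.≈ K.0#) where

      p : Terms
      p = ⨁ (λ i → scale (x i) ((K.1# , mono i) ∷ []))

      head : Fin (suc (length small)) → Monomial n → K.Carrier
      head i m = if does (mono i ≐? m) then K.1# else K.0#

      coeff-p : ∀ m → coeff K n p m K.≈ Σᶠ (λ i → x i K.* head i m)
      coeff-p m = K.trans (coeff-⨁ (λ i → scale (x i) ((K.1# , mono i) ∷ [])) m) (Σᶠ-cong {f = λ i → coeff K n (scale (x i) ((K.1# , mono i) ∷ [])) m} {λ i → x i K.* head i m} λ i → K.trans (coeff-scale (x i) ((K.1# , mono i) ∷ []) m) (K.*-congˡ (K.+-identityʳ _)))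

      tails-vanish : ∀ m → Σᶠ (λ i → x i K.* coeff K n (r i) m) K.≈ K.0#
      tails-vanish m with Any.any? (λ s → s ≐? m) small
      ... | yes some = K.trans (Σᶠ-cong {f = λ i → x i K.* coeff K n (r i) m} {λ i → x i K.* coeff K n (r i) (Data.List.Base.lookup small (Any.index some))} λ i → K.*-congˡ (coeff-cong (r i) (≗⇒≐ λ e → sym (≐⇒≗ (Any.lookup-index some) e)))) (eq (Any.index some))
      ... | no none  = Σᶠ-0 {f = λ i → x i K.* coeff K n (r i) m} λ i → K.trans (K.*-congˡ (coeff-absent (r i) m (All.tabulate λ {t} t∈ t≐m →
        let st , tot = standard i t∈
            s , s∈ , t≗s = small-complete (proj₂ t) st (ℕ.≤-trans (ℕ.≤-reflexive tot) (mono-total i))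
        in none (List.lose s∈ (≗⇒≐ λ e → trans (sym (t≗s e)) (≐⇒≗ t≐m e)))))) (K.zeroʳ (x i))

      p∈I : p ∈ I
      p∈I = I-respects (⨁-I (λ i → scale (x i) ((K.1# , mono i) ∷ r i)) (λ i → I-scale (x i) (r∈ i))) λ m →
        K.trans (coeff-p m) (K.sym (K.trans (coeff-⨁ (λ i → scale (x i) ((K.1# , mono i) ∷ r i)) m)
          (K.trans (Σᶠ-cong {f = λ i → coeff K n (scale (x i) ((K.1# , mono i) ∷ r i)) m} {λ i → x i K.* head i m K.+ x i K.* coeff K n (r i) m} λ i → K.trans (coeff-scale (x i) ((K.1# , mono i) ∷ r i) m) (K.distribˡ _ _ _))
          (K.trans (Σᶠ-+ (λ i → x i K.* head i m) (λ i → x i K.* coeff K n (r i) m)) (K.trans (K.+-congˡ (tails-vanish m)) (K.+-identityʳ _))))))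

      p≉0 : ¬ (_≈ᵖ_ K n p [])
      p≉0 z = x≉0 (K.trans (K.sym (K.trans (coeff-p (mono i₀)) (K.trans (Σᶠ-remove (λ i → x i K.* head i (mono i₀)) i₀)
        (K.trans (K.+-cong (K.trans (K.*-congˡ (K.reflexive (cong (λ b → if b then K.1# else K.0#) (dec-true (mono i₀ ≐? mono i₀) (≗⇒≐ λ _ → refl))))) (K.*-identityʳ _))
          (Σᶠ-0 {f = λ i → x (Fin.punchIn i₀ i) K.* head (Fin.punchIn i₀ i) (mono i₀)} λ i → K.trans (K.*-congˡ (K.reflexive (cong (λ b → if b then K.1# else K.0#) (dec-false (mono (Fin.punchIn i₀ i) ≐? mono i₀) (mono-distinct _ _ (Fin.punchInᵢ≢i i₀ i)))))) (K.zeroʳ (x (Fin.punchIn i₀ i)))))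
        (K.+-identityʳ _))))) (z (mono i₀)))

      involved⊆ : ∀ e → Involves K n p e → ∃[ i ] mono i e ≢ 0
      involved⊆ e (m , m≉0 , me≢0) = Fin.¬∀⟶∃¬ (suc (length small)) (λ i → mono i e ≡ 0) (λ i → mono i e ℕ.≟ 0) λ vanish →
        m≉0 (K.trans (coeff-p m) (Σᶠ-0 {f = λ i → x i K.* head i m} λ i → K.trans (K.*-congˡ (K.reflexive (cong (λ b → if b then K.1# else K.0#)
          (dec-false (mono i ≐? m) λ i≐m → me≢0 (trans (sym (≐⇒≗ i≐m e)) (vanish i)))))) (K.zeroʳ (x i))))

    relation : ¬ ¬ (∃[ p ] p ∈ I × ¬ (_≈ᵖ_ K n p []) × (∀ e → Involves K n p e → ∃[ i ] mono i e ≢ 0))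
    relation κ = ¬¬-Fin (suc (length small)) (λ i → reduce (suc (wt crossingWeight (mono i))) (mono i) (ℕ.n<1+n _)) λ red →
      dependent (length small) (λ i j → coeff K n (proj₁ (red i)) (Data.List.Base.lookup small j)) λ { (x , (i₀ , x≉0) , eq) →
        let r = λ i → proj₁ (red i) ; st = λ i {t} → proj₁ (proj₂ (red i)) {t} ; r∈ = λ i → proj₂ (proj₂ (red i))
        in κ (p r (λ i {t} → st i {t}) r∈ x i₀ x≉0 eq , p∈I r (λ i {t} → st i {t}) r∈ x i₀ x≉0 eq , p≉0 r (λ i {t} → st i {t}) r∈ x i₀ x≉0 eq , involved⊆ r (λ i {t} → st i {t}) r∈ x i₀ x≉0 eq) }

  module _ {T : List (Edge n)} (T-unique : Unique T) (T-size : length T ≡ suc rank) where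

    private
      b d M : ℕ
      b = 2 ℕ.^ length (allEdges n) ℕ.* (2 ℕ.+ rank) ℕ.^ rank
      d = suc rank ℕ.* b
      small : List (Monomial n)
      small = smallMonomials d rank
      M = length small

    enough : suc M ℕ.≤ length (box b T)
    enough = ℕ.≤-trans (s≤s (smallMonomials-length {n} d rank)) (ℕ.≤-trans (box-outgrows (length (allEdges n)) rank)
      (ℕ.≤-reflexive (sym (trans (box-length b T) (cong (suc b ℕ.^_) T-size)))))

    mono : Fin (suc M) → Monomial n
    mono i = Data.List.Base.lookup (box b T) (Fin.inject≤ i enough)

    mono-∈ : ∀ i → mono i ∈ˡ box b T
    mono-∈ i = List.∈-lookup (Fin.inject≤ i enough)

    mono-distinct : ∀ i j → i ≢ j → ¬ (mono i ≐ mono j)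
    mono-distinct i j i≢j = AllPairs-lookup (λ ≢ eq → ≢ (≗⇒≐ λ e → sym (≐⇒≗ eq e))) (box-distinct b T T-unique) _ _
      (λ eq → i≢j (Fin.inject≤-injective enough enough i j eq))

    mono-total : ∀ i → total (mono i) ℕ.≤ d
    mono-total i = ℕ.≤-trans (box-total b T (mono-∈ i)) (ℕ.≤-reflexive (cong (ℕ._* b) T-size))

    oversized-dependent : ∀ (S : EdgeSet n) → (∀ {e} → e ∈ˡ T → e ∈ S) → ¬ Independent K n k S
    oversized-dependent S T⊆S independent = Elimination.relation d small
      (λ m standard le → smallMonomials-complete d rank m (free-size {support m} standard) le) mono mono-distinct mono-total
      λ { (p , p∈I , p≉0 , involves) → independent (p , p∈I , p≉0 , λ {e} → used e ∘ involves e) }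
      where
      used : ∀ e → ∃[ i ] mono i e ≢ 0 → e ∈ S
      used e (i , ≢0) with Any.any? (e ≟ᵉ_) T
      ... | yes e∈ = T⊆S e∈
      ... | no e∉  = contradiction (box-outside b T (mono-∈ i) e∉) ≢0

  triangulation⇒basis : ∀ (S : EdgeSet n) → IsTriangulation k S → IsBasis K n k S
  triangulation⇒basis S (S-free , S-maximal) = crossingFree⇒independent K n k 0<k 2k≤n S S-free , λ T T-independent S⊆T {e} e∈T → stable e λ e∉S →
    ¬¬-decide S λ { (σ , σ⇒S , S⇒σ) →
      let σ-free : Free k σ
          σ-free = λ { (E , cr , ps) → S-free (E , cr , All.map (σ⇒S _) ps) }
          σ-maximal : ∀ f → σ f ≡ false → ¬ Free k (adjoin σ f)
          σ-maximal f off free = contradiction (trans (sym (S⇒σ f (S-maximal (λ g → adjoin σ f g ≡ true) (λ { (E , cr , ps) → free (E , cr , ps) })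
            (λ {g} g∈S → adjoin-⊇ σ f g (S⇒σ g g∈S)) (adjoin-≡ σ f)))) off) λ ()
          e∉ : ∀ {f} → f ∈ˡ chosen σ → e ≢ f
          e∉ f∈ e≡f = e∉S (σ⇒S e (subst (λ f → σ f ≡ true) (sym e≡f) (∈-chosen⁻ σ f∈)))
      in oversized-dependent {e ∷ chosen σ} (All.tabulate e∉ ∷ Unique.filter⁺ _ (allEdges-unique n)) (cong suc (maximal-size {σ} σ-free σ-maximal)) T
        (λ { (here refl) → e∈T ; (there f∈) → S⊆T (σ⇒S _ (∈-chosen⁻ σ f∈)) }) T-independent }
    where
    -- The double negation of S is crossing-free, so S contains it.
    stable : ∀ e → ¬ ¬ (e ∈ S) → e ∈ S
    stable e = S-maximal (λ e → ¬ ¬ (e ∈ S)) (λ { (E , cr , ps) → ¬¬-gather ps λ ps′ → S-free (E , cr , ps′) }) (λ e∈ ¬e∈ → ¬e∈ e∈)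
      where
      ¬¬-gather : ∀ {E} → All (λ e → ¬ ¬ (e ∈ S)) E → ¬ ¬ All (_∈ S) E
      ¬¬-gather []       κ = κ []
      ¬¬-gather (p ∷ ps) κ = p λ q → ¬¬-gather ps λ qs → κ (q ∷ qs)

open import Data.Nat.Base using (_+_; _*_; _≤_)

corollary2p15 : ∀ {c ℓ₁ ℓ₂} (K : HeytingField c ℓ₁ ℓ₂) (k n : ℕ) →
    1 ≤ k → 2 * k + 2 ≤ n →
    (∀ (S : EdgeSet n) → CrossingFree (suc k) S → Independent K n k S)
    × (∀ (S : EdgeSet n) → IsTriangulation k S → IsBasis K n k S)
corollary2p15 K k n 1≤k 2k+2≤n = crossingFree⇒independent K n k 1≤k 2k≤n , Bases.triangulation⇒basis K n k 1≤k 2k≤n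
  where
  2k≤n : k + k ≤ n
  2k≤n = ℕ.≤-trans (ℕ.≤-trans (ℕ.≤-reflexive (cong (k +_) (sym (ℕ.+-identityʳ k)))) (ℕ.m≤m+n (2 * k) 2)) 2k+2≤n
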